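{- Let $A$ and $B$ be 0-1 matrices of sizes $p\times q$ and $q\times r$, respectively. Given parameters $\ell\in[p]$ and $k\in[r]$, the arithmetic matrix product $AB$ can be computed by a deterministic algorithm in time $$O\big(pq\ell+rqk+\min\{pr\,\lambda(A,\ell,\mathrm{row})+rq\ell,\; pr\,\lambda(B,k,\mathrm{col})+pqk\}\big).$$
   Context: For a positive integer $r$, $[r]=\{1,\dots,r\}$. The arithmetic matrix product $C=AB$ has entries $C_{ij}=\sum_{h=1}^q A_{ih}B_{hj}$ (over the integers). The Hamming distance $\mathrm{ham}(a,b)$ between $a,b\in\{0,1\}^q$ is the number of coordinates in which they differ. For a 0-1 $p\times q$ matrix $A$, $\lambda(A,\ell,\mathrm{row})$ is the minimum, over all sets $T$ of $\ell$ points of $\{0,1\}^q$, of $\max_{i\in[p]}\min_{u\in T}\mathrm{ham}(A_{i*},u)$, where $A_{i*}$ is the $i$-th row of $A$. For a 0-1 $q\times r$ matrix $B$, $\lambda(B,k,\mathrm{col})$ is the analogous minimum over sets of $k$ points of $\{0,1\}^q$ of the maximum Hamming distance from a column of $B$ to its closest point in the set. Running times are in the standard RAM model.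
   Formalization: The factors λ(A,ℓ,row) and λ(B,k,col) are replaced by max(1,λ): when λ=0 the stated bound can be smaller than the pr entries to be written (q=ℓ=k=1, p=r=n, all ones: O(n) against n² entries). -}

module Defs where

open import Data.Bool.Base using (Bool; true; false; if_then_else_; _xor_)
open import Data.Fin.Base using (Fin; toℕ)
open import Data.List.Base using (List; []; _∷_; _++_; map; allFin)
open import Data.List.Extrema.Nat using (min; max)
open import Data.Nat.Base using (ℕ; zero; suc; _+_; _*_; _∸_; _^_; _⊓_; _≤_; _≡ᵇ_)
open import Data.Product.Base using (_×_)
open import Data.Vec.Base as Vec using (Vec; lookup; tabulate; transpose)
open import Relation.Binary.PropositionalEquality.Core using (_≡_)

bit : Bool → ℕ
bit false = 0
bit true  = 1

Matrix01 : ℕ → ℕ → Set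
Matrix01 m n = Vec (Vec Bool n) m

-- All summands are non-negative, so the integer product has entries in ℕ.
product : ∀ {p q r} → Matrix01 p q → Matrix01 q r → Fin p → Fin r → ℕ
product A B i j =
  Vec.sum (tabulate λ h → bit (lookup (lookup A i) h) * bit (lookup (lookup B h) j))

ham : ∀ {q} → Vec Bool q → Vec Bool q → ℕ
ham a b = Vec.sum (Vec.map bit (Vec.zipWith _xor_ a b))

cube : ∀ q → List (Vec Bool q)
cube zero    = Vec.[] ∷ []
cube (suc q) = map (false Vec.∷_) (cube q) ++ map (true Vec.∷_) (cube q)

-- The m-element subsets of a duplicate-free list, each listed once.
subsetsOfSize : {X : Set} → ℕ → List X → List (List X)
subsetsOfSize zero    _        = [] ∷ []
subsetsOfSize (suc m) []       = []
subsetsOfSize (suc m) (x ∷ xs) = map (x ∷_) (subsetsOfSize m xs) ++ subsetsOfSize (suc m) xs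

-- max over rows i of min over u ∈ T of ham (A i) u.  The default values q of
-- `min` and 0 of `max` do not matter for nonempty T, as 0 ≤ ham ≤ q.
radius : ∀ {p q} → Matrix01 p q → List (Vec Bool q) → ℕ
radius {p} {q} A T = max 0 (map (λ i → min q (map (ham (lookup A i)) T)) (allFin p))

-- The minimum over all sets T of ℓ points of {0,1}^q.  The cube has only 2 ^ q
-- points; for ℓ > 2 ^ q the set T is the whole cube, so the minimum is never
-- over an empty family and its default value q does not matter.
λ-row : ∀ {p q} → Matrix01 p q → ℕ → ℕ
λ-row {q = q} A ℓ = min q (map (radius A) (subsetsOfSize (ℓ ⊓ 2 ^ q) (cube q)))

λ-col : ∀ {q r} → Matrix01 q r → ℕ → ℕ
λ-col B k = λ-row (transpose B) k

-- A unit-cost random access machine.  A program mentions finitely many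
-- registers; all addressing of the memory is indirect, through a register.

Reg : Set
Reg = ℕ

data Instr : Set where
  const         : (d : Reg) (n : ℕ) → Instr    -- d := n
  move          : (d a : Reg) → Instr          -- d := a
  add sub mul   : (d a b : Reg) → Instr        -- d := a ∘ b, with truncated subtraction
  load          : (d a : Reg) → Instr          -- d := mem[a]
  store         : (a b : Reg) → Instr          -- mem[a] := b
  jump          : (target : ℕ) → Instr
  jumpIfZero    : (a : Reg) (target : ℕ) → Instr
  halt          : Instr

Program : Set
Program = List Instr

record State : Set where
  constructor state
  field
    pc  : ℕ
    reg : ℕ → ℕ
    mem : ℕ → ℕ

open State public

_[_↦_] : (ℕ → ℕ) → ℕ → ℕ → ℕ → ℕ
(f [ a ↦ v ]) x = if x ≡ᵇ a then v else f x

nth : {X : Set} → X → List X → ℕ → X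
nth default []       _       = default
nth default (x ∷ xs) zero    = x
nth default (x ∷ xs) (suc n) = nth default xs n

-- Leaving the program text halts.
fetch : Program → State → Instr
fetch P s = nth halt P (pc s)

exec : Instr → State → State
exec (const d n)      (state c ρ m) = state (suc c) (ρ [ d ↦ n ]) m
exec (move d a)       (state c ρ m) = state (suc c) (ρ [ d ↦ ρ a ]) m
exec (add d a b)      (state c ρ m) = state (suc c) (ρ [ d ↦ ρ a + ρ b ]) m
exec (sub d a b)      (state c ρ m) = state (suc c) (ρ [ d ↦ ρ a ∸ ρ b ]) m
exec (mul d a b)      (state c ρ m) = state (suc c) (ρ [ d ↦ ρ a * ρ b ]) m
exec (load d a)       (state c ρ m) = state (suc c) (ρ [ d ↦ m (ρ a) ]) m
exec (store a b)      (state c ρ m) = state (suc c) ρ (m [ ρ a ↦ ρ b ])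
exec (jump l)         (state c ρ m) = state l ρ m
exec (jumpIfZero a l) (state c ρ m) = state (if ρ a ≡ᵇ 0 then l else suc c) ρ m
exec halt             s             = s

run : Program → ℕ → State → State
run P zero    s = s
run P (suc t) s = run P t (exec (fetch P s) s)

Halted : Program → State → Set
Halted P s = fetch P s ≡ halt

-- p, q, r, ℓ, k in registers 0 to 4; A and then B, row by row, from memory
-- address 0 on; zero everywhere else.
input : ∀ {p q r} → Matrix01 p q → Matrix01 q r → (ℓ k : ℕ) → State
input {p} {q} {r} A B ℓ k =
  state 0 (nth 0 (p ∷ q ∷ r ∷ ℓ ∷ k ∷ [])) (nth 0 (entries A ++ entries B))
  where
  entries : ∀ {m n} → Matrix01 m n → List ℕ
  entries M = Vec.toList (Vec.map bit (Vec.concat M))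

-- The matrix C is in memory, row by row, from the address in register 0 on.
Outputs : ∀ {p r} → State → (Fin p → Fin r → ℕ) → Set
Outputs {p} {r} s C = ∀ i j → mem s (reg s 0 + toℕ i * r + toℕ j) ≡ C i j

-- All words are at most W.  With W polynomial in the instance size this is the
-- logarithmic word length that makes unit cost per instruction realistic.
WordsBounded : ℕ → State → Set
WordsBounded W s = ∀ x → reg s x ≤ W × mem s x ≤ W

module Submission where

-- Farthest-first traversal of the rows of A yields ℓ centers and a radius ρ such that every row is
-- within ρ of a center, and the centers together with a farthest row are ℓ + 1 points at mutual
-- distance at least ρ. Two of these points share a closest point of an optimal set T, so
-- ρ ≤ 2 λ(A, ℓ, row). The rows of AB at the centers are computed directly from B; any other row of AB
-- differs from the one at its center by at most ρ signed rows of B. The same procedure applied to the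
-- transposed product has radius ρ′ ≤ 2 λ(B, k, col), and the machine takes the cheaper of
-- p r ρ + r q ℓ and p r ρ′ + p q k.

open import Data.Bool.Base using (Bool; T; _xor_; _∧_; false; if_then_else_; not; true)
open import Data.Bool.ListAction using (all)
open import Data.Empty using (⊥-elim)
import Data.Fin.Base as Fin
open import Data.Fin.Base using (Fin; fromℕ<; suc; toℕ; zero)
open import Data.Fin.Properties using (pigeonhole; toℕ-combine; toℕ-fromℕ<; toℕ<n)
import Data.List.Base as List
open import Data.List.Base using (List; []; _++_; _∷_; allFin; length; map; upTo)
open import Data.List.Extrema.Nat using (argmin-all; argmin-sel; min; min≤⊤; xs≤max)
open import Data.List.Membership.Propositional.Properties using (∈-allFin; ∈-map⁺; ∈-map⁻; ∈-upTo⁺)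
open import Data.List.Properties using (length-++)
import Data.List.Relation.Unary.All as All
open import Data.List.Relation.Unary.All using (All; []; _∷_)
import Data.List.Relation.Unary.All.Properties as All
import Data.List.Relation.Unary.Any as Any
open import Data.List.Relation.Unary.Any.Properties using (lookup-index)
open import Data.Nat.Base
open import Data.Nat.Properties
open import Data.Nat.Tactic.RingSolver using (solve-∀)
open import Data.Product.Base using (_,_; _×_; proj₁; proj₂; ∃-syntax)
open import Data.Sum.Base using (_⊎_; inj₁; inj₂)
open import Data.Unit.Base using (tt; ⊤)
import Data.Vec.Base as Vec
open import Data.Vec.Base using (Vec; []; _∷_; lookup; tabulate; transpose)
open import Data.Vec.Properties using (length-toList; lookup-concat; lookup-map; lookup-replicate; lookup-⊛)
open import Defs
open import Function.Base using (_∘_; id)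
open import Relation.Binary.Definitions using (tri<; tri>; tri≈)
open import Relation.Binary.PropositionalEquality
open import Relation.Nullary.Decidable.Core using (no; yes)
open import Relation.Nullary.Negation using (contradiction)

-- Unit cost comes with bounded words and truncated subtraction. Algorithms are therefore written in
-- a small structured language whose semantics counts machine steps exactly. Correctness and time
-- are proved by total-correctness triples; word size is proved apart from them, by a syntactic
-- discipline on registers that the compiled program meets by mere evaluation.
--
-- One program text serves both orientations: a matrix is a start address with two strides, so the
-- transposed product is only another setting of parameters. Both orientations are clustered to
-- measure their radii, but they share memory, so the chosen one is clustered again. The radius of
-- this second run is compared with the measured one by the same pigeonhole argument that compares ρ
-- with λ, at the price of another factor 2.
--
-- While a row is corrected, each cell still contains all terms of the reference row not yet
-- exchanged, so adding before subtracting never truncates.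
--
-- Writing out AB takes p r steps however small λ is; this is what the maximum with 1 in the bound
-- pays for.

update-same : ∀ (f : ℕ → ℕ) {x} a {v} → x ≡ a → (f [ a ↦ v ]) x ≡ v
update-same f a refl with a ≡ᵇ a in eq
... | true  = refl
... | false = ⊥-elim (subst T eq (≡⇒≡ᵇ a a refl))

update-other : ∀ (f : ℕ → ℕ) {x a v} → x ≢ a → (f [ a ↦ v ]) x ≡ f x
update-other f {x} {a} x≢a with x ≡ᵇ a in eq
... | true  = ⊥-elim (x≢a (≡ᵇ⇒≡ x a (subst T (sym eq) tt)))
... | false = refl

update-bound : ∀ {W} (f : ℕ → ℕ) {a v} → v ≤ W → (∀ x → f x ≤ W) → ∀ x → (f [ a ↦ v ]) x ≤ W
update-bound f {a} v≤W f≤W x with x ≡ᵇ a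
... | true  = v≤W
... | false = f≤W x

-- A structured language over the machine

-- Decrementing a loop counter passes through this register.
tmp : Reg
tmp = 20

infixr 5 _⨾_

data Cmd : Set where
  ops    : List Instr → Cmd
  _⨾_    : Cmd → Cmd → Cmd
  unless : Reg → Cmd → Cmd
  loop   : Reg → Cmd → Cmd

size : Cmd → ℕ
size (ops is)     = length is
size (c ⨾ d)      = size c + size d
size (unless a c) = suc (size c)
size (loop a c)   = suc (size c + 3)

compile : ℕ → Cmd → List Instr
compile o (ops is)     = is
compile o (c ⨾ d)      = compile o c ++ compile (o + size c) d
compile o (unless a c) = jumpIfZero a (o + suc (size c)) ∷ compile (suc o) c
compile o (loop a c)   =
  jumpIfZero a (o + suc (size c + 3)) ∷ compile (suc o) c ++ const tmp 1 ∷ sub a a tmp ∷ jump o ∷ []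

execs : List Instr → State → State
execs []       σ = σ
execs (i ∷ is) σ = execs is (exec i σ)

decrement : Reg → State → State
decrement a σ = execs (const tmp 1 ∷ sub a a tmp ∷ []) σ

-- The program counter of the states below carries no information.
eval    : Cmd → State → State
iterate : ℕ → Reg → Cmd → State → State

eval (ops is)     σ = execs is σ
eval (c ⨾ d)      σ = eval d (eval c σ)
eval (unless a c) σ = if reg σ a ≡ᵇ 0 then σ else eval c σ
eval (loop a c)   σ = iterate (reg σ a) a c σ

iterate zero    a c σ = σ
iterate (suc n) a c σ = iterate n a c (decrement a (eval c σ))

cost        : Cmd → State → ℕ
iterateCost : ℕ → Reg → Cmd → State → ℕ

cost (ops is)     σ = length is
cost (c ⨾ d)      σ = cost c σ + cost d (eval c σ)
cost (unless a c) σ = suc (if reg σ a ≡ᵇ 0 then 0 else cost c σ)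
cost (loop a c)   σ = iterateCost (reg σ a) a c σ

iterateCost zero    a c σ = 1
iterateCost (suc n) a c σ = suc (cost c σ + (3 + iterateCost n a c (decrement a (eval c σ))))

straight : Instr → Bool
straight (jump _)         = false
straight (jumpIfZero _ _) = false
straight halt             = false
straight _                = true

untouched : Instr → Reg → Bool
untouched (const d _) x = not (x ≡ᵇ d)
untouched (move d _)  x = not (x ≡ᵇ d)
untouched (add d _ _) x = not (x ≡ᵇ d)
untouched (sub d _ _) x = not (x ≡ᵇ d)
untouched (mul d _ _) x = not (x ≡ᵇ d)
untouched (load d _)  x = not (x ≡ᵇ d)
untouched _           x = true

-- Boolean, so that for a concrete command and register the proof that the register survives is
-- `tt`. This replaces frame conditions in all specifications below.
fresh : Cmd → Reg → Bool
fresh (ops is)     x = all (λ i → untouched i x) is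
fresh (c ⨾ d)      x = fresh c x ∧ fresh d x
fresh (unless a c) x = fresh c x
fresh (loop a c)   x = fresh c x ∧ not (x ≡ᵇ a) ∧ not (x ≡ᵇ tmp)

-- A loop body may not write its counter, and the counter may not be `tmp`. The number of iterations
-- is then the value of the counter on entry, as `eval` presumes.
wellFormed : Cmd → Bool
wellFormed (ops is)     = all straight is
wellFormed (c ⨾ d)      = wellFormed c ∧ wellFormed d
wellFormed (unless a c) = wellFormed c
wellFormed (loop a c)   = wellFormed c ∧ fresh c a ∧ not (a ≡ᵇ tmp)

-- A record rather than a bare function type, so that `c`, `σ` and `τ` can be inferred from a frame
-- that is passed around.
record Frame (c : Cmd) (σ τ : State) : Set where
  constructor framed
  field unchanged : ∀ x → T (fresh c x) → reg τ x ≡ reg σ x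

open Frame public

∧-left : ∀ {a b} → T (a ∧ b) → T a
∧-left {true} {true} _ = tt

∧-right : ∀ {a b} → T (a ∧ b) → T b
∧-right {true} {true} _ = tt

update-fresh : ∀ (f : ℕ → ℕ) x d {v} → T (not (x ≡ᵇ d)) → (f [ d ↦ v ]) x ≡ f x
update-fresh f x d h with x ≡ᵇ d
... | false = refl

exec-untouched : ∀ i x σ → T (untouched i x) → reg (exec i σ) x ≡ reg σ x
exec-untouched (const d _)      x σ h = update-fresh (reg σ) x d h
exec-untouched (move d _)       x σ h = update-fresh (reg σ) x d h
exec-untouched (add d _ _)      x σ h = update-fresh (reg σ) x d h
exec-untouched (sub d _ _)      x σ h = update-fresh (reg σ) x d h
exec-untouched (mul d _ _)      x σ h = update-fresh (reg σ) x d h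
exec-untouched (load d _)       x σ h = update-fresh (reg σ) x d h
exec-untouched (store _ _)      x σ h = refl
exec-untouched (jump _)         x σ h = refl
exec-untouched (jumpIfZero _ _) x σ h = refl
exec-untouched halt             x σ h = refl

decrement-fresh : ∀ x a σ → T (not (x ≡ᵇ a) ∧ not (x ≡ᵇ tmp)) → reg (decrement a σ) x ≡ reg σ x
decrement-fresh x a σ h =
  trans (update-fresh (reg (exec (const tmp 1) σ)) x a (∧-left h)) (update-fresh (reg σ) x tmp (∧-right {not (x ≡ᵇ a)} h))

eval-fresh    : ∀ c σ x → T (fresh c x) → reg (eval c σ) x ≡ reg σ x
iterate-fresh : ∀ n a c σ x → T (fresh (loop a c) x) → reg (iterate n a c σ) x ≡ reg σ x

eval-fresh (ops [])       σ x h = refl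
eval-fresh (ops (i ∷ is)) σ x h =
  trans (eval-fresh (ops is) (exec i σ) x (∧-right {untouched i x} h)) (exec-untouched i x σ (∧-left h))
eval-fresh (c ⨾ d)        σ x h =
  trans (eval-fresh d (eval c σ) x (∧-right {fresh c x} h)) (eval-fresh c σ x (∧-left h))
eval-fresh (unless a c)   σ x h with reg σ a ≡ᵇ 0
... | true  = refl
... | false = eval-fresh c σ x h
eval-fresh (loop a c)     σ x h = iterate-fresh (reg σ a) a c σ x h

iterate-fresh zero    a c σ x h = refl
iterate-fresh (suc n) a c σ x h =
  trans (iterate-fresh n a c _ x h)
    (trans (decrement-fresh x a (eval c σ) (∧-right {fresh c x} h)) (eval-fresh c σ x (∧-left h)))

frame : ∀ c σ → Frame c σ (eval c σ)
frame c σ = framed (eval-fresh c σ)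

counter-step : ∀ {n a c σ} → T (fresh c a ∧ not (a ≡ᵇ tmp)) → reg σ a ≡ suc n →
               reg (decrement a (eval c σ)) a ≡ n
counter-step {n} {a} {c} {σ} h eq =
  trans (update-same (reg (exec (const tmp 1) (eval c σ))) {a} a refl)
    (trans (cong (_∸ 1) (update-fresh (reg (eval c σ)) a tmp (∧-right {fresh c a} h)))
      (cong (_∸ 1) (trans (eval-fresh c σ a (∧-left h)) eq)))

-- Correctness of compilation

CodeAt : Program → ℕ → List Instr → Set
CodeAt P o []       = ⊤
CodeAt P o (i ∷ is) = nth halt P o ≡ i × CodeAt P (suc o) is

CodeAt-++ : ∀ {P} o is {js} → CodeAt P o (is ++ js) → CodeAt P o is × CodeAt P (o + length is) js
CodeAt-++ {P} o []       {js} h       = tt , subst (λ o′ → CodeAt P o′ js) (sym (+-identityʳ o)) h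
CodeAt-++ {P} o (i ∷ is) {js} (e , h) with CodeAt-++ (suc o) is h
... | h₁ , h₂ = (e , h₁) , subst (λ o′ → CodeAt P o′ js) (sym (+-suc o (length is))) h₂

CodeAt-refl : ∀ P → CodeAt P 0 P
CodeAt-refl P = shifted P P 0 λ _ → refl
  where
  shifted : ∀ P is o → (∀ n → nth halt P (o + n) ≡ nth halt is n) → CodeAt P o is
  shifted P []       o h = tt
  shifted P (i ∷ is) o h =
    trans (cong (nth halt P) (sym (+-identityʳ o))) (h 0) ,
    shifted P is (suc o) λ n → trans (cong (nth halt P) (sym (+-suc o n))) (h (suc n))

length-compile : ∀ o c → length (compile o c) ≡ size c
length-compile o (ops is)     = refl
length-compile o (c ⨾ d)      =
  trans (length-++ (compile o c)) (cong₂ _+_ (length-compile o c) (length-compile _ d))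
length-compile o (unless a c) = cong suc (length-compile (suc o) c)
length-compile o (loop a c)   =
  cong suc (trans (length-++ (compile (suc o) c)) (cong (_+ 3) (length-compile (suc o) c)))

at : ℕ → State → State
at o σ = state o (reg σ) (mem σ)

run-+ : ∀ P s t x → run P (s + t) x ≡ run P t (run P s x)
run-+ P zero    t x = refl
run-+ P (suc s) t x = run-+ P s t (exec (fetch P x) x)

exec-at : ∀ i o σ → T (straight i) → exec i (at o σ) ≡ at (suc o) (exec i σ)
exec-at (const d n) o σ _ = refl
exec-at (move d a)  o σ _ = refl
exec-at (add d a b) o σ _ = refl
exec-at (sub d a b) o σ _ = refl
exec-at (mul d a b) o σ _ = refl
exec-at (load d a)  o σ _ = refl
exec-at (store a b) o σ _ = refl

run-step : ∀ {P i} t x → nth halt P (pc x) ≡ i → run P (suc t) x ≡ run P t (exec i x)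
run-step {P} t x e = cong (λ i → run P t (exec i x)) e

module _ (P : Program) where

  execs-correct : ∀ is o σ → T (all straight is) → CodeAt P o is →
                  run P (length is) (at o σ) ≡ at (o + length is) (execs is σ)
  execs-correct []       o σ w h       = cong (λ o′ → at o′ σ) (sym (+-identityʳ o))
  execs-correct (i ∷ is) o σ w (e , h) =
    trans (run-step {P} (length is) (at o σ) e)
      (trans (cong (run P (length is)) (exec-at i o σ (∧-left w)))
        (trans (execs-correct is (suc o) (exec i σ) (∧-right {straight i} w) h)
          (cong (λ o′ → at o′ (execs is (exec i σ))) (sym (+-suc o (length is))))))

  -- Exact step counts let the runs of consecutive commands be joined by `run-+`; upper bounds enter
  -- only with `Exec`.
  compile-correct : ∀ c o σ → T (wellFormed c) → CodeAt P o (compile o c) →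
                    run P (cost c σ) (at o σ) ≡ at (o + size c) (eval c σ)

  -- The counter value is a separate argument `n`, which makes the mutual recursion structural: the
  -- state changes from one iteration to the next, while `n` decreases.
  iterate-correct : ∀ n a c o σ → T (wellFormed (loop a c)) → CodeAt P o (compile o (loop a c)) →
                    reg σ a ≡ n →
                    run P (iterateCost n a c σ) (at o σ) ≡ at (o + size (loop a c)) (iterate n a c σ)

  compile-correct (ops is) o σ w h = execs-correct is o σ w h
  compile-correct (c ⨾ d) o σ w h with CodeAt-++ o (compile o c) h
  ... | h₁ , h₂ =
    trans (run-+ P (cost c σ) _ (at o σ))
      (trans (cong (run P (cost d (eval c σ))) (compile-correct c o σ (∧-left w) h₁))
        (trans (compile-correct d (o + size c) (eval c σ) (∧-right {wellFormed c} w)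
                 (subst (λ l → CodeAt P (o + l) (compile (o + size c) d)) (length-compile o c) h₂))
          (cong (λ o′ → at o′ (eval d (eval c σ))) (+-assoc o (size c) (size d)))))
  compile-correct (unless a c) o σ w (e , h)
    rewrite run-step {P} (if reg σ a ≡ᵇ 0 then 0 else cost c σ) (at o σ) e
    with reg σ a ≡ᵇ 0
  ... | true  = refl
  ... | false = trans (compile-correct c (suc o) σ w h)
                  (cong (λ o′ → at o′ (eval c σ)) (sym (+-suc o (size c))))
  compile-correct (loop a c) o σ w h = iterate-correct (reg σ a) a c o σ w h refl

  iterate-correct zero a c o σ w (e , h) eq =
    trans (run-step {P} 0 (at o σ) e)
      (cong (λ z → state (if z ≡ᵇ 0 then o + size (loop a c) else suc o) (reg σ) (mem σ)) eq)
  iterate-correct (suc n) a c o σ w (e , h) eq with CodeAt-++ (suc o) (compile (suc o) c) h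
  ... | h₁ , h₂ with subst (λ l → CodeAt P (suc o + l) (const tmp 1 ∷ sub a a tmp ∷ jump o ∷ []))
                       (length-compile (suc o) c) h₂
  ...   | e₁ , e₂ , e₃ , _ = begin
    run P (suc (cost c σ + (3 + t))) (at o σ)
      ≡⟨ run-step {P} (cost c σ + (3 + t)) (at o σ) e ⟩
    run P (cost c σ + (3 + t)) (exec (jumpIfZero a (o + size (loop a c))) (at o σ))
      ≡⟨ cong (λ z → run P (cost c σ + (3 + t))
           (state (if z ≡ᵇ 0 then o + size (loop a c) else suc o) (reg σ) (mem σ))) eq ⟩
    run P (cost c σ + (3 + t)) (at (suc o) σ)
      ≡⟨ run-+ P (cost c σ) (3 + t) (at (suc o) σ) ⟩
    run P (3 + t) (run P (cost c σ) (at (suc o) σ))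
      ≡⟨ cong (run P (3 + t)) (compile-correct c (suc o) σ (∧-left w) h₁) ⟩
    run P (3 + t) (at o′ (eval c σ))
      ≡⟨ run-step {P} (2 + t) (at o′ (eval c σ)) e₁ ⟩
    run P (2 + t) (at (suc o′) (exec (const tmp 1) (eval c σ)))
      ≡⟨ run-step {P} (1 + t) (at (suc o′) (exec (const tmp 1) (eval c σ))) e₂ ⟩
    run P (1 + t) (at (2 + o′) σ′)
      ≡⟨ run-step {P} t (at (2 + o′) σ′) e₃ ⟩
    run P t (at o σ′)
      ≡⟨ iterate-correct n a c o σ′ w (e , h)
           (counter-step {n} {a} {c} {σ} (∧-right {wellFormed c} w) eq) ⟩
    at (o + size (loop a c)) (iterate n a c σ′) ∎
    where
    open ≡-Reasoning
    σ′ = decrement a (eval c σ)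
    o′ = suc o + size c
    t = iterateCost n a c σ′

-- Program logic

-- A total-correctness triple at a single start state. The exact cost is relaxed to a bound here, so
-- that constants can be rounded.
record Exec (c : Cmd) (σ : State) (t : ℕ) (Q : State → Set) : Set where
  constructor exec-by
  field
    post : Q (eval c σ)
    time : cost c σ ≤ t

open Exec public

weaken : ∀ {c σ t u Q} → t ≤ u → Exec c σ t Q → Exec c σ u Q
weaken t≤u (exec-by q h) = exec-by q (≤-trans h t≤u)

-- The frame is handed over together with the postcondition, here and in `execSeq`, so
-- postconditions mention only what a command changes.
conseq : ∀ {c σ t} {Q R : State → Set} → (∀ τ → Frame c σ τ → Q τ → R τ) → Exec c σ t Q → Exec c σ t R
conseq {c} {σ} f (exec-by q h) = exec-by (f _ (frame c σ) q) h

execOps : ∀ {is σ} {Q : State → Set} → Q (execs is σ) → Exec (ops is) σ (length is) Q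
execOps q = exec-by q ≤-refl

execOps⨾ : ∀ {is d σ t Q} → Exec d (execs is σ) t Q → Exec (ops is ⨾ d) σ (length is + t) Q
execOps⨾ {is} (exec-by q h) = exec-by q (+-monoʳ-≤ (length is) h)

execSeq : ∀ {c d σ t u} {R Q : State → Set} → Exec c σ t R →
          (∀ τ → Frame c σ τ → R τ → Exec d τ u Q) → Exec (c ⨾ d) σ (t + u) Q
execSeq {c} {d} {σ} (exec-by r h) f =
  exec-by (post e) (+-mono-≤ h (time e))
  where e = f (eval c σ) (frame c σ) r

execUnless : ∀ {a c σ t} {Q : State → Set} → (reg σ a ≡ 0 → Q σ) →
             (reg σ a ≢ 0 → Exec c σ t Q) → Exec (unless a c) σ (suc t) Q
execUnless {a} {c} {σ} {t} {Q} f g = exec-by post′ (s≤s time′)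
  where
  post′ : Q (if reg σ a ≡ᵇ 0 then σ else eval c σ)
  post′ with reg σ a
  ... | zero  = f refl
  ... | suc n = post (g λ ())
  time′ : (if reg σ a ≡ᵇ 0 then 0 else cost c σ) ≤ t
  time′ with reg σ a
  ... | zero  = z≤n
  ... | suc n = time (g λ ())

Σ[_] : ℕ → (ℕ → ℕ) → ℕ
Σ[ zero ]  f = 0
Σ[ suc n ] f = Σ[ n ] f + f n

Σ-cong : ∀ n {f g : ℕ → ℕ} → (∀ i → i < n → f i ≡ g i) → Σ[ n ] f ≡ Σ[ n ] g
Σ-cong zero    h = refl
Σ-cong (suc n) h = cong₂ _+_ (Σ-cong n λ i i<n → h i (m≤n⇒m≤1+n i<n)) (h n ≤-refl)

-- Sums peel off their last index, executions of a loop their first iteration.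
Σ-split : ∀ n (f : ℕ → ℕ) → Σ[ suc n ] f ≡ f 0 + Σ[ n ] (f ∘ suc)
Σ-split zero    f = +-comm 0 (f 0)
Σ-split (suc n) f = trans (cong (_+ f (suc n)) (Σ-split n f)) (+-assoc (f 0) _ _)

execIterate : ∀ {a c σ} → T (fresh c a ∧ not (a ≡ᵇ tmp)) →
              ∀ n (t : ℕ → ℕ) (I : ℕ → State → Set) τ →
              reg τ a ≡ n → Frame (loop a c) σ τ → I 0 τ →
              (∀ i υ → i < n → Frame (loop a c) σ υ → I i υ →
                 Exec c υ (t i) (λ ω → I (suc i) (decrement a ω))) →
              I n (iterate n a c τ) × iterateCost n a c τ ≤ suc (Σ[ n ] λ i → t i + 4)
execIterate             w zero    t I τ eq fr h step = h , ≤-refl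
execIterate {a} {c} {σ} w (suc n) t I τ eq fr h step = proj₁ rest , s≤s (begin
  cost c τ + (3 + iterateCost n a c τ′)       ≤⟨ +-mono-≤ (time e) (+-monoʳ-≤ 3 (proj₂ rest)) ⟩
  t 0 + (4 + Σ[ n ] λ i → t (suc i) + 4)      ≡⟨ +-assoc (t 0) 4 _ ⟨
  t 0 + 4 + (Σ[ n ] λ i → t (suc i) + 4)      ≡⟨ Σ-split n (λ i → t i + 4) ⟨
  Σ[ suc n ] (λ i → t i + 4)                  ∎)
  where
  open ≤-Reasoning
  e = step 0 τ z<s fr h
  τ′ = decrement a (eval c τ)
  rest = execIterate {a} {c} {σ} w n (t ∘ suc) (I ∘ suc) τ′ (counter-step {n} {a} {c} {τ} w eq)
           -- A body followed by the decrement is `iterate 1`, so freshness for the whole loop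
           -- already covers one round.
           (framed λ x u → trans (iterate-fresh 1 a c τ x u) (unchanged fr x u)) (post e)
           (λ i υ i<n → step (suc i) υ (s<s i<n))

-- The index of an invariant counts the iterations done.
execLoop : ∀ {a c σ n} (t : ℕ → ℕ) (I : ℕ → State → Set) {_ : T (fresh c a ∧ not (a ≡ᵇ tmp))} →
           reg σ a ≡ n → I 0 σ →
           (∀ i τ → i < n → Frame (loop a c) σ τ → I i τ →
              Exec c τ (t i) (λ υ → I (suc i) (decrement a υ))) →
           Exec (loop a c) σ (suc (Σ[ n ] λ i → t i + 4)) (I n)
execLoop {a} {c} {σ} t I {w} refl h step =
  exec-by (proj₁ all-steps) (proj₂ all-steps)
  where all-steps = execIterate {a} {c} {σ} w (reg σ a) t I σ refl (framed λ _ _ → refl) h step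

Σ-const : ∀ n c → Σ[ n ] (λ _ → c) ≡ n * c
Σ-const zero    c = refl
Σ-const (suc n) c = trans (cong (_+ c) (Σ-const n c)) (+-comm (n * c) c)

-- A round costs 4 beyond its body: the test, two instructions for the decrement and the jump. The
-- last, failing test is charged to one of the rounds, which needs `1 ≤ n` and turns 4 into 5.
execLoopConst : ∀ {a c σ n} (t : ℕ) (I : ℕ → State → Set) {_ : T (fresh c a ∧ not (a ≡ᵇ tmp))} →
                1 ≤ n → reg σ a ≡ n → I 0 σ →
                (∀ i τ → i < n → Frame (loop a c) σ τ → I i τ →
                   Exec c τ t (λ υ → I (suc i) (decrement a υ))) →
                Exec (loop a c) σ (n * (t + 5)) (I n)
execLoopConst {n = n} t I {w} 1≤n eq h step = weaken bound (execLoop (λ _ → t) I {w} eq h step)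
  where
  open ≤-Reasoning
  bound : suc (Σ[ n ] λ _ → t + 4) ≤ n * (t + 5)
  bound = begin
    suc (Σ[ n ] λ _ → t + 4) ≡⟨ cong suc (Σ-const n (t + 4)) ⟩
    1 + n * (t + 4)          ≤⟨ +-monoˡ-≤ _ 1≤n ⟩
    n + n * (t + 4)          ≡⟨ *-suc n (t + 4) ⟨
    n * suc (t + 4)          ≡⟨ cong (n *_) (+-suc t 4) ⟨
    n * (t + 5)              ∎

-- Word length

-- A register of level v ≤ 2 never exceeds M ^ (1 + v), where M bounds the parameters; the
-- registers of level 3, like the memory, grow by at most M ^ 3 in each step.
level : Reg → ℕ
level x = if x <ᵇ 14 then 0 else
          if x <ᵇ 20 then 3 else
          if x <ᵇ 30 then 0 else
          if x <ᵇ 32 then 1 else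
          if x <ᵇ 34 then 2 else 3

-- Repeated squaring and doubling are what must be excluded. A product lands on a higher level than
-- its first factor, and its second factor has level 0. A sum lands on level 3, and its second
-- operand has level at most 2, so it adds at most M ^ 3. Truncated subtraction is bounded by its
-- first operand alone, whatever the level of the second; this is the only way down from level 3.
levelled : Instr → Bool
levelled (const d n) = n ≤ᵇ 1
levelled (move d a)  = level a ≤ᵇ level d
levelled (add d a b) = (3 ≤ᵇ level d) ∧ (level b ≤ᵇ 2)
levelled (sub d a b) = level a ≤ᵇ level d
levelled (mul d a b) = (level a <ᵇ level d) ∧ (level b ≤ᵇ 0) ∧ (level a ≤ᵇ 1)
levelled (load d a)  = 3 ≤ᵇ level d
levelled _           = true

cap : ℕ → ℕ → ℕ → ℕ
cap M V 0 = M
cap M V 1 = M * M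
cap M V 2 = M * M * M
cap M V _ = V

record Capped (M V : ℕ) (σ : State) : Set where
  constructor capped
  field
    regs   : ∀ x → reg σ x ≤ cap M V (level x)
    cells  : ∀ x → mem σ x ≤ V
    cube≤  : M * M * M ≤ V

module _ {M : ℕ} (1≤M : 1 ≤ M) where

  M≤M² : M ≤ M * M
  M≤M² = m≤n*m M M {{>-nonZero 1≤M}}

  M²≤M³ : M * M ≤ M * M * M
  M²≤M³ = m≤m*n (M * M) M {{>-nonZero 1≤M}}

  cap-mono : ∀ {V} v w → M * M * M ≤ V → v ≤ w → cap M V v ≤ cap M V w
  cap-mono 0 0 h _ = ≤-refl
  cap-mono 0 1 h _ = M≤M²
  cap-mono 0 2 h _ = ≤-trans M≤M² M²≤M³
  cap-mono 0 (suc (suc (suc w))) h _ = ≤-trans (≤-trans M≤M² M²≤M³) h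
  cap-mono 1 0 h ()
  cap-mono 1 1 h _ = ≤-refl
  cap-mono 1 2 h _ = M²≤M³
  cap-mono 1 (suc (suc (suc w))) h _ = ≤-trans M²≤M³ h
  cap-mono 2 0 h ()
  cap-mono 2 1 h (s≤s ())
  cap-mono 2 2 h _ = ≤-refl
  cap-mono 2 (suc (suc (suc w))) h _ = h
  cap-mono (suc (suc (suc v))) (suc (suc (suc w))) h _ = ≤-refl
  cap-mono (suc (suc (suc v))) 0 h ()
  cap-mono (suc (suc (suc v))) 1 h (s≤s ())
  cap-mono (suc (suc (suc v))) 2 h (s≤s (s≤s ()))

  cap-grow : ∀ {V V′} v → V ≤ V′ → cap M V v ≤ cap M V′ v
  cap-grow 0 h = ≤-refl
  cap-grow 1 h = ≤-refl
  cap-grow 2 h = ≤-refl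
  cap-grow (suc (suc (suc v))) h = h

  cap-mul : ∀ {V} v {x y} → M * M * M ≤ V → v ≤ 1 → x ≤ cap M V v → y ≤ M → x * y ≤ cap M V (suc v)
  cap-mul 0 h _ hx hy = *-mono-≤ hx hy
  cap-mul 1 h _ hx hy = *-mono-≤ hx hy
  cap-mul (suc (suc v)) h (s≤s ()) hx hy

  cap≤V : ∀ {V} v → M * M * M ≤ V → cap M V v ≤ V
  cap≤V {V} v h = cap-mono v (3 + v) h (m≤n+m v 3)

  cap-small : ∀ {V} v → v ≤ 2 → cap M V v ≤ M * M * M
  cap-small 0 _ = ≤-trans M≤M² M²≤M³
  cap-small 1 _ = M²≤M³
  cap-small 2 _ = ≤-refl
  cap-small (suc (suc (suc v))) (s≤s (s≤s ()))

  cap-≥3 : ∀ {V} v → 3 ≤ v → cap M V v ≡ V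
  cap-≥3 (suc (suc (suc v))) _ = refl
  cap-≥3 2 (s≤s (s≤s ()))
  cap-≥3 1 (s≤s ())
  cap-≥3 0 ()

  private
    grow : ∀ {V} → V ≤ V + M * M * M
    grow {V} = m≤m+n V _

  regs-update : ∀ {V} (f : ℕ → ℕ) d {v} → v ≤ cap M (V + M * M * M) (level d) →
                (∀ x → f x ≤ cap M V (level x)) →
                ∀ x → (f [ d ↦ v ]) x ≤ cap M (V + M * M * M) (level x)
  regs-update f d hv h x with x ≡ᵇ d in eq
  ... | false = ≤-trans (h x) (cap-grow (level x) grow)
  ... | true  = subst (λ y → _ ≤ cap M _ (level y)) (sym (≡ᵇ⇒≡ x d (subst T (sym eq) tt))) hv

  exec-capped : ∀ {V} i σ → T (levelled i) → Capped M V σ → Capped M (V + M * M * M) (exec i σ)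
  exec-capped {V} i σ h (capped r c u) = go i h
    where
    write : ∀ {n} d v → v ≤ cap M (V + M * M * M) (level d) →
            Capped M (V + M * M * M) (state n (reg σ [ d ↦ v ]) (mem σ))
    write d v hv = capped (regs-update (reg σ) d hv r) (λ x → ≤-trans (c x) grow) (≤-trans u grow)
    same : ∀ {n} → Capped M (V + M * M * M) (state n (reg σ) (mem σ))
    same = capped (λ x → ≤-trans (r x) (cap-grow (level x) grow))
                  (λ x → ≤-trans (c x) grow) (≤-trans u grow)
    below : ∀ a d {x} → T (level a ≤ᵇ level d) → x ≤ cap M V (level a) → x ≤ cap M (V + M * M * M) (level d)
    below a d h hx = ≤-trans hx
      (≤-trans (cap-mono (level a) (level d) u (≤ᵇ⇒≤ _ _ h)) (cap-grow (level d) grow))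
    go : ∀ i → T (levelled i) → Capped M (V + M * M * M) (exec i σ)
    go (const d n)      h = write d n (≤-trans (≤-trans (≤ᵇ⇒≤ _ _ h) 1≤M)
                              (cap-mono 0 (level d) (≤-trans u grow) z≤n))
    go (move d a)       h = write d _ (below a d h (r a))
    go (add d a b)      h = write d _ (≤-trans
      (+-mono-≤ (≤-trans (r a) (cap≤V (level a) u))
                (≤-trans (r b) (cap-small (level b) (≤ᵇ⇒≤ _ _ (∧-right {3 ≤ᵇ level d} h)))))
      (≤-reflexive (sym (cap-≥3 (level d) (≤ᵇ⇒≤ _ _ (∧-left h))))))
    go (sub d a b)      h = write d _ (below a d h (≤-trans (m∸n≤m (reg σ a) (reg σ b)) (r a)))
    go (mul d a b)      h = write d _ (≤-trans
      (cap-mul (level a) u (≤ᵇ⇒≤ (level a) 1 (∧-right {level b ≤ᵇ 0} h′)) (r a)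
        (subst (λ v → reg σ b ≤ cap M V v) (n≤0⇒n≡0 (≤ᵇ⇒≤ (level b) 0 (∧-left h′))) (r b)))
      (≤-trans (cap-mono (suc (level a)) (level d) u (<ᵇ⇒< _ _ (∧-left h))) (cap-grow (level d) grow)))
      where h′ = ∧-right {level a <ᵇ level d} h
    go (load d a)       h = write d _ (≤-trans (≤-trans (c _) grow)
                              (≤-reflexive (sym (cap-≥3 (level d) (≤ᵇ⇒≤ _ _ h)))))
    go (store a b)      h = capped (λ x → ≤-trans (r x) (cap-grow (level x) grow))
      (update-bound (mem σ) (≤-trans (≤-trans (r b) (cap≤V (level b) u)) grow) (λ x → ≤-trans (c x) grow))
      (≤-trans u grow)
    go (jump l)         h = same
    go (jumpIfZero a l) h = same
    go halt             h = same

  run-capped : ∀ {V} P σ t → T (all levelled P) → Capped M V σ → Capped M (V + t * (M * M * M)) (run P t σ)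
  run-capped {V} P σ zero    h b = subst (λ V → Capped M V σ) (sym (+-identityʳ V)) b
  run-capped {V} P σ (suc t) h b =
    subst (λ V → Capped M V (run P t (exec (fetch P σ) σ))) (+-assoc V _ _)
      (run-capped P _ t h (exec-capped (fetch P σ) σ (fetched P (pc σ) h) b))
    where
    fetched : ∀ P n → T (all levelled P) → T (levelled (nth halt P n))
    fetched []      n       h = tt
    fetched (i ∷ P) zero    h = ∧-left h
    fetched (i ∷ P) (suc n) h = fetched P n (∧-right {levelled i} h)

  capped-words : ∀ {V σ} → Capped M V σ → WordsBounded V σ
  capped-words (capped r c u) x = ≤-trans (r x) (cap≤V (level x) u) , c x

-- Farthest-first clustering and multiplication by corrections

rP rQ rR rL₁ rL₂ : Reg
rP = 0 ; rQ = 1 ; rR = 2 ; rL₁ = 3 ; rL₂ = 4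

-- The current mode: an rN × q matrix X, a q × rM matrix Y (each given by its first address and
-- its row and column strides), the number rL of centers, the strides of the result XY when read
-- as AB, and the addresses of the free memory, of the center slots, of the table and of XY.
rN rM rL rXR rXC rYR rYC rZR rZC rX rY rF rD rT rZ : Reg
rN = 5 ; rM = 6 ; rL = 7
rXR = 8 ; rXC = 9 ; rYR = 10 ; rYC = 11 ; rZR = 12 ; rZC = 13
rX = 14 ; rY = 15 ; rF = 16 ; rD = 17 ; rT = 18 ; rZ = 19

bx bw by plus minus rρ₁ rρ₂ rBS rRS : Reg
bx = 21 ; bw = 22 ; by = 23 ; plus = 24 ; minus = 25
rρ₁ = 26 ; rρ₂ = 27 ; rBS = 28 ; rRS = 29

area₁ area₂ vol₁ vol₂ : Reg
area₁ = 30 ; area₂ = 31 ; vol₁ = 32 ; vol₂ = 33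

val u v dist far cur maxd xp tp tq dp e row base ref wp yp yq rB cost₁ cost₂ select : Reg
val = 34 ; u = 35 ; v = 36 ; dist = 37 ; far = 38 ; cur = 39 ; maxd = 40 ; xp = 41 ; tp = 42
tq = 43 ; dp = 44 ; e = 45 ; row = 46 ; base = 47 ; ref = 48 ; wp = 49 ; yp = 50 ; yq = 51
rB = 52 ; cost₁ = 53 ; cost₂ = 54 ; select = 55

i₁ i₂ i₃ : Reg
i₁ = 60 ; i₂ = 61 ; i₃ = 62

-- bx := mem[u] and bw := mem[v] for bits; subtracting twice from 1 keeps them at level 0.
loadBits : List Instr
loadBits = load val u ∷ const tmp 1 ∷ sub bx tmp val ∷ sub bx tmp bx ∷
           load val v ∷ sub bw tmp val ∷ sub bw tmp bw ∷
           sub plus bx bw ∷ sub minus bw bx ∷ []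

hamming : Cmd
hamming = loop i₃ (ops (loadBits ++
  add dist dist plus ∷ add dist dist minus ∷ add u u rXC ∷ add v v rXC ∷ []))

-- A table entry is a distance and the address of the slot of a center.
updateEntry : Cmd
updateEntry =
  ops (const dist 0 ∷ move u xp ∷ move v cur ∷ move i₃ rQ ∷ []) ⨾
  hamming ⨾
  ops (load e tp ∷ sub val e dist ∷ const tmp 1 ∷ add tq tp tmp ∷ []) ⨾
  unless val (ops (store tp dist ∷ store tq dp ∷ [])) ⨾
  ops (load e tp ∷ sub val e maxd ∷ []) ⨾
  unless val (ops (move maxd e ∷ move far xp ∷ [])) ⨾
  ops (const tmp 1 ∷ add tp tq tmp ∷ add xp xp rXR ∷ [])

-- A slot is the address of a row of X and then the same row of XY.
addCenter : Cmd
addCenter =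
  ops (store dp far ∷ move cur far ∷ const maxd 0 ∷ move xp rX ∷ move tp rT ∷ move i₂ rN ∷ []) ⨾
  loop i₂ updateEntry ⨾
  ops (const tmp 1 ∷ add dp dp rM ∷ add dp dp tmp ∷ [])

cluster : Cmd
cluster =
  ops (move tp rT ∷ move i₁ rN ∷ []) ⨾
  -- The initial entry claims distance `q` to the first slot. Comparison is strict, so a row at
  -- distance exactly `q` from the first center keeps this entry, and the claim must be correct for
  -- it.
  loop i₁ (ops (store tp rQ ∷ const tmp 1 ∷ add tp tp tmp ∷ store tp rD ∷ add tp tp tmp ∷ [])) ⨾
  ops (move far rX ∷ move maxd rQ ∷ move dp rD ∷ move i₁ rL ∷ []) ⨾
  loop i₁ addCenter

copyRow : Cmd
copyRow = loop i₂ (ops (load val u ∷ store wp val ∷ const tmp 1 ∷ add wp wp tmp ∷ add u u rBS ∷ []))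

-- Addition comes before subtraction because subtraction truncates. The product of two bits is
-- obtained as `x ∸ (1 ∸ y)`, which stays at level 0 although the bit of Y comes from memory.
addProduct : Cmd
addProduct = loop i₃ (ops
  (load val yq ∷ const tmp 1 ∷ sub by tmp val ∷ load e wp ∷ sub plus bx by ∷ sub minus bw by ∷
   add e e plus ∷ sub e e minus ∷ store wp e ∷ add wp wp tmp ∷ add yq yq rYC ∷ []))

-- A row of Y is touched only where the two bits differ, so the expensive inner loop runs once per
-- unit of Hamming distance.
correctRow : Cmd
correctRow = loop i₂
  (ops (loadBits ++ move val plus ∷ add val val minus ∷ []) ⨾
   unless val (ops (move wp row ∷ move yq yp ∷ move i₃ rM ∷ []) ⨾ addProduct) ⨾
   ops (add u u rXC ∷ add v v rRS ∷ add yp yp rYR ∷ []))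

computeRow : Cmd
computeRow =
  ops (move wp row ∷ move u base ∷ move i₂ rM ∷ []) ⨾ copyRow ⨾
  ops (move u xp ∷ move v ref ∷ move yp rY ∷ move i₂ rQ ∷ []) ⨾ correctRow

-- With both strides 0, the single zero cell at `rF` acts as an all-zero reference row and as its
-- all-zero product. Direct computation thereby becomes a special case of `computeRow`.
centerRows : Cmd
centerRows =
  ops (const tmp 0 ∷ store rF tmp ∷ const rBS 0 ∷ const rRS 0 ∷ move base rF ∷ move ref rF ∷
       move row rD ∷ move i₁ rL ∷ []) ⨾
  loop i₁ (ops (load xp row ∷ const tmp 1 ∷ add row row tmp ∷ []) ⨾ computeRow ⨾
           ops (add row row rM ∷ []))

allRows : Cmd
allRows =
  ops (const rBS 1 ∷ move rRS rXC ∷ move row rZ ∷ move tp rT ∷ move xp rX ∷ move i₁ rN ∷ []) ⨾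
  loop i₁ (ops (const tmp 1 ∷ add tp tp tmp ∷ load base tp ∷ add tp tp tmp ∷ load ref base ∷
                add base base tmp ∷ []) ⨾
           computeRow ⨾
           ops (add row row rM ∷ add xp xp rXR ∷ []))

output : Cmd
output =
  ops (const wp 0 ∷ move v rZ ∷ move i₁ rP ∷ []) ⨾
  loop i₁ (ops (move u v ∷ move i₂ rR ∷ []) ⨾
           loop i₂ (ops (load val u ∷ store wp val ∷ const tmp 1 ∷ add wp wp tmp ∷ add u u rZC ∷ [])) ⨾
           ops (add v v rZR ∷ []))

-- The free memory starts behind A, B and AB.
start : Cmd
start = ops
  (mul area₁ rP rQ ∷ move rB area₁ ∷ move rF area₁ ∷ mul area₁ rQ rR ∷ add rF rF area₁ ∷
   mul area₁ rP rR ∷ add rF rF area₁ ∷ [])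

-- From `rF` on: the zero cell, `rL` slots of `rM` + 1 cells, `rN` table entries of 2 cells, and XY.
-- The slots are allotted as `rL` times `rM` plus `rL`, since the levels only admit `rM` itself as a
-- factor.
allocate : List Instr
allocate =
  const tmp 1 ∷ add rD rF tmp ∷ mul area₁ rL rM ∷ add rT rD area₁ ∷ add rT rT rL ∷
  add rZ rT rN ∷ add rZ rZ rN ∷ []

rowMode colMode : Cmd
rowMode = ops
  (move rN rP ∷ move rM rR ∷ move rL rL₁ ∷ move rXR rQ ∷ const rXC 1 ∷ move rYR rR ∷ const rYC 1 ∷
   move rZR rR ∷ const rZC 1 ∷ const rX 0 ∷ move rY rB ∷ allocate)
colMode = ops
  (move rN rR ∷ move rM rP ∷ move rL rL₂ ∷ const rXR 1 ∷ move rXC rR ∷ const rYR 1 ∷ move rYC rQ ∷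
   const rZR 1 ∷ move rZC rP ∷ move rX rB ∷ const rY 0 ∷ allocate)

compareCosts : Cmd
compareCosts = ops
  (mul area₁ rP rR ∷ mul vol₁ area₁ rρ₁ ∷ mul area₂ rQ rR ∷ mul vol₂ area₂ rL₁ ∷
   move cost₁ vol₁ ∷ add cost₁ cost₁ vol₂ ∷
   mul vol₁ area₁ rρ₂ ∷ mul area₂ rP rQ ∷ mul vol₂ area₂ rL₂ ∷
   move cost₂ vol₁ ∷ add cost₂ cost₂ vol₂ ∷
   sub select cost₂ cost₁ ∷ [])

-- Since `maxd` is at most `q`, subtracting twice from `q` copies it to a register of level 0; only
-- there may it be multiplied when costs are compared.
saveRadius : Reg → Cmd
saveRadius ρ = ops (sub val rQ maxd ∷ sub ρ rQ val ∷ [])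

measure : Cmd → Reg → Cmd
measure mode ρ = mode ⨾ cluster ⨾ saveRadius ρ

-- The conditional has one branch only, so the column mode is set first and overwritten if the row
-- mode is cheaper.
chooseMode : Cmd
chooseMode = compareCosts ⨾ colMode ⨾ unless select rowMode

-- Clustering is repeated because measuring the second mode overwrote the table and slots of the
-- first. The final constant is the output address: register 0 is `rP`.
solveMode : Cmd
solveMode = cluster ⨾ centerRows ⨾ allRows ⨾ output ⨾ ops (const rP 0 ∷ [])

multiply : Cmd
multiply = start ⨾ measure rowMode rρ₁ ⨾ measure colMode rρ₂ ⨾ chooseMode ⨾ solveMode

-- Distances and slices of memory

Σ-mono : ∀ n {f g : ℕ → ℕ} → (∀ i → i < n → f i ≤ g i) → Σ[ n ] f ≤ Σ[ n ] g
Σ-mono zero    h = z≤n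
Σ-mono (suc n) h = +-mono-≤ (Σ-mono n λ i i<n → h i (m≤n⇒m≤1+n i<n)) (h n ≤-refl)

diff : ℕ → ℕ → ℕ
diff x w = (x ∸ w) + (w ∸ x)

distance : ℕ → (ℕ → ℕ) → (ℕ → ℕ) → ℕ
distance q x w = Σ[ q ] (λ h → diff (x h) (w h))

record Slice (m : ℕ → ℕ) (a s n : ℕ) (x : ℕ → ℕ) : Set where
  constructor slice
  field
    cells : ∀ h → h < n → m (a + h * s) ≡ x h
    bits  : ∀ h → h < n → x h ≤ 1

advance : ∀ a i s {b} → b ≡ a + i * s → b + s ≡ a + suc i * s
advance a i s refl = trans (+-assoc a (i * s) s) (cong (a +_) (+-comm (i * s) s))

-- Distances and table entries

module Core (σ₀ : State) where

  N M L Q : ℕ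
  N = reg σ₀ rN
  M = reg σ₀ rM
  L = reg σ₀ rL
  Q = reg σ₀ rQ

  -- Here `σ₀` is a list of the parameters of a mode, not a state of the run; `Params` says that a
  -- state of the run still has these parameters.
  record Params (σ : State) : Set where
    constructor params
    field param : ∀ x → {_ : T (x <ᵇ 20)} → reg σ x ≡ reg σ₀ x

  open Params public

  keep : ∀ {c σ τ} → {h : T (all (fresh c) (upTo 20))} → Frame c σ τ → Params σ → Params τ
  keep {c} {h = h} fr P = params λ x {x<20} →
    trans (unchanged fr x (All.lookup (All.all⁺ (fresh c) (upTo 20) h) (∈-upTo⁺ (<ᵇ⇒< x 20 x<20)))) (param P x {x<20})

  keepOps : ∀ is {σ} → {h : T (all (fresh (ops is)) (upTo 20))} → Params σ → Params (execs is σ)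
  keepOps is {σ} {h} = keep {h = h} (frame (ops is) σ)

  hamming-exec : ∀ {σ x w} → 1 ≤ Q → Params σ → reg σ i₃ ≡ Q → reg σ dist ≡ 0 →
                 Slice (mem σ) (reg σ u) (reg σ₀ rXC) Q x → Slice (mem σ) (reg σ v) (reg σ₀ rXC) Q w →
                 Exec hamming σ (Q * 18) (λ τ → reg τ dist ≡ distance Q x w × mem τ ≡ mem σ)
  hamming-exec {σ} {x} {w} 1≤Q P cnt d0 X W =
    conseq (λ τ _ (_ , _ , d , m) → d , m) (execLoopConst 13 I 1≤Q cnt (init , init′ , d0 , refl) step)
    where
    s = reg σ₀ rXC
    I : ℕ → State → Set
    I i τ = reg τ u ≡ reg σ u + i * s × reg τ v ≡ reg σ v + i * s ×
            reg τ dist ≡ distance i x w × mem τ ≡ mem σ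
    init  = sym (+-identityʳ (reg σ u))
    init′ = sym (+-identityʳ (reg σ v))
    step : ∀ i τ → i < Q → Frame hamming σ τ → I i τ → _
    step i τ i<Q fr (eu , ev , ed , em) = execOps
      ( trans (cong (reg τ u +_) xc) (advance _ i s eu)
      , trans (cong (reg τ v +_) xc) (advance _ i s ev)
      , trans (+-assoc (reg τ dist) _ _) (cong₂ _+_ ed (cong₂ diff ex ew))
      , em )
      where
      xc = param (keep fr P) rXC
      ex : 1 ∸ (1 ∸ mem τ (reg τ u)) ≡ x i
      ex = trans (cong₂ (λ m a → 1 ∸ (1 ∸ m a)) em eu)
             (trans (cong (λ b → 1 ∸ (1 ∸ b)) (Slice.cells X i i<Q)) (m∸[m∸n]≡n (Slice.bits X i i<Q)))
      ew : 1 ∸ (1 ∸ mem τ (reg τ v)) ≡ w i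
      ew = trans (cong₂ (λ m a → 1 ∸ (1 ∸ m a)) em ev)
             (trans (cong (λ b → 1 ∸ (1 ∸ b)) (Slice.cells W i i<Q)) (m∸[m∸n]≡n (Slice.bits W i i<Q)))

n≢n+1 : ∀ n → n ≢ n + 1
n≢n+1 n eq = 1+n≢n (trans (+-comm 1 n) (sym eq))

-- Constant overhead is charged to a loop that runs at least once. The growing constants in the time
-- bounds below come from iterating this through nested loops.
absorb : ∀ {n} a b → 1 ≤ n → a + n * b ≤ n * (a + b)
absorb {n} a b 1≤n = begin
  a + n * b       ≤⟨ +-monoˡ-≤ (n * b) (m≤n*m a n {{>-nonZero 1≤n}}) ⟩
  n * a + n * b   ≡⟨ *-distribˡ-+ n a b ⟨
  n * (a + b)     ∎
  where open ≤-Reasoning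

module _ (σ₀ : State) where
  open Core σ₀

  record Updated (h : ℕ) (σ τ : State) : Set where
    private t = reg σ tp
    field
      tp≡      : reg τ tp ≡ reg σ tp + 1 + 1
      xp≡      : reg τ xp ≡ reg σ xp + reg σ₀ rXR
      others   : ∀ a → a ≢ t → a ≢ t + 1 → mem τ a ≡ mem σ a
      ≤new     : mem τ t ≤ h
      ≤old     : mem τ t ≤ mem σ t
      slot     : (mem τ (t + 1) ≡ mem σ (t + 1) × mem τ t ≡ mem σ t)
               ⊎ (mem τ (t + 1) ≡ reg σ dp × mem τ t ≡ h)
      maxd-≥   : reg σ maxd ≤ reg τ maxd
      ≤maxd    : mem τ t ≤ reg τ maxd
      farthest : (reg τ far ≡ reg σ far × reg τ maxd ≡ reg σ maxd)
               ⊎ (reg τ far ≡ reg σ xp × reg τ maxd ≡ mem τ t)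

  updateEntry-exec : ∀ {σ x w} → 1 ≤ Q → Params σ →
                     Slice (mem σ) (reg σ xp) (reg σ₀ rXC) Q x →
                     Slice (mem σ) (reg σ cur) (reg σ₀ rXC) Q w →
                     Exec updateEntry σ (Q * 37) (Updated (distance Q x w) σ)
  updateEntry-exec {σ} {x} {w} 1≤Q P X W = weaken bound
    (execOps⨾ (execSeq (hamming-exec 1≤Q (keepOps initial P) (param P rQ) refl X W)
      λ τ₁ fr₁ (ed , em) → execOps⨾ (execSeq (relax τ₁ fr₁ ed em)
      λ τ₂ fr₂ S → execOps⨾ (execSeq (record-far τ₁ fr₁ τ₂ fr₂ S)
      λ τ₃ fr₃ S′ → execOps (finish τ₁ fr₁ τ₂ fr₂ S τ₃ fr₃ S′)))))
    where
    initial afterHamming compareMax : List Instr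
    initial = const dist 0 ∷ move u xp ∷ move v cur ∷ move i₃ rQ ∷ []
    afterHamming = load e tp ∷ sub val e dist ∷ const tmp 1 ∷ add tq tp tmp ∷ []
    compareMax = load e tp ∷ sub val e maxd ∷ []
    t = reg σ tp
    h = distance Q x w
    bound : 4 + (Q * 18 + 15) ≤ Q * 37
    bound = subst (_≤ Q * 37) (cong (4 +_) (+-comm 15 (Q * 18))) (absorb 19 18 1≤Q)
    Relaxed : State → Set
    Relaxed τ = (∀ a → a ≢ t → a ≢ t + 1 → mem τ a ≡ mem σ a) × mem τ t ≤ h × mem τ t ≤ mem σ t ×
                ((mem τ (t + 1) ≡ mem σ (t + 1) × mem τ t ≡ mem σ t)
                 ⊎ (mem τ (t + 1) ≡ reg σ dp × mem τ t ≡ h))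
    MaxUpdated : State → State → Set
    MaxUpdated τ₂ τ = mem τ ≡ mem τ₂ × reg σ maxd ≤ reg τ maxd × mem τ₂ t ≤ reg τ maxd ×
                   ((reg τ far ≡ reg σ far × reg τ maxd ≡ reg σ maxd)
                    ⊎ (reg τ far ≡ reg σ xp × reg τ maxd ≡ mem τ₂ t))
    module _ (τ₁ : State) (fr₁ : Frame hamming (execs initial σ) τ₁) where
      relax : reg τ₁ dist ≡ h → mem τ₁ ≡ mem σ →
              Exec (unless val (ops (store tp dist ∷ store tq dp ∷ []))) (execs afterHamming τ₁) 3 Relaxed
      relax ed em = execUnless keepOld (λ ne → execOps (storeNew ne))
        where
        et : reg τ₁ tp ≡ t
        et = unchanged fr₁ tp tt
        old : mem τ₁ (reg τ₁ tp) ≡ mem σ t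
        old = cong₂ (λ m a → m a) em et
        keepOld : mem τ₁ (reg τ₁ tp) ∸ reg τ₁ dist ≡ 0 → Relaxed (execs afterHamming τ₁)
        keepOld z = (λ a _ _ → cong (λ m → m a) em)
                  , subst (_≤ h) (sym old′) (m∸n≡0⇒m≤n (trans (sym (cong₂ _∸_ old ed)) z))
                  , ≤-reflexive old′
                  , inj₁ (cong (λ m → m (t + 1)) em , old′)
          where old′ = cong (λ m → m t) em
        storeNew : mem τ₁ (reg τ₁ tp) ∸ reg τ₁ dist ≢ 0 →
                   Relaxed (execs (store tp dist ∷ store tq dp ∷ []) (execs afterHamming τ₁))
        storeNew ne = rest , ≤-reflexive atT , ≤-trans (≤-reflexive atT) (<⇒≤ h<old) , inj₂ (atT′ , atT)
          where
          h<old : h < mem σ t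
          h<old = m∸n≢0⇒n<m λ z → ne (trans (cong₂ _∸_ old ed) z)
          m₁ = mem τ₁ [ reg τ₁ tp ↦ reg τ₁ dist ]
          rest : ∀ a → a ≢ t → a ≢ t + 1 → (m₁ [ reg τ₁ tp + 1 ↦ reg τ₁ dp ]) a ≡ mem σ a
          rest a a≢t a≢t+1 =
            trans (update-other m₁ (λ eq → a≢t+1 (trans eq (cong (_+ 1) et))))
              (trans (update-other (mem τ₁) (λ eq → a≢t (trans eq et))) (cong (λ m → m a) em))
          atT : (m₁ [ reg τ₁ tp + 1 ↦ reg τ₁ dp ]) t ≡ h
          atT = trans (update-other m₁ (λ eq → n≢n+1 t (trans eq (cong (_+ 1) et))))
                  (trans (update-same (mem τ₁) (reg τ₁ tp) (sym et)) ed)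
          atT′ : (m₁ [ reg τ₁ tp + 1 ↦ reg τ₁ dp ]) (t + 1) ≡ reg σ dp
          atT′ = trans (update-same m₁ (reg τ₁ tp + 1) (cong (_+ 1) (sym et))) (unchanged fr₁ dp tt)

      module _ (τ₂ : State)
               (fr₂ : Frame (unless val (ops (store tp dist ∷ store tq dp ∷ []))) (execs afterHamming τ₁) τ₂)
               (S : Relaxed τ₂) where
        reg₂ : ∀ x → {_ : T (fresh (ops (afterHamming)) x)} → {_ : T (fresh hamming x)} → 
               {_ : T (fresh (ops initial) x)} → reg τ₂ x ≡ reg σ x
        reg₂ x {a} {b} {c} = trans (unchanged fr₂ x tt) (trans (unchanged (frame (ops afterHamming) τ₁) x a)
                   (trans (unchanged fr₁ x b) (unchanged (frame (ops initial) σ) x c)))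
        here : mem τ₂ (reg τ₂ tp) ≡ mem τ₂ t
        here = cong (mem τ₂) (reg₂ tp)
        record-far : Exec (unless val (ops (move maxd e ∷ move far xp ∷ [])))
                       (execs compareMax τ₂) 3 (MaxUpdated τ₂)
        record-far = execUnless
          (λ z → refl , ≤-reflexive (sym (reg₂ maxd))
               , subst₂ _≤_ here refl (m∸n≡0⇒m≤n z)
               , inj₁ (reg₂ far , reg₂ maxd))
          (λ ne → execOps (refl , <⇒≤ (subst (_< _) (reg₂ maxd) (m∸n≢0⇒n<m ne)) , ≤-reflexive (sym here)
               , inj₂ (reg₂ xp , here)))
        module _ (τ₃ : State)
                 (fr₃ : Frame (unless val (ops (move maxd e ∷ move far xp ∷ []))) (execs compareMax τ₂) τ₃)
                 (S′ : MaxUpdated τ₂ τ₃) where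
          finish : Updated h σ (execs (const tmp 1 ∷ add tp tq tmp ∷ add xp xp rXR ∷ []) τ₃)
          finish = let rest , new , old , slots = S ; em , max≥ , ≤max , fars = S′ in record
            { tp≡ = cong (_+ 1) (trans (unchanged fr₃ tq tt) (trans (unchanged fr₂ tq tt)
                      (cong (_+ 1) (unchanged fr₁ tp tt))))
            ; xp≡ = cong₂ _+_ (trans (unchanged fr₃ xp tt) (reg₂ xp))
                      (trans (unchanged fr₃ rXR tt) (trans (reg₂ rXR) (param P rXR)))
            ; others = λ a a≢ a≢′ → trans (cong (λ m → m a) em) (rest a a≢ a≢′)
            ; ≤new = subst (_≤ h) (sym (cong (λ m → m t) em)) new
            ; ≤old = subst (_≤ mem σ t) (sym (cong (λ m → m t) em)) old
            ; slot = subst (λ m → (m (t + 1) ≡ mem σ (t + 1) × m t ≡ mem σ t)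
                                 ⊎ (m (t + 1) ≡ reg σ dp × m t ≡ h)) (sym em) slots
            ; maxd-≥ = max≥
            ; ≤maxd = subst (_≤ reg τ₃ maxd) (sym (cong (λ m → m t) em)) ≤max
            ; farthest = subst (λ m → (reg τ₃ far ≡ reg σ far × reg τ₃ maxd ≡ reg σ maxd)
                                 ⊎ (reg τ₃ far ≡ reg σ xp × reg τ₃ maxd ≡ m t)) (sym em) fars
            }

<1+-elim : ∀ {A : Set} {i j} → j < suc i → (j < i → A) → (j ≡ i → A) → A
<1+-elim j<1+i f g with m≤n⇒m<n∨m≡n (≤-pred j<1+i)
... | inj₁ j<i = f j<i
... | inj₂ j≡i = g j≡i

-- Matrices given by strides, and one pass over the table

module Matrices (σ₀ : State) (m₀ : ℕ → ℕ) where
  open Core σ₀ public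

  F D T₀ Z X₀ XR XC Y₀ YR YC : ℕ
  F  = reg σ₀ rF
  D  = reg σ₀ rD
  T₀ = reg σ₀ rT
  Z  = reg σ₀ rZ
  X₀ = reg σ₀ rX
  XR = reg σ₀ rXR
  XC = reg σ₀ rXC
  Y₀ = reg σ₀ rY
  YR = reg σ₀ rYR
  YC = reg σ₀ rYC

  x y : ℕ → ℕ → ℕ
  x i h = m₀ (X₀ + i * XR + h * XC)
  y h j = m₀ (Y₀ + h * YR + j * YC)

  hd : ℕ → ℕ → ℕ
  hd i j = distance Q (x i) (x j)

  record Layout : Set where
    field
      1≤N : 1 ≤ N
      1≤M : 1 ≤ M
      1≤L : 1 ≤ L
      1≤Q : 1 ≤ Q
      x<F : ∀ i h → i < N → h < Q → X₀ + i * XR + h * XC < F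
      x≤1 : ∀ i h → i < N → h < Q → x i h ≤ 1
      y<F : ∀ h j → h < Q → j < M → Y₀ + h * YR + j * YC < F
      y≤1 : ∀ h j → h < Q → j < M → y h j ≤ 1
      F<D : F < D
      D≤T : D + L * suc M ≤ T₀
      T≤Z : T₀ + N * 2 ≤ Z

  -- Below `F` lie the input and the room kept for the output. Nothing is written there before the
  -- final `output`, so matrix entries can always be read off `m₀`.
  Low : State → Set
  Low σ = ∀ a → a < F → mem σ a ≡ m₀ a

  E : ℕ → ℕ
  E i = T₀ + i * 2

  S : ℕ → ℕ
  S s = D + s * suc M

module Passes (σ₀ : State) (m₀ : ℕ → ℕ) (lay : Matrices.Layout σ₀ m₀) where
  open Matrices σ₀ m₀ public
  open Layout lay public

  F≤T : F ≤ T₀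
  F≤T = ≤-trans (<⇒≤ F<D) (≤-trans (m≤m+n D _) D≤T)

  E-next : ∀ i → E i + 1 + 1 ≡ E (suc i)
  E-next i = trans (+-assoc (E i) 1 1) (advance T₀ i 2 refl)

  E-gap : ∀ {i j} → i < j → E i + 1 < E j
  E-gap {i} {j} i<j = begin-strict
    E i + 1     <⟨ ≤-reflexive (trans (+-comm 1 (E i + 1)) (E-next i)) ⟩
    E (suc i)   ≤⟨ +-monoʳ-≤ T₀ (*-monoˡ-≤ 2 i<j) ⟩
    E j         ∎
    where open ≤-Reasoning

  row-slice : ∀ {σ i a} → Low σ → i < N → a ≡ X₀ + i * XR → Slice (mem σ) a XC Q (x i)
  row-slice low i<N refl = slice (λ h h<Q → low _ (x<F _ h i<N h<Q)) (λ h → x≤1 _ h i<N)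

  record Refined (k : ℕ) (σ τ : State) (i : ℕ) : Set where
    field
      ≤new  : mem τ (E i) ≤ hd i k
      ≤old  : mem τ (E i) ≤ mem σ (E i)
      slot  : (mem τ (E i + 1) ≡ mem σ (E i + 1) × mem τ (E i) ≡ mem σ (E i))
            ⊎ (mem τ (E i + 1) ≡ reg σ dp × mem τ (E i) ≡ hd i k)

  -- Entries before `i` have been refined by the center `k`, later ones are still those of `σ`. If
  -- no positive entry has been met, `far` still points to the center itself and `maxd` is 0, which
  -- makes the lower bounds on distances that follow from `maxd` trivial.
  record Pass (k : ℕ) (σ : State) (i : ℕ) (τ : State) : Set where
    field
      tp≡     : reg τ tp ≡ E i
      xp≡     : reg τ xp ≡ X₀ + i * XR
      others  : ∀ a → a < T₀ ⊎ E i ≤ a → mem τ a ≡ mem σ a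
      refined : ∀ j → j < i → Refined k σ τ j
      ≤maxd   : ∀ j → j < i → mem τ (E j) ≤ reg τ maxd
      argmax  : ∃[ f ] f < N × reg τ far ≡ X₀ + f * XR × (reg τ maxd ≡ 0 ⊎ (f < i × reg τ maxd ≡ mem τ (E f)))

  pass-exec : ∀ {k σ} → k < N → Params σ → Low σ → reg σ cur ≡ X₀ + k * XR → reg σ far ≡ X₀ + k * XR →
              reg σ maxd ≡ 0 → reg σ tp ≡ T₀ → reg σ xp ≡ X₀ → reg σ i₂ ≡ N →
              Exec (loop i₂ updateEntry) σ (N * (Q * 42)) (Pass k σ N)
  pass-exec {k} {σ} k<N P low ecur efar emax etp exp ecnt = weaken bound
    (execLoopConst (Q * 37) (Pass k σ) 1≤N ecnt initial step)
    where
    bound : N * (Q * 37 + 5) ≤ N * (Q * 42)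
    bound = *-monoʳ-≤ N (subst (_≤ Q * 42) (+-comm 5 (Q * 37)) (absorb 5 37 1≤Q))
    initial : Pass k σ 0 σ
    initial = record
      { tp≡ = trans etp (sym (+-identityʳ T₀)) ; xp≡ = trans exp (sym (+-identityʳ X₀))
      ; others = λ _ _ → refl ; refined = λ _ () ; ≤maxd = λ _ ()
      ; argmax = k , k<N , efar , inj₁ emax }
    step : ∀ i τ → i < N → Frame (loop i₂ updateEntry) σ τ → Pass k σ i τ →
           Exec updateEntry τ (Q * 37) (λ υ → Pass k σ (suc i) (decrement i₂ υ))
    step i τ i<N fr I = conseq next
      (updateEntry-exec σ₀ 1≤Q (keep fr P) (row-slice {τ} low-τ i<N I.xp≡)
        (row-slice {τ} low-τ k<N (trans (unchanged fr cur tt) ecur)))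
      where
      module I = Pass I
      low-τ : Low τ
      low-τ a a<F = trans (I.others a (inj₁ (<-≤-trans a<F F≤T))) (low a a<F)
      next : ∀ υ → Frame updateEntry τ υ → Updated σ₀ (hd i k) τ υ → Pass k σ (suc i) (decrement i₂ υ)
      next υ fr′ U = record
        { tp≡ = trans U.tp≡ (trans (cong (λ t → t + 1 + 1) I.tp≡) (E-next i))
        ; xp≡ = trans U.xp≡ (advance X₀ i XR I.xp≡)
        ; others = others′
        ; refined = λ j j<1+i → <1+-elim j<1+i (λ j<i → old-entry j<i) (λ { refl → new-entry })
        ; ≤maxd = λ j j<1+i → <1+-elim j<1+i
            (λ j<i → ≤-trans (≤-reflexive (before j j<i)) (≤-trans (I.≤maxd j j<i) U.maxd-≥))
            (λ { refl → subst (λ t → mem υ t ≤ reg υ maxd) I.tp≡ U.≤maxd })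
        ; argmax = argmax′ I.argmax U.farthest }
        where
        module U = Updated U
        elsewhere : ∀ a → a ≢ E i → a ≢ E i + 1 → mem υ a ≡ mem τ a
        elsewhere a ne ne′ = U.others a (λ eq → ne (trans eq I.tp≡)) (λ eq → ne′ (trans eq (cong (_+ 1) I.tp≡)))
        others′ : ∀ a → a < T₀ ⊎ E (suc i) ≤ a → mem υ a ≡ mem σ a
        others′ a (inj₁ a<T) = trans (elsewhere a
            (<⇒≢ (<-≤-trans a<T (m≤m+n T₀ _))) (<⇒≢ (<-≤-trans a<T (≤-trans (m≤m+n T₀ _) (m≤m+n (E i) 1)))))
          (I.others a (inj₁ a<T))
        others′ a (inj₂ E≤a) = trans (elsewhere a
            (>⇒≢ (≤-<-trans (m≤m+n (E i) 1) Ei<a)) (>⇒≢ Ei<a))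
          (I.others a (inj₂ (<⇒≤ (≤-<-trans (m≤m+n (E i) 1) Ei<a))))
          where Ei<a = <-≤-trans (E-gap {i} {suc i} ≤-refl) E≤a
        before : ∀ j → j < i → mem υ (E j) ≡ mem τ (E j)
        before j j<i = elsewhere (E j) (<⇒≢ (≤-<-trans (m≤m+n (E j) 1) (E-gap j<i)))
          (<⇒≢ (≤-<-trans (m≤m+n (E j) 1) (<-≤-trans (E-gap j<i) (m≤m+n (E i) 1))))
        before′ : ∀ j → j < i → mem υ (E j + 1) ≡ mem τ (E j + 1)
        before′ j j<i = elsewhere (E j + 1) (<⇒≢ (E-gap j<i)) (<⇒≢ (<-≤-trans (E-gap j<i) (m≤m+n (E i) 1)))
        old-entry : ∀ {j} → j < i → Refined k σ (decrement i₂ υ) j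
        old-entry {j} j<i = record
          { ≤new = subst (_≤ hd j k) (sym (before j j<i)) R.≤new
          ; ≤old = subst (_≤ mem σ (E j)) (sym (before j j<i)) R.≤old
          ; slot = subst₂ (λ a b → (a ≡ mem σ (E j + 1) × b ≡ mem σ (E j)) ⊎ (a ≡ reg σ dp × b ≡ hd j k))
                     (sym (before′ j j<i)) (sym (before j j<i)) R.slot }
          where module R = Refined (I.refined j j<i)
        at-i : mem τ (reg τ tp) ≡ mem σ (E i)
        at-i = trans (cong (mem τ) I.tp≡) (I.others (E i) (inj₂ ≤-refl))
        at-i′ : mem τ (reg τ tp + 1) ≡ mem σ (E i + 1)
        at-i′ = trans (cong (λ t → mem τ (t + 1)) I.tp≡) (I.others (E i + 1) (inj₂ (m≤m+n (E i) 1)))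
        new-entry : Refined k σ (decrement i₂ υ) i
        new-entry = record
          { ≤new = subst (λ t → mem υ t ≤ hd i k) I.tp≡ U.≤new
          ; ≤old = subst₂ (λ t v → mem υ t ≤ v) I.tp≡ at-i U.≤old
          ; slot = slot′ U.slot }
          where
          there = cong (mem υ) I.tp≡
          there′ = cong (λ t → mem υ (t + 1)) I.tp≡
          slot′ : _ → _
          slot′ (inj₁ (a , b)) = inj₁ (trans (sym there′) (trans a at-i′) , trans (sym there) (trans b at-i))
          slot′ (inj₂ (a , b)) = inj₂ (trans (sym there′) (trans a (unchanged fr dp tt)) , trans (sym there) b)
        argmax′ : _ → _ → ∃[ f ] f < N × reg υ far ≡ X₀ + f * XR ×
                  (reg υ maxd ≡ 0 ⊎ (f < suc i × reg υ maxd ≡ mem υ (E f)))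
        argmax′ _ (inj₂ (a , b)) = i , i<N , trans a I.xp≡ , inj₂ (≤-refl , trans b (cong (mem υ) I.tp≡))
        argmax′ (f , f<N , ef , inj₁ z) (inj₁ (a , b)) = f , f<N , trans a ef , inj₁ (trans b z)
        argmax′ (f , f<N , ef , inj₂ (f<i , em)) (inj₁ (a , b)) =
          f , f<N , trans a ef , inj₂ (m≤n⇒m≤1+n f<i , trans b (trans em (sym (before f f<i))))

diff≤1 : ∀ {x w} → x ≤ 1 → w ≤ 1 → diff x w ≤ 1
diff≤1 {x} {w} z≤n       w≤1       = ≤-trans (≤-reflexive (cong (_+ w) (0∸n≡0 w))) w≤1
diff≤1 (s≤s z≤n) z≤n       = ≤-refl
diff≤1 (s≤s z≤n) (s≤s z≤n) = z≤n

distance≤ : ∀ n {x w : ℕ → ℕ} → (∀ h → h < n → x h ≤ 1) → (∀ h → h < n → w h ≤ 1) → distance n x w ≤ n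
distance≤ n {x} {w} hx hw = begin
  distance n x w    ≤⟨ Σ-mono n (λ h h<n → diff≤1 (hx h h<n) (hw h h<n)) ⟩
  Σ[ n ] (λ _ → 1)  ≡⟨ Σ-const n 1 ⟩
  n * 1             ≡⟨ *-identityʳ n ⟩
  n                 ∎
  where open ≤-Reasoning

-- The invariant of farthest-first traversal

module Clusters (σ₀ : State) (m₀ : ℕ → ℕ) (lay : Matrices.Layout σ₀ m₀) where
  open Passes σ₀ m₀ lay public

  S-gap : ∀ {s t} → s < t → S s + suc M ≤ S t
  S-gap {s} {t} s<t = begin
    S s + suc M   ≡⟨ advance D s (suc M) refl ⟩
    S (suc s)     ≤⟨ +-monoʳ-≤ D (*-monoˡ-≤ (suc M) s<t) ⟩
    S t           ∎
    where open ≤-Reasoning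

  S-mono : ∀ {s t} → s < t → S s < S t
  S-mono {s} s<t = <-≤-trans (m<m+n (S s) z<s) (S-gap s<t)

  S-end : ∀ {s} → s < L → S s + suc M ≤ T₀
  S-end s<L = ≤-trans (S-gap s<L) D≤T

  S<T : ∀ {s} → s < L → S s < T₀
  S<T {s} s<L = <-≤-trans (m<m+n (S s) z<s) (S-end s<L)

  F<S : ∀ s → F < S s
  F<S s = <-≤-trans F<D (m≤m+n D _)

  -- The stored distance lies between the distance to the row it names (`own`) and the distances to
  -- all centers so far (`lower`). The first gives covering, the second separation. The index in
  -- `own` may equal `c` for the sake of c = 0: initial entries name the slot of a center that is
  -- about to be stored.
  record Entry (c : ℕ) (K : ℕ → ℕ) (σ : State) (i : ℕ) : Set where
    field
      near  : mem σ (E i) ≤ reg σ maxd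
      lower : ∀ s → s < c → mem σ (E i) ≤ hd i (K s)
      own   : ∃[ s ] s < L × s ≤ c × mem σ (E i + 1) ≡ S s × hd i (K s) ≤ mem σ (E i)

  -- The rows `K s` with s < c are centers; `K c` is the row at `far`, next in line. After `L`
  -- rounds it is the extra point that turns `L` centers into `L` + 1 separated points.
  record Centers (c : ℕ) (K : ℕ → ℕ) (σ : State) : Set where
    field
      low       : Low σ
      K<N       : ∀ s → s ≤ c → K s < N
      far≡      : reg σ far ≡ X₀ + K c * XR
      dp≡       : reg σ dp ≡ S c
      slots     : ∀ s → s < c → mem σ (S s) ≡ X₀ + K s * XR
      entries   : ∀ i → i < N → Entry c K σ i
      separated : ∀ s t → s < t → t ≤ c → reg σ maxd ≤ hd (K t) (K s)
      maxd≤Q    : reg σ maxd ≤ Q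

  -- Entries only shrink, so `maxd` does not grow and the old separation persists. The new `far` has
  -- `maxd` as its entry, or `maxd` is 0; in both cases its distance to every center is at least
  -- `maxd`.
  addCenter-exec : ∀ {c K σ} → c < L → Params σ → Centers c K σ →
                   Exec addCenter σ (N * (Q * 51)) (λ τ → ∃[ K′ ] Centers (suc c) K′ τ)
  addCenter-exec {c} {K} {σ} c<L P I = weaken bound
    (execOps⨾ (execSeq
      (pass-exec (K<N c ≤-refl) (keepOps setup P) low′ far≡ far≡ refl (param P rT) (param P rX) (param P rN))
      λ τ fr R → execOps (next τ fr R)))
    where
    open Centers I
    setup finish : List Instr
    setup = store dp far ∷ move cur far ∷ const maxd 0 ∷ move xp rX ∷ move tp rT ∷ move i₂ rN ∷ []
    finish = const tmp 1 ∷ add dp dp rM ∷ add dp dp tmp ∷ []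
    σ′ = execs setup σ
    bound : 6 + (N * (Q * 42) + 3) ≤ N * (Q * 51)
    bound = begin
      6 + (N * (Q * 42) + 3)   ≡⟨ cong (6 +_) (+-comm (N * (Q * 42)) 3) ⟩
      9 + N * (Q * 42)         ≤⟨ absorb 9 (Q * 42) 1≤N ⟩
      N * (9 + Q * 42)         ≤⟨ *-monoʳ-≤ N (absorb 9 42 1≤Q) ⟩
      N * (Q * 51)             ∎
      where open ≤-Reasoning
    off-slot : ∀ a → a ≢ S c → mem σ′ a ≡ mem σ a
    off-slot a ne = update-other (mem σ) (λ eq → ne (trans eq dp≡))
    low′ : Low σ′
    low′ a a<F = trans (off-slot a (<⇒≢ (<-trans a<F (F<S c)))) (low a a<F)
    module _ (τ : State) (fr : Frame (loop i₂ updateEntry) σ′ τ) (R : Pass (K c) σ′ N τ) where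
      υ = execs finish τ
      module R = Pass R
      f = proj₁ R.argmax
      f<N = proj₁ (proj₂ R.argmax)
      K′ : ℕ → ℕ
      K′ = K [ suc c ↦ f ]
      K-new : K′ (suc c) ≡ f
      K-new = update-same K {suc c} (suc c) refl
      K-old : ∀ {s} → s ≤ c → K′ s ≡ K s
      K-old s≤c = update-other K (<⇒≢ (s≤s s≤c))
      high-table : ∀ a → T₀ ≤ a → mem σ′ a ≡ mem σ a
      high-table a T≤a = off-slot a (>⇒≢ (<-≤-trans (S<T c<L) T≤a))
      at-E : ∀ i → mem σ′ (E i) ≡ mem σ (E i)
      at-E i = high-table (E i) (m≤m+n T₀ _)
      at-E′ : ∀ i → mem σ′ (E i + 1) ≡ mem σ (E i + 1)
      at-E′ i = high-table (E i + 1) (≤-trans (m≤m+n T₀ _) (m≤m+n (E i) 1))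
      entry : ∀ i → i < N → Entry (suc c) K′ υ i
      entry i i<N = record { near = R.≤maxd i i<N ; lower = lower′ ; own = own′ R′.slot Old.own }
        where
        module R′ = Refined (R.refined i i<N)
        module Old = Entry (entries i i<N)
        lower′ : ∀ s → s < suc c → mem τ (E i) ≤ hd i (K′ s)
        lower′ s s<1+c = subst (λ k → mem τ (E i) ≤ hd i k) (sym (K-old (≤-pred s<1+c)))
          (<1+-elim s<1+c
            (λ s<c → ≤-trans R′.≤old (subst (_≤ hd i (K s)) (sym (at-E i)) (Old.lower s s<c)))
            (λ { refl → R′.≤new }))
        own′ : _ → _ → ∃[ s ] s < L × s ≤ suc c × mem τ (E i + 1) ≡ S s × hd i (K′ s) ≤ mem τ (E i)
        own′ (inj₁ (a , b)) (s , s<L , s≤c , d , h) =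
          s , s<L , m≤n⇒m≤1+n s≤c , trans a (trans (at-E′ i) d) ,
          subst₂ (λ k v → hd i k ≤ v) (sym (K-old s≤c)) (sym (trans b (at-E i))) h
        own′ (inj₂ (a , b)) _ =
          c , c<L , n≤1+n c , trans a dp≡ ,
          subst₂ (λ k v → hd i k ≤ v) (sym (K-old ≤-refl)) (sym b) ≤-refl
      far-entry : reg τ maxd ≡ 0 ⊎ reg τ maxd ≡ mem τ (E f)
      far-entry with proj₂ (proj₂ (proj₂ R.argmax))
      ... | inj₁ z = inj₁ z
      ... | inj₂ (_ , e) = inj₂ e
      maxd-≤ : reg τ maxd ≤ reg σ maxd
      maxd-≤ with far-entry
      ... | inj₁ z = ≤-trans (≤-reflexive z) z≤n
      ... | inj₂ e = begin
        reg τ maxd     ≡⟨ e ⟩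
        mem τ (E f)    ≤⟨ Refined.≤old (R.refined f f<N) ⟩
        mem σ′ (E f)   ≡⟨ at-E f ⟩
        mem σ (E f)    ≤⟨ Entry.near (entries f f<N) ⟩
        reg σ maxd     ∎
        where open ≤-Reasoning
      far-separated : ∀ s → s < suc c → reg τ maxd ≤ hd f (K′ s)
      far-separated s s<1+c with far-entry
      ... | inj₁ z = ≤-trans (≤-reflexive z) z≤n
      ... | inj₂ e = ≤-trans (≤-reflexive e) (Entry.lower (entry f f<N) s s<1+c)
      low-τ : ∀ a → a < T₀ → a ≢ S c → mem τ a ≡ mem σ a
      low-τ a a<T ne = trans (R.others a (inj₁ a<T)) (off-slot a ne)
      slot′ : ∀ s → s < suc c → mem τ (S s) ≡ X₀ + K s * XR
      slot′ s s<1+c = <1+-elim s<1+c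
        (λ s<c → trans (low-τ (S s) (S<T (<-trans s<c c<L)) (<⇒≢ (S-mono s<c))) (slots s s<c))
        (λ { refl → trans (R.others (S c) (inj₁ (S<T c<L)))
                      (trans (update-same (mem σ) (reg σ dp) (sym dp≡)) far≡) })
      next : ∃[ K″ ] Centers (suc c) K″ υ
      next = K′ , record
        { low = λ a a<F → trans (R.others a (inj₁ (<-≤-trans a<F F≤T))) (low′ a a<F)
        ; K<N = λ s s≤1+c → <1+-elim (s≤s s≤1+c)
            (λ s<1+c → subst (_< N) (sym (K-old (≤-pred s<1+c))) (K<N s (≤-pred s<1+c)))
            (λ { refl → subst (_< N) (sym K-new) f<N })
        ; far≡ = trans (proj₁ (proj₂ (proj₂ R.argmax))) (cong (λ k → X₀ + k * XR) (sym K-new))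
        ; dp≡ = trans (cong₂ (λ a b → a + b + 1) (trans (unchanged fr dp tt) dp≡)
                        (trans (unchanged fr rM tt) (param P rM)))
                  (trans (+-assoc (S c) M 1) (trans (cong (S c +_) (+-comm M 1)) (advance D c (suc M) refl)))
        ; slots = λ s s<1+c → trans (slot′ s s<1+c)
            (cong (λ k → X₀ + k * XR) (sym (K-old (≤-pred s<1+c))))
        ; entries = entry
        ; separated = λ s t s<t t≤1+c → <1+-elim (s≤s t≤1+c)
            (λ t<1+c → subst₂ (λ k l → reg τ maxd ≤ hd k l)
              (sym (K-old (≤-pred t<1+c))) (sym (K-old (<⇒≤ (<-≤-trans s<t (≤-pred t<1+c)))))
              (≤-trans maxd-≤ (separated s t s<t (≤-pred t<1+c))))
            (λ { refl → subst (λ k → reg τ maxd ≤ hd k (K′ s)) (sym K-new) (far-separated s s<t) })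
        ; maxd≤Q = ≤-trans maxd-≤ maxd≤Q }

  cluster-exec : ∀ {σ} → Params σ → Low σ →
                 Exec cluster σ (L * (N * (Q * 72))) (λ τ → ∃[ K ] Centers L K τ)
  cluster-exec {σ} P low₀ = weaken bound
    (execOps⨾ (execSeq (execLoopConst 5 Init 1≤N (param P rN) init₀ init-step)
      λ τ fr I → execOps⨾ (execLoopConst (N * (Q * 51)) (λ c υ → ∃[ K ] Centers c K υ) 1≤L
        (trans (unchanged fr rL tt) (param P rL)) (first τ fr I)
        λ c υ c<L fr′ (K , C) → conseq (λ ω _ → decremented)
          (addCenter-exec c<L (keep fr′ (keepOps middle (keep fr (keepOps begin P)))) C))))
    where
    begin middle : List Instr
    begin = move tp rT ∷ move i₁ rN ∷ []
    middle = move far rX ∷ move maxd rQ ∷ move dp rD ∷ move i₁ rL ∷ []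
    entryLoop : Cmd
    entryLoop = loop i₁ (ops (store tp rQ ∷ const tmp 1 ∷ add tp tp tmp ∷ store tp rD ∷ add tp tp tmp ∷ []))
    decremented : ∀ {c ω} → ∃[ K ] Centers c K ω → ∃[ K ] Centers c K (decrement i₁ ω)
    decremented {ω = ω} (K , C) = K , record
      { low = low ; K<N = K<N ; far≡ = far≡ ; dp≡ = dp≡ ; slots = slots
      ; entries = λ i i<N → record { Entry (entries i i<N) } ; separated = separated ; maxd≤Q = maxd≤Q }
      where open Centers C
    Init : ℕ → State → Set
    Init i τ = reg τ tp ≡ E i × (∀ a → a < T₀ → mem τ a ≡ mem σ a) ×
               (∀ j → j < i → mem τ (E j) ≡ Q × mem τ (E j + 1) ≡ D)
    init₀ : Init 0 (execs begin σ)
    init₀ = trans (param P rT) (sym (+-identityʳ T₀)) , (λ _ _ → refl) , λ _ ()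
    init-step : ∀ i τ → i < N → Frame entryLoop (execs begin σ) τ → Init i τ → _
    init-step i τ i<N fr (et , lo , done) = execOps
      ( trans (cong (λ t → t + 1 + 1) et) (E-next i)
      , (λ a a<T → trans (elsewhere a (<⇒≢ (<-≤-trans a<T (m≤m+n T₀ _)))
                           (<⇒≢ (<-≤-trans a<T (≤-trans (m≤m+n T₀ _) (m≤m+n (E i) 1))))) (lo a a<T))
      , λ j j<1+i → <1+-elim j<1+i
          (λ j<i → trans (elsewhere (E j) (<⇒≢ (≤-<-trans (m≤m+n (E j) 1) (E-gap j<i)))
                           (<⇒≢ (≤-<-trans (m≤m+n (E j) 1) (<-≤-trans (E-gap j<i) (m≤m+n (E i) 1)))))
                     (proj₁ (done j j<i))
                 , trans (elsewhere (E j + 1) (<⇒≢ (E-gap j<i)) (<⇒≢ (<-≤-trans (E-gap j<i) (m≤m+n (E i) 1))))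
                     (proj₂ (done j j<i)))
          (λ { refl → trans (update-other m₁ (λ eq → n≢n+1 (E i) (trans eq (cong (_+ 1) et))))
                        (trans (update-same (mem τ) (reg τ tp) (sym et)) (param Pτ rQ))
                    , trans (update-same m₁ (reg τ tp + 1) (cong (_+ 1) (sym et))) (param Pτ rD) }) )
      where
      Pτ = keep fr (keepOps begin P)
      m₁ = mem τ [ reg τ tp ↦ reg τ rQ ]
      elsewhere : ∀ a → a ≢ E i → a ≢ E i + 1 → (m₁ [ reg τ tp + 1 ↦ reg τ rD ]) a ≡ mem τ a
      elsewhere a ne ne′ = trans (update-other m₁ (λ eq → ne′ (trans eq (cong (_+ 1) et))))
                             (update-other (mem τ) (λ eq → ne (trans eq et)))
    first : ∀ τ → Frame entryLoop (execs begin σ) τ → Init N τ → ∃[ K ] Centers 0 K (execs middle τ)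
    -- Row 0 is the arbitrary first center. With c = 0 only the value of the sequence at 0 matters,
    -- and separation is vacuous.
    first τ fr (_ , lo , done) = (λ _ → 0) , record
      { low = λ a a<F → trans (lo a (<-≤-trans a<F F≤T)) (low₀ a a<F)
      ; K<N = λ _ _ → 1≤N
      ; far≡ = trans (param Pτ rX) (sym (+-identityʳ X₀))
      ; dp≡ = trans (param Pτ rD) (sym (+-identityʳ D))
      ; slots = λ _ ()
      ; entries = λ i i<N → record
          { near = ≤-reflexive (trans (proj₁ (done i i<N)) (sym (param Pτ rQ)))
          ; lower = λ _ ()
          ; own = 0 , 1≤L , z≤n , trans (proj₂ (done i i<N)) (sym (+-identityʳ D)) ,
                  ≤-trans (distance≤ Q (λ h → x≤1 i h i<N) (λ h → x≤1 0 h 1≤N))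
                    (≤-reflexive (sym (proj₁ (done i i<N)))) }
      ; separated = λ s t s<t t≤0 → contradiction (<-≤-trans s<t t≤0) λ ()
      ; maxd≤Q = ≤-reflexive (param Pτ rQ) }
      where Pτ = keep fr (keepOps begin P)
    bound : 2 + (N * 10 + (4 + L * (N * (Q * 51) + 5))) ≤ L * (N * (Q * 72))
    bound = begin′
      2 + (N * 10 + (4 + L * (N * (Q * 51) + 5)))   ≡⟨ shuffle N Q L ⟩
      (6 + N * 10) + L * (5 + N * (Q * 51))         ≤⟨ absorb (6 + N * 10) (5 + N * (Q * 51)) 1≤L ⟩
      L * ((6 + N * 10) + (5 + N * (Q * 51)))       ≡⟨ cong (L *_) (shuffle′ N Q) ⟩
      L * (11 + N * (10 + Q * 51))                  ≤⟨ *-monoʳ-≤ L (absorb 11 (10 + Q * 51) 1≤N) ⟩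
      L * (N * (21 + Q * 51))                       ≤⟨ *-monoʳ-≤ L (*-monoʳ-≤ N (absorb 21 51 1≤Q)) ⟩
      L * (N * (Q * 72))                            ∎
      where
      open ≤-Reasoning renaming (begin_ to begin′_)
      shuffle : ∀ N Q L → 2 + (N * 10 + (4 + L * (N * (Q * 51) + 5))) ≡ (6 + N * 10) + L * (5 + N * (Q * 51))
      shuffle = solve-∀
      shuffle′ : ∀ N Q → (6 + N * 10) + (5 + N * (Q * 51)) ≡ 11 + N * (10 + Q * 51)
      shuffle′ = solve-∀

-- Computing a product row by corrections

Σ-prefix : ∀ {m n} (f : ℕ → ℕ) → m ≤ n → Σ[ m ] f ≤ Σ[ n ] f
Σ-prefix {zero}      f _   = z≤n
Σ-prefix {m} {suc n} f m≤n with m≤n⇒m<n∨m≡n m≤n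
... | inj₁ m<1+n = ≤-trans (Σ-prefix f (≤-pred m<1+n)) (m≤m+n _ (f n))
... | inj₂ refl  = ≤-refl

Σ-zero : ∀ n → Σ[ n ] (λ _ → 0) ≡ 0
Σ-zero n = trans (Σ-const n 0) (*-zeroʳ n)

Σ-affine : ∀ n (d : ℕ → ℕ) c → Σ[ n ] (λ h → 15 + d h * c + 4) ≡ n * 19 + Σ[ n ] d * c
Σ-affine zero    d c = refl
Σ-affine (suc n) d c = trans (cong (_+ (15 + d n * c + 4)) (Σ-affine n d c)) (lemma n (Σ[ n ] d) (d n) c)
  where
  lemma : ∀ n s d c → n * 19 + s * c + (15 + d * c + 4) ≡ suc n * 19 + (s + d) * c
  lemma = solve-∀

-- Multiplication of bits by the subtractions that `addProduct` performs.
∸-mul : ∀ {x y} → x ≤ 1 → y ≤ 1 → x ∸ (1 ∸ y) ≡ x * y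
∸-mul {y = y} z≤n       y≤1       = 0∸n≡0 (1 ∸ y)
∸-mul         (s≤s z≤n) z≤n       = refl
∸-mul         (s≤s z≤n) (s≤s z≤n) = refl

diff-zero : ∀ {x w} → diff x w ≡ 0 → x ≡ w
diff-zero {x} {w} eq =
  ≤-antisym (m∸n≡0⇒m≤n (m+n≡0⇒m≡0 (x ∸ w) eq)) (m∸n≡0⇒m≤n (m+n≡0⇒n≡0 (x ∸ w) eq))

-- Exchanging the summand b of B for a, while SW of B has already been exchanged for SX.
exchange : ∀ v a b SW SX B → v + SW ≡ B + SX → SW + b ≤ B → (v + a ∸ b) + (SW + b) ≡ B + (SX + a)
exchange v a b SW SX B eq h = begin
  (v + a ∸ b) + (SW + b)   ≡⟨ cong ((v + a ∸ b) +_) (+-comm SW b) ⟩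
  (v + a ∸ b) + (b + SW)   ≡⟨ +-assoc (v + a ∸ b) b SW ⟨
  (v + a ∸ b) + b + SW     ≡⟨ cong (_+ SW) (m∸n+n≡m (≤-trans b≤v (m≤m+n v a))) ⟩
  v + a + SW               ≡⟨ swap v a SW ⟩
  v + SW + a               ≡⟨ cong (_+ a) eq ⟩
  B + SX + a               ≡⟨ +-assoc B SX a ⟩
  B + (SX + a)             ∎
  where
  open ≡-Reasoning
  swap : ∀ v a s → v + a + s ≡ v + s + a
  swap = solve-∀
  -- The cell `v` still contains the whole of `B` apart from `SW`, hence in particular the summand
  -- `b`; the truncated subtraction is exact.
  b≤v : b ≤ v
  b≤v = +-cancelˡ-≤ SW b v (≤-trans h (≤-trans (m≤m+n B SX) (≤-reflexive (trans (sym eq) (+-comm v SW)))))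

Outside : ℕ → ℕ → State → State → Set
Outside a n σ τ = ∀ b → b < a ⊎ a + n ≤ b → mem τ b ≡ mem σ b

+-suc-1 : ∀ a i → a + i + 1 ≡ a + suc i
+-suc-1 a i = trans (+-assoc a i 1) (cong (a +_) (+-comm i 1))

module Rows (σ₀ : State) (m₀ : ℕ → ℕ) (lay : Matrices.Layout σ₀ m₀) where
  open Clusters σ₀ m₀ lay public

  prod : ℕ → ℕ → ℕ
  prod k j = Σ[ Q ] (λ h → x k h * y h j)

  record Copied (R : ℕ) (σ : State) (g : ℕ → ℕ) (τ : State) : Set where
    constructor copied
    field
      cells   : ∀ j → j < M → mem τ (R + j) ≡ g j
      outside : Outside R M σ τ

  copyRow-exec : ∀ {σ g} → (let R = reg σ wp) → reg σ i₂ ≡ M →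
                 (∀ j → j < M → reg σ u + j * reg σ rBS < R × mem σ (reg σ u + j * reg σ rBS) ≡ g j) →
                 Exec copyRow σ (M * 10) (Copied R σ g)
  copyRow-exec {σ} {g} cnt src = conseq (λ τ _ (_ , _ , c , o) → copied c o)
    (execLoopConst 5 I 1≤M cnt (sym (+-identityʳ R) , sym (+-identityʳ (reg σ u)) , (λ _ ()) , λ _ _ → refl) step)
    where
    R = reg σ wp
    s = reg σ rBS
    I : ℕ → State → Set
    I i τ = reg τ wp ≡ R + i × reg τ u ≡ reg σ u + i * s ×
            (∀ j → j < i → mem τ (R + j) ≡ g j) × Outside R i σ τ
    step : ∀ i τ → i < M → Frame copyRow σ τ → I i τ → _
    step i τ i<M fr (ew , eu , done , out) = execOps
      ( trans (cong (_+ 1) ew) (+-suc-1 R i)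
      , trans (cong (reg τ u +_) (unchanged fr rBS tt)) (advance _ i s eu)
      , (λ j j<1+i → <1+-elim j<1+i
          (λ j<i → trans (elsewhere (R + j) (<⇒≢ (+-monoʳ-< R j<i))) (done j j<i))
          (λ { refl → trans (update-same (mem τ) (reg τ wp) (sym ew)) read }))
      , λ { b (inj₁ b<R) → trans (elsewhere b (<⇒≢ (<-≤-trans b<R (m≤m+n R i)))) (out b (inj₁ b<R))
          ; b (inj₂ R+i<b) → let b>R+i = <-≤-trans (+-monoʳ-< R (n<1+n i)) R+i<b in
              trans (elsewhere b (>⇒≢ b>R+i)) (out b (inj₂ (<⇒≤ b>R+i))) } )
      where
      elsewhere : ∀ b → b ≢ R + i → (mem τ [ reg τ wp ↦ mem τ (reg τ u) ]) b ≡ mem τ b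
      elsewhere b ne = update-other (mem τ) (λ eq → ne (trans eq ew))
      read : mem τ (reg τ u) ≡ g i
      read = trans (cong (mem τ) eu) (trans (out _ (inj₁ (proj₁ (src i i<M)))) (proj₂ (src i i<M)))

  addProduct-exec : ∀ {σ h a b} → (let R = reg σ wp) → Params σ → Low σ → F ≤ R → h < Q → a ≤ 1 → b ≤ 1 →
                    reg σ i₃ ≡ M → reg σ bx ≡ a → reg σ bw ≡ b → reg σ yq ≡ Y₀ + h * YR →
                    Exec addProduct σ (M * 16)
                      (Copied R σ (λ j → (mem σ (R + j) + a * y h j) ∸ b * y h j))
  addProduct-exec {σ} {h} {a} {b} P low F≤R h<Q a≤1 b≤1 cnt ea eb ey = conseq (λ τ _ (_ , _ , c , o) → copied c o)
    (execLoopConst 11 I 1≤M cnt (sym (+-identityʳ R) , trans ey (sym (+-identityʳ _)) , (λ _ ()) , λ _ _ → refl) step)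
    where
    R = reg σ wp
    g : ℕ → ℕ
    g j = (mem σ (R + j) + a * y h j) ∸ b * y h j
    I : ℕ → State → Set
    I i τ = reg τ wp ≡ R + i × reg τ yq ≡ Y₀ + h * YR + i * YC ×
            (∀ j → j < i → mem τ (R + j) ≡ g j) × Outside R i σ τ
    step : ∀ i τ → i < M → Frame addProduct σ τ → I i τ → _
    step i τ i<M fr (ew , eq , done , out) = execOps
      ( trans (cong (_+ 1) ew) (+-suc-1 R i)
      , trans (cong (reg τ yq +_) (param (keep fr P) rYC)) (advance _ i YC eq)
      , (λ j j<1+i → <1+-elim j<1+i
          (λ j<i → trans (elsewhere (R + j) (<⇒≢ (+-monoʳ-< R j<i))) (done j j<i))
          (λ { refl → trans (update-same (mem τ) (reg τ wp) (sym ew)) value }))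
      , λ { c (inj₁ c<R) → trans (elsewhere c (<⇒≢ (<-≤-trans c<R (m≤m+n R i)))) (out c (inj₁ c<R))
          ; c (inj₂ R+i<c) → let c>R+i = <-≤-trans (+-monoʳ-< R (n<1+n i)) R+i<c in
              trans (elsewhere c (>⇒≢ c>R+i)) (out c (inj₂ (<⇒≤ c>R+i))) } )
      where
      new = (mem τ (reg τ wp) + (reg τ bx ∸ (1 ∸ mem τ (reg τ yq)))) ∸ (reg τ bw ∸ (1 ∸ mem τ (reg τ yq)))
      elsewhere : ∀ c → c ≢ R + i → (mem τ [ reg τ wp ↦ new ]) c ≡ mem τ c
      elsewhere c ne = update-other (mem τ) (λ eq → ne (trans eq ew))
      yi : mem τ (reg τ yq) ≡ y h i
      yi = trans (cong (mem τ) eq)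
             (trans (out _ (inj₁ (<-≤-trans (y<F h i h<Q i<M) F≤R))) (low _ (y<F h i h<Q i<M)))
      value : new ≡ g i
      value = cong₂ _∸_
        (cong₂ _+_ (trans (cong (mem τ) ew) (out _ (inj₂ ≤-refl)))
          (trans (cong₂ (λ b y → b ∸ (1 ∸ y)) (trans (unchanged fr bx tt) ea) yi) (∸-mul a≤1 (y≤1 h i h<Q i<M))))
        (trans (cong₂ (λ b y → b ∸ (1 ∸ y)) (trans (unchanged fr bw tt) eb) yi) (∸-mul b≤1 (y≤1 h i h<Q i<M)))

  -- The reference lies below `R`, the address of the row under construction, and so survives the
  -- writing of that row.
  Reference : State → ℕ → ℕ → ℕ → (ℕ → ℕ) → Set
  Reference σ R a s w = ∀ h → h < Q → a + h * s < R × mem σ (a + h * s) ≡ w h × w h ≤ 1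

  correctRow-exec : ∀ {σ k w} → (let R = reg σ row) → Params σ → Low σ → F ≤ R → k < N →
                    reg σ i₂ ≡ Q → reg σ u ≡ X₀ + k * XR → reg σ yp ≡ Y₀ →
                    Reference σ R (reg σ v) (reg σ rRS) w →
                    (∀ j → j < M → mem σ (R + j) ≡ Σ[ Q ] (λ h → w h * y h j)) →
                    Exec correctRow σ (suc (Q * 19 + distance Q (x k) w * (M * 19))) (Copied R σ (prod k))
  correctRow-exec {σ} {k} {w} P low F≤R k<N cnt eu₀ ey₀ W B = weaken bound
    -- Rounds have unequal cost: `diff` of two bits is 0 or 1 and switches the pass over a row of Y.
    -- Summing it over all rounds produces the Hamming distance.
    (conseq finish (execLoop (λ h → 15 + diff (x k h) (w h) * (M * 19)) I cnt initial step))
    where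
    R = reg σ row
    rs = reg σ rRS
    bits : List Instr
    bits = loadBits ++ move val plus ∷ add val val minus ∷ []
    record I (h : ℕ) (τ : State) : Set where
      field
        u≡ : reg τ u ≡ X₀ + k * XR + h * XC
        v≡ : reg τ v ≡ reg σ v + h * rs
        yp≡ : reg τ yp ≡ Y₀ + h * YR
        -- Stated additively to avoid subtraction: of the reference product, the first `h` terms
        -- have been exchanged for those of row `k`. At h = Q the reference cancels.
        partial : ∀ j → j < M → mem τ (R + j) + Σ[ h ] (λ h → w h * y h j)
                              ≡ Σ[ Q ] (λ h → w h * y h j) + Σ[ h ] (λ h → x k h * y h j)
        outside : Outside R M σ τ
    initial : I 0 σ
    initial = record
      { u≡ = trans eu₀ (sym (+-identityʳ _)) ; v≡ = sym (+-identityʳ _) ; yp≡ = trans ey₀ (sym (+-identityʳ _))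
      ; partial = λ j j<M → cong (_+ 0) (B j j<M) ; outside = λ _ _ → refl }
    finish : ∀ τ → Frame correctRow σ τ → I Q τ → Copied R σ (prod k) τ
    finish τ _ h = copied (λ j j<M → +-cancelʳ-≡ (Σ[ Q ] (λ h → w h * y h j)) (mem τ (R + j)) (prod k j)
        (trans (I.partial h j j<M) (+-comm (Σ[ Q ] (λ h → w h * y h j)) (prod k j)))) (I.outside h)
    bound : suc (Σ[ Q ] (λ h → 15 + diff (x k h) (w h) * (M * 19) + 4)) ≤
            suc (Q * 19 + distance Q (x k) w * (M * 19))
    bound = s≤s (≤-reflexive (Σ-affine Q (λ h → diff (x k h) (w h)) (M * 19)))
    step : ∀ h τ → h < Q → Frame correctRow σ τ → I h τ →
           Exec _ τ (15 + diff (x k h) (w h) * (M * 19)) (λ υ → I (suc h) (decrement i₂ υ))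
    step h τ h<Q fr J = weaken time≤
      (execOps⨾ (execSeq {t = suc (diff (x k h) (w h) * (M * 19))} {u = 3} middle λ υ fr′ C → execOps (next υ fr′ C)))
      where
      module J = I J
      time≤ : 11 + (suc (diff (x k h) (w h) * (M * 19)) + 3) ≤ 15 + diff (x k h) (w h) * (M * 19)
      time≤ = ≤-reflexive (shuffle (diff (x k h) (w h) * (M * 19)))
        where
        shuffle : ∀ d → 11 + (suc d + 3) ≡ 15 + d
        shuffle = solve-∀
      τ′ = execs bits τ
      Pτ : Params τ
      Pτ = keep fr P
      low-τ : Low τ
      low-τ a a<F = trans (J.outside a (inj₁ (<-≤-trans a<F F≤R))) (low a a<F)
      ex : 1 ∸ (1 ∸ mem τ (reg τ u)) ≡ x k h
      ex = trans (cong (λ a → 1 ∸ (1 ∸ a)) (trans (cong (mem τ) J.u≡) (low-τ _ (x<F k h k<N h<Q))))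
             (m∸[m∸n]≡n (x≤1 k h k<N h<Q))
      ew : 1 ∸ (1 ∸ mem τ (reg τ v)) ≡ w h
      ew = trans (cong (λ a → 1 ∸ (1 ∸ a)) (trans (cong (mem τ) J.v≡)
                   (trans (J.outside _ (inj₁ (proj₁ (W h h<Q)))) (proj₁ (proj₂ (W h h<Q))))))
             (m∸[m∸n]≡n (proj₂ (proj₂ (W h h<Q))))
      Row : State → Set
      Row = Copied R τ (λ j → (mem τ (R + j) + x k h * y h j) ∸ w h * y h j)
      eval-diff : reg τ′ val ≡ diff (x k h) (w h)
      eval-diff = cong₂ diff ex ew
      erow : reg τ row ≡ R
      erow = unchanged fr row tt
      middle : Exec (unless val (ops (move wp row ∷ move yq yp ∷ move i₃ rM ∷ []) ⨾ addProduct)) τ′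
                 (suc (diff (x k h) (w h) * (M * 19))) Row
      middle = execUnless skip λ ne → weaken (long ne) (execOps⨾
        (subst (λ r → Exec addProduct τ″ (M * 16) (Copied r τ (λ j → (mem τ (r + j) + x k h * y h j) ∸ w h * y h j)))
          erow
          (addProduct-exec′ (addProduct-exec {τ″} (keepOps (bits ++ setup) Pτ) low-τ (subst (F ≤_) (sym erow) F≤R) h<Q
            (x≤1 k h k<N h<Q) (proj₂ (proj₂ (W h h<Q))) (param Pτ rM) ex ew J.yp≡))))
        where
        setup = move wp row ∷ move yq yp ∷ move i₃ rM ∷ []
        τ″ = execs setup τ′
        addProduct-exec′ : ∀ {t g} → Exec addProduct τ″ t (Copied (reg τ row) τ″ g) →
                           Exec addProduct τ″ t (Copied (reg τ row) τ g)
        addProduct-exec′ = conseq (λ _ _ (copied c o) → copied c o)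
        skip : reg τ′ val ≡ 0 → Row τ′
        skip z = copied (λ j _ → sym (trans (cong (λ a → (mem τ (R + j) + a * y h j) ∸ w h * y h j)
                                  (diff-zero {x k h} {w h} (trans (sym eval-diff) z)))
                                (m+n∸n≡m (mem τ (R + j)) (w h * y h j)))) (λ _ _ → refl)
        long : reg τ′ val ≢ 0 → 3 + M * 16 ≤ diff (x k h) (w h) * (M * 19)
        long ne = ≤-trans (absorb 3 16 1≤M)
          (m≤n*m (M * 19) (diff (x k h) (w h)) {{≢-nonZero (λ z → ne (trans eval-diff z))}})
      next : ∀ υ → Frame (unless val (ops (move wp row ∷ move yq yp ∷ move i₃ rM ∷ []) ⨾ addProduct)) τ′ υ →
             Row υ → I (suc h) (decrement i₂ (execs (add u u rXC ∷ add v v rRS ∷ add yp yp rYR ∷ []) υ))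
      next υ fr′ (copied c o) = record
        { u≡ = trans (cong₂ _+_ (unchanged fr′ u tt) (trans (unchanged fr′ rXC tt) (param Pτ rXC)))
                 (advance (X₀ + k * XR) h XC J.u≡)
        ; v≡ = trans (cong₂ _+_ (unchanged fr′ v tt) (trans (unchanged fr′ rRS tt) (unchanged fr rRS tt)))
                 (advance (reg σ v) h rs J.v≡)
        ; yp≡ = trans (cong₂ _+_ (unchanged fr′ yp tt) (trans (unchanged fr′ rYR tt) (param Pτ rYR)))
                 (advance Y₀ h YR J.yp≡)
        ; partial = λ j j<M → trans (cong (_+ Σ[ suc h ] (λ h → w h * y h j)) (c j j<M))
            (exchange (mem τ (R + j)) (x k h * y h j) (w h * y h j) _ _ _ (J.partial j j<M)
              (Σ-prefix (λ h → w h * y h j) h<Q))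
        ; outside = λ b out → trans (o b out) (J.outside b out) }

  computeRow-exec : ∀ {σ k w d} → (let R = reg σ row) → Params σ → Low σ → F ≤ R → k < N →
                    reg σ xp ≡ X₀ + k * XR →
                    Reference σ R (reg σ ref) (reg σ rRS) w →
                    (∀ j → j < M → reg σ base + j * reg σ rBS < R ×
                                   mem σ (reg σ base + j * reg σ rBS) ≡ Σ[ Q ] (λ h → w h * y h j)) →
                    distance Q (x k) w ≤ d →
                    Exec computeRow σ (M * 18 + Q * 19 + d * (M * 19)) (Copied R σ (prod k))
  computeRow-exec {σ} {k} {w} {d} P low F≤R k<N exp W B dist≤ = weaken bound
    (execOps⨾ (execSeq (copyRow-exec (param P rM) B)
      λ τ fr (copied c o) → execOps⨾ (correct τ fr c o)))
    where
    R = reg σ row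
    copySetup correctSetup : List Instr
    copySetup = move wp row ∷ move u base ∷ move i₂ rM ∷ []
    correctSetup = move u xp ∷ move v ref ∷ move yp rY ∷ move i₂ rQ ∷ []
    correct : ∀ τ → Frame copyRow (execs copySetup σ) τ →
              (∀ j → j < M → mem τ (R + j) ≡ Σ[ Q ] (λ h → w h * y h j)) → Outside R M (execs copySetup σ) τ →
              Exec correctRow (execs correctSetup τ) (suc (Q * 19 + distance Q (x k) w * (M * 19))) (Copied R σ (prod k))
    correct τ fr c o = go (reg τ row) (unchanged fr row tt) refl
      where
      go : ∀ r → r ≡ R → reg τ row ≡ r →
           Exec correctRow (execs correctSetup τ) (suc (Q * 19 + distance Q (x k) w * (M * 19))) (Copied R σ (prod k))
      go r r≡R refl = conseq (λ υ _ (copied c′ o′) → copied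
          (λ j j<M → trans (cong (λ r → mem υ (r + j)) (sym r≡R)) (c′ j j<M))
          (λ b out → trans (o′ b (subst (λ r → b < r ⊎ r + M ≤ b) (sym r≡R) out)) (o b out)))
        (correctRow-exec {k = k} {w = w} (keepOps correctSetup Pτ) low-τ
          (subst (F ≤_) (sym r≡R) F≤R) k<N (param Pτ rQ) (trans (unchanged fr xp tt) exp) (param Pτ rY)
          W′
          (λ j j<M → trans (cong (λ r → mem τ (r + j)) r≡R) (c j j<M)))
        where
        Pτ = keep fr (keepOps copySetup P)
        low-τ : Low τ
        low-τ a a<F = trans (o a (inj₁ (<-≤-trans a<F F≤R))) (low a a<F)
        W′ : Reference τ r (reg τ ref) (reg τ rRS) w
        W′ h h<Q with W h h<Q
        ... | lt , eq , le rewrite unchanged fr ref tt | unchanged fr rRS tt =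
          subst (reg σ ref + h * reg σ rRS <_) (sym r≡R) lt , trans (o _ (inj₁ lt)) eq , le
    bound : 3 + (M * 10 + (4 + suc (Q * 19 + distance Q (x k) w * (M * 19)))) ≤ M * 18 + Q * 19 + d * (M * 19)
    bound = begin
      3 + (M * 10 + (4 + suc (Q * 19 + distance Q (x k) w * (M * 19))))
        ≡⟨ shuffle M (Q * 19) (distance Q (x k) w * (M * 19)) ⟩
      (8 + M * 10) + Q * 19 + distance Q (x k) w * (M * 19)
        ≤⟨ +-mono-≤ (+-monoˡ-≤ (Q * 19) (absorb 8 10 1≤M)) (*-monoˡ-≤ (M * 19) dist≤) ⟩
      M * 18 + Q * 19 + d * (M * 19) ∎
      where
      open ≤-Reasoning
      shuffle : ∀ M a b → 3 + (M * 10 + (4 + suc (a + b))) ≡ (8 + M * 10) + a + b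
      shuffle = solve-∀

-- Rows at the centers, all rows, and the output

module Products (σ₀ : State) (m₀ : ℕ → ℕ) (lay : Matrices.Layout σ₀ m₀) where
  open Rows σ₀ m₀ lay public

  record Rowed (K : ℕ → ℕ) (σ τ : State) : Set where
    field
      low   : Low τ
      slots : ∀ s → s < L → mem τ (S s) ≡ X₀ + K s * XR
      rows  : ∀ s j → s < L → j < M → mem τ (S s + 1 + j) ≡ prod (K s) j
      table : ∀ a → T₀ ≤ a → mem τ a ≡ mem σ a

  -- The zero row is the reference. Its distance to a center is the number of ones there, at most
  -- `Q`, so the correction cost is that of a direct vector-matrix product.
  centerRows-exec : ∀ {K σ} → Params σ → Centers L K σ → Exec centerRows σ (L * (Q * (M * 73))) (Rowed K σ)
  centerRows-exec {K} {σ} P C = weaken bound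
    (execOps⨾ (conseq finish (execLoopConst (3 + (rowTime + 1)) I 1≤L (param P rL) initial step)))
    where
    module C = Centers C
    rowTime = M * 18 + Q * 19 + Q * (M * 19)
    setup : List Instr
    setup = const tmp 0 ∷ store rF tmp ∷ const rBS 0 ∷ const rRS 0 ∷ move base rF ∷ move ref rF ∷
            move row rD ∷ move i₁ rL ∷ []
    body = ops (load xp row ∷ const tmp 1 ∷ add row row tmp ∷ []) ⨾ computeRow ⨾ ops (add row row rM ∷ [])
    σ′ = execs setup σ
    record I (c : ℕ) (τ : State) : Set where
      field
        row≡  : reg τ row ≡ S c
        low   : Low τ
        zero≡ : mem τ F ≡ 0
        slots : ∀ s → s < L → mem τ (S s) ≡ X₀ + K s * XR
        rows  : ∀ s j → s < c → j < M → mem τ (S s + 1 + j) ≡ prod (K s) j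
        table : ∀ a → T₀ ≤ a → mem τ a ≡ mem σ a
    finish : ∀ τ → Frame (loop i₁ body) σ′ τ → I L τ → Rowed K σ τ
    finish τ _ J = record { low = J.low ; slots = J.slots ; rows = J.rows ; table = J.table }
      where module J = I J
    initial : I 0 σ′
    initial = record
      { row≡ = trans (param P rD) (sym (+-identityʳ D))
      ; low = λ a a<F → trans (elsewhere a (<⇒≢ a<F)) (C.low a a<F)
      ; zero≡ = update-same (mem σ) (reg σ rF) (sym (param P rF))
      ; slots = λ s s<L → trans (elsewhere (S s) (>⇒≢ (F<S s))) (C.slots s s<L)
      ; rows = λ _ _ ()
      ; table = λ a T≤a → elsewhere a (>⇒≢ (<-≤-trans (<-≤-trans (F<S 0) (≤-trans (≤-reflexive (+-identityʳ D))
                  (≤-trans (m≤m+n D _) D≤T))) T≤a)) }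
      where
      elsewhere : ∀ a → a ≢ F → mem σ′ a ≡ mem σ a
      elsewhere a ne = update-other (mem σ) (λ eq → ne (trans eq (param P rF)))
    step : ∀ c τ → c < L → Frame (loop i₁ body) σ′ τ → I c τ →
           Exec body τ (3 + (rowTime + 1)) (λ υ → I (suc c) (decrement i₁ υ))
    step c τ c<L fr J = execOps⨾ (execSeq
        (computeRow-exec {k = K c} {w = λ _ → 0} (keepOps load′ Pτ) J.low F≤R (C.K<N c (<⇒≤ c<L))
          (trans (cong (mem τ) J.row≡) (J.slots c c<L)) reference zeros
          (distance≤ Q (λ h → x≤1 (K c) h (C.K<N c (<⇒≤ c<L))) (λ _ _ → z≤n)))
        λ υ fr′ D → execOps (next υ fr′ D))
      where
      module J = I J
      load′ : List Instr
      load′ = load xp row ∷ const tmp 1 ∷ add row row tmp ∷ []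
      τ′ = execs load′ τ
      R = reg τ row + 1
      R≡ : R ≡ S c + 1
      R≡ = cong (_+ 1) J.row≡
      end≡ : R + M ≡ S (suc c)
      end≡ = trans (cong (_+ M) R≡) (trans (+-assoc (S c) 1 M) (advance D c (suc M) refl))
      Pτ : Params τ
      Pτ = keep fr (keepOps setup P)
      F<R : F < R
      F<R = subst (F <_) (sym R≡) (<-≤-trans (F<S c) (m≤m+n (S c) 1))
      F≤R : F ≤ R
      F≤R = <⇒≤ F<R
      at-F : ∀ a h → a ≡ F → F + h * 0 ≡ a
      at-F a h refl = trans (cong (F +_) (*-zeroʳ h)) (+-identityʳ F)
      ref≡ : ∀ h → reg τ ref + h * reg τ rRS ≡ F
      ref≡ h = trans (cong₂ (λ a s → a + h * s) (trans (unchanged fr ref tt) (param P rF)) (unchanged fr rRS tt))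
                 (at-F F h refl)
      base≡ : ∀ j → reg τ base + j * reg τ rBS ≡ F
      base≡ j = trans (cong₂ (λ a s → a + j * s) (trans (unchanged fr base tt) (param P rF)) (unchanged fr rBS tt))
                 (at-F F j refl)
      reference : Reference τ′ R (reg τ ref) (reg τ rRS) (λ _ → 0)
      reference h h<Q = subst (_< R) (sym (ref≡ h)) F<R , trans (cong (mem τ) (ref≡ h)) J.zero≡ , z≤n
      zeros : ∀ j → j < M → reg τ base + j * reg τ rBS < R ×
                            mem τ (reg τ base + j * reg τ rBS) ≡ Σ[ Q ] (λ h → 0 * y h j)
      zeros j j<M = subst (_< R) (sym (base≡ j)) F<R ,
                    trans (cong (mem τ) (base≡ j)) (trans J.zero≡ (sym (Σ-zero Q)))
      next : ∀ υ → Frame computeRow τ′ υ → Copied R τ′ (prod (K c)) υ →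
             I (suc c) (decrement i₁ (execs (add row row rM ∷ []) υ))
      next υ fr′ (copied cells out) = record
        { row≡ = trans (cong₂ _+_ (unchanged fr′ row tt) (trans (unchanged fr′ rM tt) (param Pτ rM))) end≡
        ; low = λ a a<F → trans (out a (inj₁ (<-≤-trans a<F F≤R))) (J.low a a<F)
        ; zero≡ = trans (out F (inj₁ F<R)) J.zero≡
        ; slots = slots′
        ; rows = λ s j s<1+c j<M → <1+-elim s<1+c
            (λ s<c → trans (out _ (inj₁ (subst (S s + 1 + j <_) (sym R≡)
                (<-≤-trans (cell<end s j j<M) (≤-trans (S-gap s<c) (m≤m+n (S c) 1))))))
              (J.rows s j s<c j<M))
            (λ { refl → trans (cong (λ r → mem υ (r + j)) (sym R≡)) (cells j j<M) })
        ; table = λ a T≤a → trans (out a (inj₂ (≤-trans (≤-reflexive end≡)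
            (≤-trans (+-monoʳ-≤ D (*-monoˡ-≤ (suc M) c<L)) (≤-trans D≤T T≤a))))) (J.table a T≤a) }
        where
        cell<end : ∀ s j → j < M → S s + 1 + j < S s + suc M
        cell<end s j j<M = subst (_< S s + suc M) (sym (+-assoc (S s) 1 j)) (+-monoʳ-< (S s) (s<s j<M))
        slots′ : ∀ s → s < L → mem υ (S s) ≡ X₀ + K s * XR
        slots′ s s<L with <-cmp s c
        ... | tri< s<c _ _ = trans (out (S s) (inj₁ (subst (S s <_) (sym R≡)
                               (<-≤-trans (S-mono s<c) (m≤m+n (S c) 1))))) (J.slots s s<L)
        ... | tri≈ _ refl _ = trans (out (S s) (inj₁ (subst (S s <_) (sym R≡)
                               (m<m+n (S s) z<s)))) (J.slots s s<L)
        ... | tri> _ _ c<s = trans (out (S s) (inj₂ (≤-trans (≤-reflexive end≡)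
                               (+-monoʳ-≤ D (*-monoˡ-≤ (suc M) c<s))))) (J.slots s s<L)
    bound : 8 + L * (3 + (rowTime + 1) + 5) ≤ L * (Q * (M * 73))
    bound = begin
      8 + L * (3 + (rowTime + 1) + 5)                        ≤⟨ absorb 8 (3 + (rowTime + 1) + 5) 1≤L ⟩
      L * (8 + (3 + (rowTime + 1) + 5))                      ≡⟨ cong (L *_) (shuffle M Q) ⟩
      L * ((17 + M * 18) + Q * (19 + M * 19))                ≤⟨ *-monoʳ-≤ L (absorb (17 + M * 18) (19 + M * 19) 1≤Q) ⟩
      L * (Q * (17 + M * 18 + (19 + M * 19)))                ≡⟨ cong (λ a → L * (Q * a)) (shuffle′ M) ⟩
      L * (Q * (36 + M * 37))                                ≤⟨ *-monoʳ-≤ L (*-monoʳ-≤ Q (absorb 36 37 1≤M)) ⟩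
      L * (Q * (M * 73))                                     ∎
      where
      open ≤-Reasoning
      shuffle : ∀ M Q → 8 + (3 + (M * 18 + Q * 19 + Q * (M * 19) + 1) + 5) ≡ (17 + M * 18) + Q * (19 + M * 19)
      shuffle = solve-∀
      shuffle′ : ∀ M → 17 + M * 18 + (19 + M * 19) ≡ 36 + M * 37
      shuffle′ = solve-∀

  Z[_] : ℕ → ℕ
  Z[ i ] = Z + i * M

  Multiplied : State → Set
  Multiplied τ = ∀ i j → i < N → j < M → mem τ (Z[ i ] + j) ≡ prod i j

  -- `Centers` describes the state `σ` right after clustering. The table has not changed since, so
  -- an entry of `σ` leads to a slot that `centerRows` has meanwhile filled. The distance to that
  -- reference is at most the entry, hence at most the final `maxd`.
  allRows-exec : ∀ {K σ ρ τ} → Params τ → Centers L K σ → Rowed K σ τ → reg σ maxd ≡ ρ →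
                 Exec allRows τ (N * (M * 37 + Q * 19 + ρ * (M * 19))) Multiplied
  allRows-exec {K} {σ} {ρ} {τ₀} P C D refl = weaken bound
    (execOps⨾ (conseq (λ _ _ → I.rows) (execLoopConst (6 + (rowTime + 2)) I 1≤N (param P rN) initial step)))
    where
    module C = Centers C
    module D = Rowed D
    rowTime = M * 18 + Q * 19 + ρ * (M * 19)
    setup : List Instr
    setup = const rBS 1 ∷ move rRS rXC ∷ move row rZ ∷ move tp rT ∷ move xp rX ∷ move i₁ rN ∷ []
    loads : List Instr
    loads = const tmp 1 ∷ add tp tp tmp ∷ load base tp ∷ add tp tp tmp ∷ load ref base ∷ add base base tmp ∷ []
    body = ops loads ⨾ computeRow ⨾ ops (add row row rM ∷ add xp xp rXR ∷ [])
    record I (i : ℕ) (τ : State) : Set where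
      field
        row≡  : reg τ row ≡ Z[ i ]
        tp≡   : reg τ tp ≡ E i
        xp≡   : reg τ xp ≡ X₀ + i * XR
        below : ∀ a → a < Z → mem τ a ≡ mem τ₀ a
        rows  : ∀ j h → j < i → h < M → mem τ (Z[ j ] + h) ≡ prod j h
    initial : I 0 (execs setup τ₀)
    initial = record
      { row≡ = trans (param P rZ) (sym (+-identityʳ Z)) ; tp≡ = trans (param P rT) (sym (+-identityʳ T₀))
      ; xp≡ = trans (param P rX) (sym (+-identityʳ X₀)) ; below = λ _ _ → refl ; rows = λ _ _ () }
    T≤Z′ : T₀ ≤ Z
    T≤Z′ = ≤-trans (m≤m+n T₀ _) T≤Z
    step : ∀ i τ → i < N → Frame (loop i₁ body) (execs setup τ₀) τ → I i τ →
           Exec body τ (6 + (rowTime + 2)) (λ υ → I (suc i) (decrement i₁ υ))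
    step i τ i<N fr J = execOps⨾ (execSeq
        (computeRow-exec {k = i} {w = x (K s)} (keepOps loads Pτ) low-τ (≤-trans F≤T (≤-trans T≤Z′ Z≤R)) i<N J.xp≡
          reference bases (≤-trans near (Entry.near (C.entries i i<N))))
        λ υ fr′ D → execOps (next υ fr′ D))
      where
      module J = I J
      own = Entry.own (C.entries i i<N)
      s = proj₁ own
      s<L = proj₁ (proj₂ own)
      K<N′ = C.K<N s (<⇒≤ s<L)
      near = proj₂ (proj₂ (proj₂ (proj₂ own)))
      R = reg τ row
      Z≤R : Z ≤ R
      Z≤R = subst (Z ≤_) (sym J.row≡) (m≤m+n Z _)
      Pτ : Params τ
      Pτ = keep fr (keepOps setup P)
      low-τ : Low τ
      low-τ a a<F = trans (J.below a (<-≤-trans a<F (≤-trans F≤T T≤Z′))) (D.low a a<F)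
      slot≡ : mem τ (reg τ tp + 1) ≡ S s
      slot≡ = trans (cong (λ t → mem τ (t + 1)) J.tp≡)
        (trans (J.below (E i + 1) (<-≤-trans (E-gap i<N) T≤Z))
          (trans (D.table (E i + 1) (≤-trans (m≤m+n T₀ _) (m≤m+n (E i) 1))) (proj₁ (proj₂ (proj₂ (proj₂ own))))))
      ref≡ : mem τ (mem τ (reg τ tp + 1)) ≡ X₀ + K s * XR
      ref≡ = trans (cong (mem τ) slot≡) (trans (J.below (S s) (<-≤-trans (S<T s<L) T≤Z′)) (D.slots s s<L))
      reference : Reference (execs loads τ) R (mem τ (mem τ (reg τ tp + 1))) (reg τ rRS) (x (K s))
      reference h h<Q = subst (_< R) (sym addr) (<-≤-trans lt (≤-trans F≤T (≤-trans T≤Z′ Z≤R))) ,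
                        trans (cong (mem τ) addr) (low-τ _ lt) , x≤1 (K s) h K<N′ h<Q
        where
        addr = cong₂ (λ a b → a + h * b) ref≡ (trans (unchanged fr rRS tt) (param P rXC))
        lt = x<F (K s) h K<N′ h<Q
      bases : ∀ j → j < M → mem τ (reg τ tp + 1) + 1 + j * reg τ rBS < R ×
              mem τ (mem τ (reg τ tp + 1) + 1 + j * reg τ rBS) ≡ Σ[ Q ] (λ h → x (K s) h * y h j)
      bases j j<M = subst (_< R) (sym addr) (<-≤-trans cell<T (≤-trans T≤Z′ Z≤R)) ,
                    trans (cong (mem τ) addr) (trans (J.below _ (<-≤-trans cell<T T≤Z′)) (D.rows s j s<L j<M))
        where
        addr : mem τ (reg τ tp + 1) + 1 + j * reg τ rBS ≡ S s + 1 + j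
        addr = cong₂ (λ a b → a + 1 + b) slot≡ (trans (cong (j *_) (unchanged fr rBS tt)) (*-identityʳ j))
        cell<T : S s + 1 + j < T₀
        cell<T = <-≤-trans (subst (_< S s + suc M) (sym (+-assoc (S s) 1 j)) (+-monoʳ-< (S s) (s<s j<M))) (S-end s<L)
      next : ∀ υ → Frame computeRow (execs loads τ) υ → Copied R (execs loads τ) (prod i) υ →
             I (suc i) (decrement i₁ (execs (add row row rM ∷ add xp xp rXR ∷ []) υ))
      next υ fr′ (copied cells out) = record
        { row≡ = trans (cong₂ _+_ (unchanged fr′ row tt) (trans (unchanged fr′ rM tt) (param Pτ rM)))
                   (advance Z i M J.row≡)
        ; tp≡ = trans (unchanged fr′ tp tt) (trans (cong (λ t → t + 1 + 1) J.tp≡) (E-next i))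
        ; xp≡ = trans (cong₂ _+_ (unchanged fr′ xp tt) (trans (unchanged fr′ rXR tt) (param Pτ rXR)))
                  (advance X₀ i XR J.xp≡)
        ; below = λ a a<Z → trans (out a (inj₁ (<-≤-trans a<Z Z≤R))) (J.below a a<Z)
        ; rows = λ j h j<1+i h<M → <1+-elim j<1+i
            (λ j<i → trans (out _ (inj₁ (subst (Z[ j ] + h <_) (sym J.row≡) (cell< j<i h<M)))) (J.rows j h j<i h<M))
            (λ { refl → trans (cong (λ r → mem υ (r + h)) (sym J.row≡)) (cells h h<M) }) }
        where
        cell< : ∀ {j h} → j < i → h < M → Z[ j ] + h < Z[ i ]
        cell< {j} {h} j<i h<M = begin-strict
          Z[ j ] + h    <⟨ +-monoʳ-< Z[ j ] h<M ⟩
          Z[ j ] + M    ≡⟨ advance Z j M refl ⟩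
          Z[ suc j ]    ≤⟨ +-monoʳ-≤ Z (*-monoˡ-≤ M j<i) ⟩
          Z[ i ]        ∎
          where open ≤-Reasoning
    bound : 6 + N * (6 + (rowTime + 2) + 5) ≤ N * (M * 37 + Q * 19 + ρ * (M * 19))
    bound = begin
      6 + N * (6 + (rowTime + 2) + 5)                          ≤⟨ absorb 6 (6 + (rowTime + 2) + 5) 1≤N ⟩
      N * (6 + (6 + (rowTime + 2) + 5))                        ≡⟨ cong (N *_) (shuffle M (Q * 19) (ρ * (M * 19))) ⟩
      N * ((19 + M * 18) + Q * 19 + ρ * (M * 19))
        ≤⟨ *-monoʳ-≤ N (+-monoˡ-≤ _ (+-monoˡ-≤ (Q * 19) (absorb 19 18 1≤M))) ⟩
      N * (M * 37 + Q * 19 + ρ * (M * 19))                     ∎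
      where
      open ≤-Reasoning
      shuffle : ∀ M a b → 6 + (6 + (M * 18 + a + b + 2) + 5) ≡ (19 + M * 18) + a + b
      shuffle = solve-∀

-- Cells read lie at p * r or above, so the output never overwrites them.
output-exec : ∀ {σ p r} {g : ℕ → ℕ → ℕ} → 1 ≤ p → 1 ≤ r → reg σ rP ≡ p → reg σ rR ≡ r →
              (∀ i j → i < p → j < r → (let a = reg σ rZ + i * reg σ rZR + j * reg σ rZC) →
                 p * r ≤ a × mem σ a ≡ g i j) →
              Exec output σ (p * (r * 21)) (λ τ → ∀ i j → i < p → j < r → mem τ (i * r + j) ≡ g i j)
output-exec {σ} {p} {r} {g} 1≤p 1≤r ep er src = weaken bound
  (execOps⨾ (conseq (λ _ _ → I.done) (execLoopConst (2 + (r * 10 + 1)) I 1≤p ep initial step)))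
  where
  z = reg σ rZ
  zr = reg σ rZR
  zc = reg σ rZC
  setup : List Instr
  setup = const wp 0 ∷ move v rZ ∷ move i₁ rP ∷ []
  inner : Cmd
  inner = loop i₂ (ops (load val u ∷ store wp val ∷ const tmp 1 ∷ add wp wp tmp ∷ add u u rZC ∷ []))
  body = ops (move u v ∷ move i₂ rR ∷ []) ⨾ inner ⨾ ops (add v v rZR ∷ [])
  record I (i : ℕ) (τ : State) : Set where
    field
      wp≡  : reg τ wp ≡ i * r
      v≡   : reg τ v ≡ z + i * zr
      high : ∀ a → p * r ≤ a → mem τ a ≡ mem σ a
      done : ∀ k j → k < i → j < r → mem τ (k * r + j) ≡ g k j
  initial : I 0 (execs setup σ)
  initial = record { wp≡ = refl ; v≡ = sym (+-identityʳ z) ; high = λ _ _ → refl ; done = λ _ _ () }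
  step : ∀ i τ → i < p → Frame (loop i₁ body) (execs setup σ) τ → I i τ →
         Exec body τ (2 + (r * 10 + 1)) (λ υ → I (suc i) (decrement i₁ υ))
  step i τ i<p fr J = execOps⨾ (execSeq
      (execLoopConst 5 I′ 1≤r (trans (unchanged fr rR tt) er)
        (record { wp≡ = trans J.wp≡ (sym (+-identityʳ _)) ; u≡ = trans J.v≡ (sym (+-identityʳ _))
                ; high = J.high ; before = λ _ _ → refl ; new = λ _ () }) step′)
      λ υ fr′ J′ → execOps (next υ fr′ J′))
    where
    module J = I J
    τ′ = execs (move u v ∷ move i₂ rR ∷ []) τ
    record I′ (j : ℕ) (υ : State) : Set where
      field
        wp≡    : reg υ wp ≡ i * r + j
        u≡     : reg υ u ≡ z + i * zr + j * zc
        high   : ∀ a → p * r ≤ a → mem υ a ≡ mem σ a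
        before : ∀ a → a < i * r → mem υ a ≡ mem τ a
        new    : ∀ h → h < j → mem υ (i * r + h) ≡ g i h
    end≤ : i * r + r ≤ p * r
    end≤ = ≤-trans (≤-reflexive (+-comm (i * r) r)) (*-monoˡ-≤ r i<p)
    step′ : ∀ j υ → j < r → Frame inner τ′ υ → I′ j υ →
            Exec (ops (load val u ∷ store wp val ∷ const tmp 1 ∷ add wp wp tmp ∷ add u u rZC ∷ [])) υ 5
              (λ ω → I′ (suc j) (decrement i₂ ω))
    step′ j υ j<r fr′ H = execOps (record
      { wp≡ = trans (cong (_+ 1) H.wp≡) (+-suc-1 (i * r) j)
      ; u≡ = trans (cong (reg υ u +_) (trans (unchanged fr′ rZC tt) (unchanged fr rZC tt)))
               (advance (z + i * zr) j zc H.u≡)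
      ; high = λ a pr≤a → trans (elsewhere a (>⇒≢ (<-≤-trans (+-monoʳ-< (i * r) j<r) (≤-trans end≤ pr≤a)))) (H.high a pr≤a)
      ; before = λ a a< → trans (elsewhere a (<⇒≢ (<-≤-trans a< (m≤m+n (i * r) j)))) (H.before a a<)
      ; new = λ h h<1+j → <1+-elim h<1+j
          (λ h<j → trans (elsewhere (i * r + h) (<⇒≢ (+-monoʳ-< (i * r) h<j))) (H.new h h<j))
          (λ { refl → trans (update-same (mem υ) (reg υ wp) (sym H.wp≡))
                 (trans (cong (mem υ) H.u≡) (trans (H.high _ (proj₁ (src i j i<p j<r))) (proj₂ (src i j i<p j<r)))) }) })
      where
      module H = I′ H
      elsewhere : ∀ a → a ≢ i * r + j → (mem υ [ reg υ wp ↦ mem υ (reg υ u) ]) a ≡ mem υ a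
      elsewhere a ne = update-other (mem υ) (λ eq → ne (trans eq H.wp≡))
    next : ∀ υ → Frame inner τ′ υ → I′ r υ → I (suc i) (decrement i₁ (execs (add v v rZR ∷ []) υ))
    next υ fr′ H = record
      { wp≡ = trans H.wp≡ (+-comm (i * r) r)
      ; v≡ = trans (cong₂ _+_ (unchanged fr′ v tt) (trans (unchanged fr′ rZR tt) (unchanged fr rZR tt)))
               (advance z i zr J.v≡)
      ; high = H.high
      ; done = λ k j k<1+i j<r → <1+-elim k<1+i
          (λ k<i → trans (H.before _ (<-≤-trans (+-monoʳ-< (k * r) j<r)
                     (≤-trans (≤-reflexive (+-comm (k * r) r)) (*-monoˡ-≤ r k<i)))) (J.done k j k<i j<r))
          (λ { refl → H.new j j<r }) }
      where module H = I′ H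
  bound : 3 + p * (2 + (r * 10 + 1) + 5) ≤ p * (r * 21)
  bound = begin
    3 + p * (2 + (r * 10 + 1) + 5)     ≤⟨ absorb 3 (2 + (r * 10 + 1) + 5) 1≤p ⟩
    p * (3 + (2 + (r * 10 + 1) + 5))   ≡⟨ cong (p *_) (shuffle r) ⟩
    p * (11 + r * 10)                  ≤⟨ *-monoʳ-≤ p (absorb 11 10 1≤r) ⟩
    p * (r * 21)                       ∎
    where
    open ≤-Reasoning
    shuffle : ∀ r → 3 + (2 + (r * 10 + 1) + 5) ≡ 11 + r * 10
    shuffle = solve-∀

-- Matrices in memory

nth-++ˡ : ∀ {X : Set} {d : X} xs {ys i} → i < length xs → nth d (xs ++ ys) i ≡ nth d xs i
nth-++ˡ (x ∷ xs) {i = zero}  _   = refl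
nth-++ˡ (x ∷ xs) {i = suc i} i<n = nth-++ˡ xs (≤-pred i<n)

nth-++ʳ : ∀ {X : Set} {d : X} xs {ys i} → nth d (xs ++ ys) (length xs + i) ≡ nth d ys i
nth-++ʳ []       = refl
nth-++ʳ (x ∷ xs) = nth-++ʳ xs

nth-toList : ∀ {X : Set} {d : X} {n} (v : Vec X n) i → nth d (Vec.toList v) (toℕ i) ≡ lookup v i
nth-toList (x ∷ v) zero    = refl
nth-toList (x ∷ v) (suc i) = nth-toList v i

nth-bound : ∀ {W} xs → All (_≤ W) xs → ∀ i → nth 0 xs i ≤ W
nth-bound []       []       i       = z≤n
nth-bound (x ∷ xs) (h ∷ _)  zero    = h
nth-bound (x ∷ xs) (_ ∷ hs) (suc i) = nth-bound xs hs i

contents : ∀ {m n} → Matrix01 m n → List ℕ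
contents A = Vec.toList (Vec.map bit (Vec.concat A))

bit≤1 : ∀ b → bit b ≤ 1
bit≤1 false = z≤n
bit≤1 true  = ≤-refl

contents≤1 : ∀ {m n} (A : Matrix01 m n) → All (_≤ 1) (contents A)
contents≤1 A = bits (Vec.concat A)
  where
  bits : ∀ {n} (v : Vec Bool n) → All (_≤ 1) (Vec.toList (Vec.map bit v))
  bits []      = []
  bits (b ∷ v) = bit≤1 b ∷ bits v

nth-contents : ∀ {m n} (A : Matrix01 m n) i h → nth 0 (contents A) (toℕ i * n + toℕ h) ≡ bit (lookup (lookup A i) h)
nth-contents {m} {n} A i h = begin
  nth 0 (contents A) (toℕ i * n + toℕ h)
    ≡⟨ cong (λ k → nth 0 (contents A) (k + toℕ h)) (*-comm (toℕ i) n) ⟩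
  nth 0 (contents A) (n * toℕ i + toℕ h)
    ≡⟨ cong (nth 0 (contents A)) (toℕ-combine i h) ⟨
  nth 0 (contents A) (toℕ (Fin.combine i h))
    ≡⟨ nth-toList (Vec.map bit (Vec.concat A)) (Fin.combine i h) ⟩
  lookup (Vec.map bit (Vec.concat A)) (Fin.combine i h)
    ≡⟨ lookup-map (Fin.combine i h) bit (Vec.concat A) ⟩
  bit (lookup (Vec.concat A) (Fin.combine i h))
    ≡⟨ cong bit (lookup-concat A i h) ⟩
  bit (lookup (lookup A i) h) ∎
  where open ≡-Reasoning

length-contents : ∀ {m n} (A : Matrix01 m n) → length (contents A) ≡ m * n
length-contents A = length-toList (Vec.map bit (Vec.concat A))

index< : ∀ {m n i h} → i < m → h < n → i * n + h < m * n
index< {m} {n} {i} {h} i<m h<n = begin-strict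
  i * n + h    <⟨ +-monoʳ-< (i * n) h<n ⟩
  i * n + n    ≡⟨ +-comm (i * n) n ⟩
  suc i * n    ≤⟨ *-monoˡ-≤ n i<m ⟩
  m * n        ∎
  where open ≤-Reasoning

lookup-transpose : ∀ {X : Set} {m n} (A : Vec (Vec X n) m) i j → lookup (lookup (transpose A) j) i ≡ lookup (lookup A i) j
lookup-transpose {m = suc m} {n} (v ∷ A) i j = trans (cong (λ w → lookup w i) column) (cell i)
  where
  column : lookup (transpose (v ∷ A)) j ≡ lookup v j ∷ lookup (transpose A) j
  column = trans (lookup-⊛ j (Vec.replicate n Vec._∷_ Vec.⊛ v) (transpose A))
    (cong (λ f → f (lookup (transpose A) j))
      (trans (lookup-⊛ j (Vec.replicate n Vec._∷_) v) (cong (λ f → f (lookup v j)) (lookup-replicate j Vec._∷_))))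
  cell : ∀ i → lookup (lookup v j ∷ lookup (transpose A) j) i ≡ lookup (lookup (v ∷ A) i) j
  cell zero    = refl
  cell (suc i) = lookup-transpose A i j

sum-tabulate : ∀ n {f : Fin n → ℕ} {g : ℕ → ℕ} → (∀ h → f h ≡ g (toℕ h)) → Vec.sum (tabulate f) ≡ Σ[ n ] g
sum-tabulate zero        h = refl
sum-tabulate (suc n) {f} {g} h =
  trans (cong₂ _+_ (h zero) (sum-tabulate n (h ∘ suc))) (sym (Σ-split n g))

diff-xor : ∀ a b → bit (a xor b) ≡ diff (bit a) (bit b)
diff-xor false false = refl
diff-xor false true  = refl
diff-xor true  false = refl
diff-xor true  true  = refl

ham-distance : ∀ {n} (a b : Vec Bool n) {x w : ℕ → ℕ} → (∀ h → bit (lookup a h) ≡ x (toℕ h)) →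
               (∀ h → bit (lookup b h) ≡ w (toℕ h)) → ham a b ≡ distance n x w
ham-distance []      []      hx hw = refl
ham-distance {suc n} (a ∷ v) (b ∷ z) {x} {w} hx hw = trans
  (cong₂ _+_ (trans (diff-xor a b) (cong₂ diff (hx zero) (hw zero))) (ham-distance v z {x ∘ suc} {w ∘ suc} (hx ∘ suc) (hw ∘ suc)))
  (sym (Σ-split n (λ h → diff (x h) (w h))))

-- Well separated points

-- The intermediate point is the second argument in both summands. In this form the inequality
-- yields the pigeonhole estimate without an appeal to symmetry.
ham-triangle : ∀ {n} (a b u : Vec Bool n) → ham a b ≤ ham a u + ham b u
ham-triangle []      []      []      = z≤n
ham-triangle (a ∷ v) (b ∷ w) (c ∷ z) = begin
  bit (a xor b) + ham v w                                      ≤⟨ +-mono-≤ (triangle a b c) (ham-triangle v w z) ⟩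
  (bit (a xor c) + bit (b xor c)) + (ham v z + ham w z)        ≡⟨ shuffle (bit (a xor c)) _ _ _ ⟩
  (bit (a xor c) + ham v z) + (bit (b xor c) + ham w z)        ∎
  where
  open ≤-Reasoning
  shuffle : ∀ a b c d → (a + b) + (c + d) ≡ (a + c) + (b + d)
  shuffle = solve-∀
  triangle : ∀ a b c → bit (a xor b) ≤ bit (a xor c) + bit (b xor c)
  triangle false false c     = z≤n
  triangle true  true  c     = z≤n
  triangle false true  false = ≤-refl
  triangle false true  true  = ≤-refl
  triangle true  false false = ≤-refl
  triangle true  false true  = ≤-refl

length-subsets : ∀ {X : Set} m (xs : List X) → All (λ S → length S ≡ m) (subsetsOfSize m xs)
length-subsets zero    xs       = refl ∷ []
length-subsets (suc m) []       = []
length-subsets (suc m) (x ∷ xs) =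
  All.++⁺ (All.map⁺ (All.map (cong suc) (length-subsets m xs))) (length-subsets (suc m) xs)

-- Of more points than centers, two have the same closest center.
separated≤cover : ∀ {X : Set} (d : X → X → ℕ) → (∀ a b u → d a b ≤ d a u + d b u) →
                  ∀ {m n ρ R} (center : Fin m → X) (point : Fin n → X) → m < n →
                  (∀ s → ∃[ k ] d (point s) (center k) ≤ R) →
                  (∀ s t → s Fin.< t → ρ ≤ d (point t) (point s)) → ρ ≤ 2 * R
separated≤cover d triangle {ρ = ρ} {R} center point m<n near sep with pigeonhole m<n (proj₁ ∘ near)
... | s , t , s<t , e = begin
  ρ                                    ≤⟨ sep s t s<t ⟩
  d (point t) (point s)                ≤⟨ triangle (point t) (point s) c ⟩
  d (point t) c + d (point s) c        ≤⟨ +-mono-≤ (proj₂ (near t))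
                                            (subst (λ k → d (point s) (center k) ≤ R) e (proj₂ (near s))) ⟩
  R + R                                ≡⟨ cong (R +_) (+-identityʳ R) ⟨
  2 * R                                ∎
  where
  open ≤-Reasoning
  c = center (proj₁ (near t))

separated≤radius : ∀ {p q} (A : Matrix01 p q) S {n ρ} (K : Fin n → Fin p) → length S < n → ρ ≤ q →
                   (∀ s t → s Fin.< t → ρ ≤ ham (lookup A (K t)) (lookup A (K s))) → ρ ≤ 2 * radius A S
separated≤radius {p} {q} A S {n} {ρ} K S<n ρ≤q sep with ρ ≤? 2 * radius A S
... | yes ρ≤ = ρ≤
... | no  ρ≰ = contradiction ρ≤2R ρ≰
  where
  R = radius A S
  near : ∀ i → ∃[ k ] ham (lookup A i) (List.lookup S k) ≤ R
  near i with argmin-sel id q (map (ham (lookup A i)) S)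
            | All.lookup (xs≤max 0 (map (λ i → min q (map (ham (lookup A i)) S)) (allFin p)))
                (∈-map⁺ (λ i → min q (map (ham (lookup A i)) S)) (∈-allFin i))
  -- If `min` returns its default `q`, then q ≤ R, and already ρ ≤ q gives the claim.
  ... | inj₁ e | le = contradiction (≤-trans ρ≤q (≤-trans (≤-reflexive (sym e)) (≤-trans le (m≤m+n R _)))) ρ≰
  ... | inj₂ m | le with ∈-map⁻ (ham (lookup A i)) m
  ...   | u , u∈S , e = Any.index u∈S , (begin
    ham (lookup A i) (List.lookup S (Any.index u∈S))   ≡⟨ cong (ham (lookup A i)) (lookup-index u∈S) ⟨
    ham (lookup A i) u                                 ≡⟨ e ⟨
    min q (map (ham (lookup A i)) S)                   ≤⟨ le ⟩
    R                                                  ∎)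
    where open ≤-Reasoning
  ρ≤2R : ρ ≤ 2 * R
  ρ≤2R = separated≤cover ham ham-triangle (List.lookup S) (lookup A ∘ K) S<n (near ∘ K) sep

diff-triangle : ∀ a b u → diff a b ≤ diff a u + diff b u
diff-triangle a b u = begin
  (a ∸ b) + (b ∸ a)                                  ≤⟨ +-mono-≤ (∸-triangle a b) (∸-triangle b a) ⟩
  ((a ∸ u) + (u ∸ b)) + ((b ∸ u) + (u ∸ a))          ≡⟨ shuffle (a ∸ u) (u ∸ b) (b ∸ u) (u ∸ a) ⟩
  ((a ∸ u) + (u ∸ a)) + ((b ∸ u) + (u ∸ b))          ∎
  where
  open ≤-Reasoning
  shuffle : ∀ a b c d → (a + b) + (c + d) ≡ (a + d) + (c + b)
  shuffle = solve-∀
  ∸-triangle : ∀ a b → a ∸ b ≤ (a ∸ u) + (u ∸ b)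
  ∸-triangle a b = m≤n+o⇒m∸n≤o a b (begin
    a                              ≤⟨ m≤n+m∸n a u ⟩
    u + (a ∸ u)                    ≤⟨ +-monoˡ-≤ (a ∸ u) (m≤n+m∸n u b) ⟩
    b + (u ∸ b) + (a ∸ u)          ≡⟨ +-assoc b (u ∸ b) (a ∸ u) ⟩
    b + ((u ∸ b) + (a ∸ u))        ≡⟨ cong (b +_) (+-comm (u ∸ b) (a ∸ u)) ⟩
    b + ((a ∸ u) + (u ∸ b))        ∎)

Σ-+ : ∀ n (f g : ℕ → ℕ) → Σ[ n ] (λ h → f h + g h) ≡ Σ[ n ] f + Σ[ n ] g
Σ-+ zero    f g = refl
Σ-+ (suc n) f g = trans (cong (_+ (f n + g n)) (Σ-+ n f g)) (shuffle (Σ[ n ] f) (Σ[ n ] g) (f n) (g n))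
  where
  shuffle : ∀ a b c d → (a + b) + (c + d) ≡ (a + c) + (b + d)
  shuffle = solve-∀

distance-triangle : ∀ n a b u → distance n a b ≤ distance n a u + distance n b u
distance-triangle n a b u = ≤-trans (Σ-mono n λ h _ → diff-triangle (a h) (b h) (u h))
  (≤-reflexive (Σ-+ n (λ h → diff (a h) (u h)) (λ h → diff (b h) (u h))))

-- Each competing set has `ℓ ⊓ 2 ^ q` points, at most ℓ even when the cube is too small, so ℓ + 1
-- separated rows force two of them onto a common closest point.
separated≤λ : ∀ {p q} (A : Matrix01 p q) {a : ℕ → ℕ → ℕ} {ℓ ρ} (K : ℕ → ℕ) →
              (∀ i h → bit (lookup (lookup A i) h) ≡ a (toℕ i) (toℕ h)) →
              (∀ s → s ≤ ℓ → K s < p) → ρ ≤ q →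
              (∀ s t → s < t → t ≤ ℓ → ρ ≤ distance q (a (K t)) (a (K s))) → ρ ≤ 2 * λ-row A ℓ
separated≤λ {p} {q} A {a} {ℓ} {ρ} K link K<p ρ≤q sep =
  -- The first argument covers the default value `q` of the minimum over all sets.
  argmin-all id {P = λ v → ρ ≤ 2 * v} (≤-trans ρ≤q (m≤m+n q _))
    (All.map⁺ (All.map (λ {S} e → separated≤radius A S K′ (S<n S e) ρ≤q sep′)
      (length-subsets (ℓ ⊓ 2 ^ q) (cube q))))
  where
  K′ : Fin (suc ℓ) → Fin p
  K′ s = fromℕ< (K<p (toℕ s) (≤-pred (toℕ<n s)))
  S<n : ∀ S → length S ≡ ℓ ⊓ 2 ^ q → length S < suc ℓ
  S<n S e = s≤s (≤-trans (≤-reflexive e) (m⊓n≤m ℓ _))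
  cells : ∀ s h → bit (lookup (lookup A (K′ s)) h) ≡ a (K (toℕ s)) (toℕ h)
  cells s h = trans (link (K′ s) h) (cong (λ k → a k (toℕ h)) (toℕ-fromℕ< (K<p (toℕ s) (≤-pred (toℕ<n s)))))
  sep′ : ∀ s t → s Fin.< t → ρ ≤ ham (lookup A (K′ t)) (lookup A (K′ s))
  sep′ s t s<t = ≤-trans (sep (toℕ s) (toℕ t) s<t (≤-pred (toℕ<n t)))
    (≤-reflexive (sym (ham-distance (lookup A (K′ t)) (lookup A (K′ s)) {a (K (toℕ t))} {a (K (toℕ s))} (cells t) (cells s))))

-- Measuring a radius and solving in one mode

module Solution (σ₀ : State) (m₀ : ℕ → ℕ) (lay : Matrices.Layout σ₀ m₀) where
  open Products σ₀ m₀ lay public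

  -- What remains of a clustering once its memory is overwritten. Covering and separation suffice to
  -- compare ρ both with λ and with the radius of another run.
  record Radius (ρ : ℕ) : Set where
    field
      K         : ℕ → ℕ
      K<N       : ∀ s → s ≤ L → K s < N
      cover     : ∀ i → i < N → ∃[ s ] s < L × hd i (K s) ≤ ρ
      separated : ∀ s t → s < t → t ≤ L → ρ ≤ hd (K t) (K s)
      ρ≤Q       : ρ ≤ Q

  centers-radius : ∀ {K σ} → Centers L K σ → Radius (reg σ maxd)
  centers-radius {K} C = record
    { K = K ; K<N = K<N ; separated = separated ; ρ≤Q = maxd≤Q
    ; cover = λ i i<N → let s , s<L , _ , _ , h = Entry.own (entries i i<N) in
                s , s<L , ≤-trans h (Entry.near (entries i i<N)) }
    where open Centers C

  -- The two runs are not compared step by step. The `L` + 1 separated points of one are covered by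
  -- the `L` centers of the other, so two of them share a center.
  radius-twice : ∀ {ρ ρ′} → Radius ρ → Radius ρ′ → ρ′ ≤ 2 * ρ
  radius-twice {ρ} R R′ = separated≤cover (distance Q) (distance-triangle Q)
      (λ (k : Fin L) → x (R.K (toℕ k))) (λ (s : Fin (suc L)) → x (R′.K (toℕ s))) ≤-refl near
      (λ s t s<t → R′.separated (toℕ s) (toℕ t) s<t (≤-pred (toℕ<n t)))
    where
    module R = Radius R
    module R′ = Radius R′
    near : ∀ (s : Fin (suc L)) → ∃[ k ] distance Q (x (R′.K (toℕ s))) (x (R.K (toℕ k))) ≤ ρ
    near s with R.cover (R′.K (toℕ s)) (R′.K<N (toℕ s) (≤-pred (toℕ<n s)))
    ... | t , t<L , h = fromℕ< t<L , subst (λ t → hd (R′.K (toℕ s)) (R.K t) ≤ ρ) (sym (toℕ-fromℕ< t<L)) h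

  clusterTime : ℕ
  clusterTime = L * (N * (Q * 72))

  measure-exec : ∀ {mode ρ σ} → Exec mode σ 18 (λ τ → Params τ × mem τ ≡ mem σ) → Low σ →
                 Exec (measure mode ρ) σ (18 + (clusterTime + 2)) (λ τ → Radius (reg τ ρ) × Low τ)
  measure-exec {mode} {ρ} {σ} setMode low = execSeq setMode λ τ _ (P , em) →
    execSeq (cluster-exec P (λ a a<F → trans (cong (λ m → m a) em) (low a a<F)))
    λ υ fr (K , C) → execOps
      ( subst Radius (sym (trans (update-same (reg (exec (sub val rQ maxd) υ)) ρ refl) (saved υ (keep fr P) C)))
          (centers-radius C)
      , Centers.low C )
    where
    saved : ∀ {K} υ → Params υ → Centers L K υ → reg υ rQ ∸ (reg υ rQ ∸ reg υ maxd) ≡ reg υ maxd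
    saved υ P C = m∸[m∸n]≡n (subst (reg υ maxd ≤_) (sym (param P rQ)) (Centers.maxd≤Q C))

  solveTime : ℕ → ℕ
  solveTime ρ = clusterTime + (L * (Q * (M * 73)) + (N * (M * 37 + Q * 19 + ρ * (M * 19)) +
                (reg σ₀ rP * (reg σ₀ rR * 21) + 1)))

  -- The hypothesis on destinations carries the orientation: entry (i, j) of AB is entry (i, j) of
  -- XY in row mode and (j, i) in column mode. The time is that for radius 2 ρ, with ρ the measured
  -- radius, because the renewed clustering ends with a radius of its own.
  solveMode-exec : ∀ {σ ρ} {g : ℕ → ℕ → ℕ} → (let p = reg σ₀ rP ; r = reg σ₀ rR) → 1 ≤ p → 1 ≤ r →
                   Params σ → Low σ → Radius ρ → p * r ≤ F →
                   (∀ i j → i < p → j < r → ∃[ a ] ∃[ b ] a < N × b < M × prod a b ≡ g i j ×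
                      Z + i * reg σ₀ rZR + j * reg σ₀ rZC ≡ Z[ a ] + b) →
                   Exec solveMode σ (solveTime (2 * ρ))
                     (λ τ → reg τ rP ≡ 0 × (∀ i j → i < p → j < r → mem τ (i * r + j) ≡ g i j))
  solveMode-exec {σ} {ρ} {g} 1≤p 1≤r P low R pr≤F dest =
    execSeq (cluster-exec P low) λ τ₁ fr₁ (K , C) → let P₁ = keep fr₁ P in
    execSeq (centerRows-exec P₁ C) λ τ₂ fr₂ D → let P₂ = keep fr₂ P₁ in
    execSeq (weaken (rows≤ (radius-twice R (centers-radius C))) (allRows-exec P₂ C D refl)) λ τ₃ fr₃ H →
    execSeq (output-exec 1≤p 1≤r (param (keep fr₃ P₂) rP) (param (keep fr₃ P₂) rR) (source τ₃ (keep fr₃ P₂) H))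
    λ τ₄ _ G → execOps (refl , G)
    where
    rows≤ : ∀ {ρ′} → ρ′ ≤ 2 * ρ →
            N * (M * 37 + Q * 19 + ρ′ * (M * 19)) ≤ N * (M * 37 + Q * 19 + 2 * ρ * (M * 19))
    rows≤ h = *-monoʳ-≤ N (+-monoʳ-≤ (M * 37 + Q * 19) (*-monoˡ-≤ (M * 19) h))
    source : ∀ τ → Params τ → Multiplied τ → ∀ i j → i < reg σ₀ rP → j < reg σ₀ rR →
             (let a = reg τ rZ + i * reg τ rZR + j * reg τ rZC) →
             reg σ₀ rP * reg σ₀ rR ≤ a × mem τ a ≡ g i j
    source τ P′ H i j i<p j<r with dest i j i<p j<r
    ... | a , b , a<N , b<M , eq , addr =
      subst (λ c → reg σ₀ rP * reg σ₀ rR ≤ c × mem τ c ≡ g i j)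
        (sym (trans (cong₂ _+_ (cong₂ (λ z s → z + i * s) (param P′ rZ) (param P′ rZR)) (cong (j *_) (param P′ rZC)))
                    addr))
        ( ≤-trans pr≤F (≤-trans F≤T (≤-trans (m≤m+n T₀ _) (≤-trans T≤Z (≤-trans (m≤m+n Z _) (m≤m+n _ b)))))
        , trans (H a b a<N b<M) eq )

-- Parameter tables for the modules above: the contents of registers 0 to 19 once a mode is set,
-- with `b` the address of B and `f` the first free cell.
rowState colState : (p q r ℓ k b f : ℕ) → (ℕ → ℕ) → State
rowState p q r ℓ k b f m = state 0 (nth 0
  (p ∷ q ∷ r ∷ ℓ ∷ k ∷ p ∷ r ∷ ℓ ∷ q ∷ 1 ∷ r ∷ 1 ∷ r ∷ 1 ∷ 0 ∷ b ∷ f ∷ f + 1 ∷ f + 1 + ℓ * r + ℓ ∷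
   f + 1 + ℓ * r + ℓ + p + p ∷ [])) m
colState p q r ℓ k b f m = state 0 (nth 0
  (p ∷ q ∷ r ∷ ℓ ∷ k ∷ r ∷ p ∷ k ∷ 1 ∷ r ∷ 1 ∷ q ∷ 1 ∷ p ∷ b ∷ 0 ∷ f ∷ f + 1 ∷ f + 1 + k * p + k ∷
   f + 1 + k * p + k + r + r ∷ [])) m

record Ready (p q r ℓ k b f : ℕ) (m : ℕ → ℕ) (σ : State) : Set where
  constructor ready
  field
    p≡ : reg σ rP ≡ p
    q≡ : reg σ rQ ≡ q
    r≡ : reg σ rR ≡ r
    ℓ≡ : reg σ rL₁ ≡ ℓ
    k≡ : reg σ rL₂ ≡ k
    b≡ : reg σ rB ≡ b
    f≡ : reg σ rF ≡ f
    low : ∀ a → a < f → mem σ a ≡ m a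

inputRegs : List Reg
inputRegs = rP ∷ rQ ∷ rR ∷ rL₁ ∷ rL₂ ∷ rB ∷ rF ∷ []

keepReady : ∀ {c p q r ℓ k b f m σ τ} →
            {h : T (all (fresh c) inputRegs)} → Frame c σ τ →
            Ready p q r ℓ k b f m σ → (∀ a → a < f → mem τ a ≡ m a) → Ready p q r ℓ k b f m τ
keepReady {c} {h = h} fr S low with All.all⁺ (fresh c) inputRegs h
... | hp ∷ hq ∷ hr ∷ hℓ ∷ hk ∷ hb ∷ hf ∷ [] = ready
  (trans (unchanged fr _ hp) p≡) (trans (unchanged fr _ hq) q≡) (trans (unchanged fr _ hr) r≡)
  (trans (unchanged fr _ hℓ) ℓ≡) (trans (unchanged fr _ hk) k≡) (trans (unchanged fr _ hb) b≡)
  (trans (unchanged fr _ hf) f≡) low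
  where open Ready S hiding (low)

rowMode-exec : ∀ {p q r ℓ k b f m σ} → Ready p q r ℓ k b f m σ →
               Exec rowMode σ 18 (λ τ → Core.Params (rowState p q r ℓ k b f m) τ × mem τ ≡ mem σ)
rowMode-exec (ready refl refl refl refl refl refl refl _) = execOps (Core.params (λ
  { 0 → refl ; 1 → refl ; 2 → refl ; 3 → refl ; 4 → refl ; 5 → refl ; 6 → refl ; 7 → refl ; 8 → refl ; 9 → refl
  ; 10 → refl ; 11 → refl ; 12 → refl ; 13 → refl ; 14 → refl ; 15 → refl ; 16 → refl ; 17 → refl ; 18 → refl
  ; 19 → refl }) , refl)

colMode-exec : ∀ {p q r ℓ k b f m σ} → Ready p q r ℓ k b f m σ →
               Exec colMode σ 18 (λ τ → Core.Params (colState p q r ℓ k b f m) τ × mem τ ≡ mem σ)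
colMode-exec (ready refl refl refl refl refl refl refl _) = execOps (Core.params (λ
  { 0 → refl ; 1 → refl ; 2 → refl ; 3 → refl ; 4 → refl ; 5 → refl ; 6 → refl ; 7 → refl ; 8 → refl ; 9 → refl
  ; 10 → refl ; 11 → refl ; 12 → refl ; 13 → refl ; 14 → refl ; 15 → refl ; 16 → refl ; 17 → refl ; 18 → refl
  ; 19 → refl }) , refl)

chooseMode-exec : ∀ {p q r ℓ k b f m σ} → Ready p q r ℓ k b f m σ →
  (let c₁ = p * r * reg σ rρ₁ + q * r * ℓ ; c₂ = p * r * reg σ rρ₂ + p * q * k) →
  Exec chooseMode σ 49 (λ τ → mem τ ≡ mem σ ×
    ((Core.Params (rowState p q r ℓ k b f m) τ × c₁ ≤ c₂) ⊎ (Core.Params (colState p q r ℓ k b f m) τ × c₂ ≤ c₁)))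
chooseMode-exec {σ = σ} S@(ready refl refl refl refl refl refl refl low) =
  execOps⨾ (execSeq (colMode-exec (keepReady (frame compareCosts σ) S low)) λ τ fr (P , em) →
    execUnless
      (λ z → em , inj₂ (P , m∸n≡0⇒m≤n (trans (sym (unchanged fr select tt)) z)))
      (λ ne → conseq
        (λ υ _ (P′ , em′) → trans em′ em ,
           inj₁ (P′ , <⇒≤ (m∸n≢0⇒n<m λ z → ne (trans (unchanged fr select tt) z))))
        (rowMode-exec (keepReady fr (keepReady (frame compareCosts σ) S low)
          (λ a a<f → trans (cong (λ m → m a) em) (low a a<f))))))

-- Both `p r` and `N M` occur because the output loop runs over AB in either mode, while everything
-- else runs over XY.
solveTime-bound : ∀ N M L Q ρ p r → 1 ≤ N → 1 ≤ M → 1 ≤ L → p * r ≡ N * M →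
  L * (N * (Q * 72)) + (L * (Q * (M * 73)) + (N * (M * 37 + Q * 19 + 2 * ρ * (M * 19)) + (p * (r * 21) + 1)))
  ≤ 91 * (N * Q * L) + 73 * (N * M * ρ + M * Q * L) + 59 * (N * M)
solveTime-bound N M L Q ρ p r 1≤N 1≤M 1≤L pr = begin
  L * (N * (Q * 72)) + (L * (Q * (M * 73)) + (N * (M * 37 + Q * 19 + 2 * ρ * (M * 19)) + (p * (r * 21) + 1)))
    ≡⟨ expand N M L Q ρ p r ⟩
  72 * (N * Q * L) + 19 * (N * Q) + 73 * (M * Q * L) + 38 * (N * M * ρ) + (37 * (N * M) + 21 * (p * r) + 1)
    ≤⟨ +-mono-≤ (+-mono-≤ (+-monoˡ-≤ (73 * (M * Q * L)) (+-monoʳ-≤ (72 * (N * Q * L)) (*-monoʳ-≤ 19 NQ≤)))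
                          -- Raising 38 to 73 gives both terms the same weight, so that their sum is
                          -- the quantity by which `compareCosts` chooses the mode.
                          (*-monoˡ-≤ (N * M * ρ) (m≤m+n 38 35)))
         (+-mono-≤ (+-monoʳ-≤ (37 * (N * M)) (≤-reflexive (cong (21 *_) pr))) (*-mono-≤ 1≤N 1≤M)) ⟩
  72 * (N * Q * L) + 19 * (N * Q * L) + 73 * (M * Q * L) + 73 * (N * M * ρ) + (37 * (N * M) + 21 * (N * M) + N * M)
    ≡⟨ collect (N * Q * L) (M * Q * L) (N * M * ρ) (N * M) ⟩
  91 * (N * Q * L) + 73 * (N * M * ρ + M * Q * L) + 59 * (N * M) ∎
  where
  open ≤-Reasoning
  NQ≤ : N * Q ≤ N * Q * L
  NQ≤ = m≤m*n (N * Q) L {{>-nonZero 1≤L}}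
  expand : ∀ N M L Q ρ p r →
    L * (N * (Q * 72)) + (L * (Q * (M * 73)) + (N * (M * 37 + Q * 19 + 2 * ρ * (M * 19)) + (p * (r * 21) + 1)))
    ≡ 72 * (N * Q * L) + 19 * (N * Q) + 73 * (M * Q * L) + 38 * (N * M * ρ) + (37 * (N * M) + 21 * (p * r) + 1)
  expand = solve-∀
  collect : ∀ a b c d → 72 * a + 19 * a + 73 * b + 73 * c + (37 * d + 21 * d + d) ≡ 91 * a + 73 * (c + b) + 59 * d
  collect = solve-∀

-- Both modes on a given input

module Instance {p q r : ℕ} (A : Matrix01 p q) (B : Matrix01 q r) (ℓ k : ℕ)
                (1≤q : 1 ≤ q) (1≤ℓ : 1 ≤ ℓ) (ℓ≤p : ℓ ≤ p) (1≤k : 1 ≤ k) (k≤r : k ≤ r) where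

  1≤p : 1 ≤ p
  1≤p = ≤-trans 1≤ℓ ℓ≤p

  1≤r : 1 ≤ r
  1≤r = ≤-trans 1≤k k≤r

  σᵢ : State
  σᵢ = input A B ℓ k

  m₀ : ℕ → ℕ
  m₀ = mem σᵢ

  f : ℕ
  f = p * q + q * r + p * r

  row′ col′ : State
  row′ = rowState p q r ℓ k (p * q) f m₀
  col′ = colState p q r ℓ k (p * q) f m₀

  m₀≤1 : ∀ a → m₀ a ≤ 1
  m₀≤1 = nth-bound (contents A ++ contents B) (All.++⁺ (contents≤1 A) (contents≤1 B))

  at-A : ∀ i h → bit (lookup (lookup A i) h) ≡ m₀ (toℕ i * q + toℕ h)
  at-A i h = sym (trans
    (nth-++ˡ (contents A) (subst (toℕ i * q + toℕ h <_) (sym (length-contents A)) (index< (toℕ<n i) (toℕ<n h))))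
    (nth-contents A i h))

  at-B : ∀ h j → bit (lookup (lookup B h) j) ≡ m₀ (p * q + (toℕ h * r + toℕ j))
  at-B h j = sym (trans
    (cong (λ l → m₀ (l + (toℕ h * r + toℕ j))) (sym (length-contents A)))
    (trans (nth-++ʳ (contents A)) (nth-contents B h j)))

  row-A : ∀ i h → 0 + i * q + h * 1 ≡ i * q + h
  row-A i h = cong (i * q +_) (*-identityʳ h)

  row-B : ∀ h j → p * q + h * r + j * 1 ≡ p * q + (h * r + j)
  row-B h j = trans (cong (p * q + h * r +_) (*-identityʳ j)) (+-assoc (p * q) (h * r) j)

  col-B : ∀ j h → p * q + j * 1 + h * r ≡ p * q + (h * r + j)
  col-B j h = trans (cong (λ j → p * q + j + h * r) (*-identityʳ j))
    (trans (+-assoc (p * q) j (h * r)) (cong (p * q +_) (+-comm j (h * r))))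

  col-A : ∀ h i → 0 + h * 1 + i * q ≡ i * q + h
  col-A h i = trans (cong (_+ i * q) (*-identityʳ h)) (+-comm h (i * q))

  A<f : ∀ {a i h} → a ≡ i * q + h → i < p → h < q → a < f
  A<f refl i<p h<q = <-≤-trans (index< i<p h<q) (≤-trans (m≤m+n (p * q) (q * r)) (m≤m+n _ (p * r)))

  B<f : ∀ {a h j} → a ≡ p * q + (h * r + j) → h < q → j < r → a < f
  B<f refl h<q j<r = <-≤-trans (+-monoʳ-< (p * q) (index< h<q j<r)) (m≤m+n _ (p * r))

  slots≤ : ∀ D L M → D + L * suc M ≤ D + L * M + L
  slots≤ D L M = ≤-reflexive (lemma D L M)
    where
    lemma : ∀ D L M → D + L * suc M ≡ D + L * M + L
    lemma = solve-∀

  table≤ : ∀ t N → t + N * 2 ≤ t + N + N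
  table≤ t N = ≤-reflexive (lemma t N)
    where
    lemma : ∀ t N → t + N * 2 ≡ t + N + N
    lemma = solve-∀

  rowLayout : Matrices.Layout row′ m₀
  rowLayout = record
    { 1≤N = 1≤p ; 1≤M = 1≤r ; 1≤L = 1≤ℓ ; 1≤Q = 1≤q
    ; x<F = λ i h i<p h<q → A<f (row-A i h) i<p h<q
    ; x≤1 = λ _ _ _ _ → m₀≤1 _
    ; y<F = λ h j h<q j<r → B<f (row-B h j) h<q j<r
    ; y≤1 = λ _ _ _ _ → m₀≤1 _
    ; F<D = m<m+n f z<s ; D≤T = slots≤ (f + 1) ℓ r ; T≤Z = table≤ _ p }

  colLayout : Matrices.Layout col′ m₀
  colLayout = record
    { 1≤N = 1≤r ; 1≤M = 1≤p ; 1≤L = 1≤k ; 1≤Q = 1≤q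
    ; x<F = λ j h j<r h<q → B<f (col-B j h) h<q j<r
    ; x≤1 = λ _ _ _ _ → m₀≤1 _
    ; y<F = λ h i h<q i<p → A<f (col-A h i) i<p h<q
    ; y≤1 = λ _ _ _ _ → m₀≤1 _
    ; F<D = m<m+n f z<s ; D≤T = slots≤ (f + 1) k p ; T≤Z = table≤ _ r }

  module Row = Solution row′ m₀ rowLayout
  module Col = Solution col′ m₀ colLayout

  row-radius : ∀ {ρ} → Row.Radius ρ → ρ ≤ 2 * λ-row A ℓ
  row-radius R = separated≤λ A {Row.x} K (λ i h → trans (at-A i h) (cong m₀ (sym (row-A (toℕ i) (toℕ h))))) K<N ρ≤Q separated
    where open Row.Radius R

  col-radius : ∀ {ρ} → Col.Radius ρ → ρ ≤ 2 * λ-col B k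
  col-radius R = separated≤λ (transpose B) {Col.x} K
      (λ j h → trans (cong bit (lookup-transpose B h j)) (trans (at-B h j) (cong m₀ (sym (col-B (toℕ j) (toℕ h))))))
      K<N ρ≤Q separated
    where open Col.Radius R

  g : ℕ → ℕ → ℕ
  g = Row.prod

  col-prod : ∀ i j → Col.prod j i ≡ g i j
  col-prod i j = Σ-cong q λ h _ → trans
    (cong₂ (λ a b → m₀ a * m₀ b) (trans (col-B j h) (sym (row-B h j))) (trans (col-A h i) (sym (row-A i h))))
    (*-comm (m₀ (p * q + h * r + j * 1)) (m₀ (0 + i * q + h * 1)))

  product≡g : ∀ i j → product A B i j ≡ g (toℕ i) (toℕ j)
  product≡g i j = sum-tabulate q λ h → cong₂ _*_
    (trans (at-A i h) (cong m₀ (sym (row-A (toℕ i) (toℕ h)))))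
    (trans (at-B h j) (cong m₀ (sym (row-B (toℕ h) (toℕ j)))))

  V₁ V₂ G P₁₂ : ℕ
  V₁ = p * r * (1 ⊔ λ-row A ℓ) + r * q * ℓ
  V₂ = p * r * (1 ⊔ λ-col B k) + p * q * k
  G = V₁ ⊓ V₂
  P₁₂ = p * q * ℓ + r * q * k

  -- The output has p r entries even if λ vanishes; the maximum with 1 leaves room for writing them.
  pr≤G : p * r ≤ G
  pr≤G = ⊓-glb (pr≤ (λ-row A ℓ) (r * q * ℓ)) (pr≤ (λ-col B k) (p * q * k))
    where
    pr≤ : ∀ v s → p * r ≤ p * r * (1 ⊔ v) + s
    pr≤ v s = ≤-trans (≤-trans (≤-reflexive (sym (*-identityʳ (p * r)))) (*-monoʳ-≤ (p * r) (m≤m⊔n 1 v))) (m≤m+n _ s)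

  1≤G : 1 ≤ G
  1≤G = ≤-trans (*-mono-≤ 1≤p 1≤r) pr≤G

  double-V : ∀ {ρ v s} → ρ ≤ 2 * v → p * r * ρ + s ≤ 2 * (p * r * (1 ⊔ v) + s)
  double-V {ρ} {v} {s} h = begin
    p * r * ρ + s                            ≤⟨ +-mono-≤ (*-monoʳ-≤ (p * r) (≤-trans h (*-monoʳ-≤ 2 (m≤n⊔m 1 v))))
                                                  (m≤m+n s _) ⟩
    p * r * (2 * (1 ⊔ v)) + (s + (s + 0))    ≡⟨ lemma (p * r) (1 ⊔ v) s ⟩
    2 * (p * r * (1 ⊔ v) + s)                ∎
    where
    open ≤-Reasoning
    lemma : ∀ a b s → a * (2 * b) + (s + (s + 0)) ≡ 2 * (a * b + s)
    lemma = solve-∀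

  -- `W` is the smaller of two measured costs, each at most twice its ideal value. It is therefore
  -- at most twice both ideal values, and hence twice their minimum, even if the mode chosen is not
  -- the ideal one. Here 205 = 73 * 2 + 59.
  solve-bound : ∀ {P W} → P ≤ P₁₂ → W ≤ 2 * V₁ → W ≤ 2 * V₂ →
                91 * P + 73 * W + 59 * (p * r) ≤ 91 * P₁₂ + 205 * G
  solve-bound {P} {W} P≤ W≤₁ W≤₂ = begin
    91 * P + 73 * W + 59 * (p * r)
      ≤⟨ +-mono-≤ (+-mono-≤ (*-monoʳ-≤ 91 P≤) (*-monoʳ-≤ 73 W≤2G)) (*-monoʳ-≤ 59 pr≤G) ⟩
    91 * P₁₂ + 73 * (2 * G) + 59 * G   ≡⟨ lemma P₁₂ G ⟩
    91 * P₁₂ + 205 * G                 ∎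
    where
    open ≤-Reasoning
    W≤2G : W ≤ 2 * G
    W≤2G = ≤-trans (⊓-glb W≤₁ W≤₂) (≤-reflexive (sym (*-distribˡ-⊓ 2 V₁ V₂)))
    lemma : ∀ a g → 91 * a + 73 * (2 * g) + 59 * g ≡ 91 * a + 205 * g
    lemma = solve-∀

  Solved : State → Set
  Solved τ = reg τ rP ≡ 0 × (∀ i j → i < p → j < r → mem τ (i * r + j) ≡ g i j)

  -- The output overwrites the input from address 0 on and must end before the free memory, where
  -- its source lies.
  pr≤f : p * r ≤ f
  pr≤f = m≤n+m (p * r) (p * q + q * r)

  row-solve : ∀ {σ ρ} → Core.Params row′ σ → Row.Low σ → Row.Radius ρ →
              (let W = p * r * ρ + q * r * ℓ) → W ≤ 2 * V₁ → W ≤ 2 * V₂ →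
              Exec solveMode σ (91 * P₁₂ + 205 * G) Solved
  row-solve {σ} {ρ} P low R W≤₁ W≤₂ = weaken bound (Row.solveMode-exec {g = g} 1≤p 1≤r P low R pr≤f
    λ i j i<p j<r → i , j , i<p , j<r , refl , cong (Row.Z + i * r +_) (*-identityʳ j))
    where
    bound : Row.solveTime (2 * ρ) ≤ 91 * P₁₂ + 205 * G
    bound = ≤-trans (solveTime-bound p r ℓ q ρ p r 1≤p 1≤r 1≤ℓ refl)
      (≤-trans (≤-reflexive (cong (λ s → 91 * (p * q * ℓ) + 73 * (p * r * ρ + s * ℓ) + 59 * (p * r)) {r * q} {q * r} (*-comm r q)))
        (solve-bound (m≤m+n (p * q * ℓ) (r * q * k)) W≤₁ W≤₂))

  col-solve : ∀ {σ ρ} → Core.Params col′ σ → Col.Low σ → Col.Radius ρ →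
              (let W = p * r * ρ + p * q * k) → W ≤ 2 * V₁ → W ≤ 2 * V₂ →
              Exec solveMode σ (91 * P₁₂ + 205 * G) Solved
  col-solve {σ} {ρ} P low R W≤₁ W≤₂ = weaken bound (Col.solveMode-exec {g = g} 1≤p 1≤r P low R pr≤f
    λ i j i<p j<r → j , i , j<r , i<p , col-prod i j , address Col.Z i j)
    where
    address : ∀ z i j → z + i * 1 + j * p ≡ z + j * p + i
    address z i j = trans (cong (λ i → z + i + j * p) (*-identityʳ i))
      (trans (+-assoc z i (j * p)) (trans (cong (z +_) (+-comm i (j * p))) (sym (+-assoc z (j * p) i))))
    bound : Col.solveTime (2 * ρ) ≤ 91 * P₁₂ + 205 * G
    bound = ≤-trans (solveTime-bound r p k q ρ p r 1≤r 1≤p 1≤k (*-comm p r))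
      (≤-trans (≤-reflexive (cong (λ s → 91 * (r * q * k) + 73 * (s * ρ + p * q * k) + 59 * s) {r * p} {p * r} (*-comm r p)))
        (solve-bound (m≤n+m (r * q * k) (p * q * ℓ)) W≤₁ W≤₂))

  start-exec : Exec start σᵢ 7 (Ready p q r ℓ k (p * q) f m₀)
  start-exec = execOps (ready refl refl refl refl refl refl refl λ _ _ → refl)

  multiply-exec : Exec multiply σᵢ (301 * (P₁₂ + G)) Solved
  multiply-exec = weaken bound
    (execSeq start-exec λ τ₁ _ S₁ →
     execSeq (Row.measure-exec {ρ = rρ₁} (rowMode-exec S₁) (Ready.low S₁)) λ τ₂ fr₂ (R₁ , low₂) →
     let S₂ = keepReady fr₂ S₁ low₂ in
     execSeq (Col.measure-exec {ρ = rρ₂} (colMode-exec S₂) low₂) λ τ₃ fr₃ (R₂ , low₃) →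
     let S₃ = keepReady fr₃ S₂ low₃
         R₁′ = subst Row.Radius (sym (unchanged fr₃ rρ₁ tt)) R₁
         W≤₁ = double-V {v = λ-row A ℓ} {q * r * ℓ} (row-radius R₁′)
         W≤₁′ = subst (λ s → p * r * reg τ₃ rρ₁ + q * r * ℓ ≤ 2 * (p * r * (1 ⊔ λ-row A ℓ) + s * ℓ)) (*-comm q r) W≤₁
         W≤₂ = double-V {v = λ-col B k} {p * q * k} (col-radius R₂) in
     execSeq (chooseMode-exec S₃) λ τ₄ _ (em , mode) →
     solve τ₄ (λ a a<f → trans (cong (λ m → m a) em) (low₃ a a<f)) R₁′ R₂ W≤₁′ W≤₂ mode)
    where
    solve : ∀ τ {ρ₁ ρ₂} → Row.Low τ → Row.Radius ρ₁ → Col.Radius ρ₂ →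
            (let c₁ = p * r * ρ₁ + q * r * ℓ ; c₂ = p * r * ρ₂ + p * q * k) → c₁ ≤ 2 * V₁ → c₂ ≤ 2 * V₂ →
            (Core.Params row′ τ × c₁ ≤ c₂) ⊎ (Core.Params col′ τ × c₂ ≤ c₁) →
            Exec solveMode τ (91 * P₁₂ + 205 * G) Solved
    solve τ low R₁ R₂ h₁ h₂ (inj₁ (P , c≤)) = row-solve P low R₁ h₁ (≤-trans c≤ h₂)
    solve τ low R₁ R₂ h₁ h₂ (inj₂ (P , c≤)) = col-solve P low R₂ (≤-trans c≤ h₁) h₂
    bound : 7 + (18 + (ℓ * (p * (q * 72)) + 2) + (18 + (k * (r * (q * 72)) + 2) + (49 + (91 * P₁₂ + 205 * G))))
            ≤ 301 * (P₁₂ + G)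
    bound = begin
      7 + (18 + (ℓ * (p * (q * 72)) + 2) + (18 + (k * (r * (q * 72)) + 2) + (49 + (91 * P₁₂ + 205 * G))))
        ≡⟨ lemma p q r ℓ k G ⟩
      -- The straight-line commands outside `solveMode` take 96 steps. The two measuring runs
      -- contribute 72 to the 163 and solving 91; 301 is 96 + 205.
      96 * 1 + 163 * P₁₂ + 205 * G
        ≤⟨ +-monoˡ-≤ (205 * G) (+-mono-≤ (*-monoʳ-≤ 96 1≤G) (*-monoˡ-≤ P₁₂ (m≤m+n 163 138))) ⟩
      96 * G + 301 * P₁₂ + 205 * G
        ≡⟨ lemma′ P₁₂ G ⟩
      301 * (P₁₂ + G) ∎
      where
      open ≤-Reasoning
      lemma : ∀ p q r ℓ k g →
        7 + (18 + (ℓ * (p * (q * 72)) + 2) + (18 + (k * (r * (q * 72)) + 2) + (49 + (91 * (p * q * ℓ + r * q * k) + 205 * g))))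
        ≡ 96 * 1 + 163 * (p * q * ℓ + r * q * k) + 205 * g
      lemma = solve-∀
      lemma′ : ∀ a g → 96 * g + 301 * a + 205 * g ≡ 301 * (a + g)
      lemma′ = solve-∀

-- From commands to the machine, and the bound on words

nth-length : ∀ {X : Set} {d : X} xs → nth d xs (length xs) ≡ d
nth-length []       = refl
nth-length (x ∷ xs) = nth-length xs

-- The default value `q` caps the minimum. This makes the running time, and with it the word length,
-- polynomial in p + q + r.
λ-row≤ : ∀ {p q} (A : Matrix01 p q) ℓ → λ-row A ℓ ≤ q
λ-row≤ {q = q} A ℓ = min≤⊤ q (map (radius A) (subsetsOfSize (ℓ ⊓ 2 ^ q) (cube q)))

-- Abstract, so that the machine is never run during type checking.
abstract
  compile-exec : ∀ c {σ t} {Q : State → Set} → T (wellFormed c) → pc σ ≡ 0 → Exec c σ t Q →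
                 (let P = compile 0 c) →
                 ∃[ s ] s ≤ t × Halted P (run P s σ) ×
                   ∃[ τ ] Q τ × (∀ x → reg (run P s σ) x ≡ reg τ x) × (∀ a → mem (run P s σ) a ≡ mem τ a)
  compile-exec c {σ@(state .0 ρ m)} w refl (exec-by q h) =
    cost c σ , h , halted , eval c σ , q , (λ x → cong (λ υ → reg υ x) final) , (λ a → cong (λ υ → mem υ a) final)
    where
    final : run (compile 0 c) (cost c σ) σ ≡ at (size c) (eval c σ)
    final = compile-correct (compile 0 c) c 0 σ w (CodeAt-refl (compile 0 c))
    halted : Halted (compile 0 c) (run (compile 0 c) (cost c σ) σ)
    halted = trans (cong (λ υ → nth halt (compile 0 c) (pc υ)) final)
      (trans (cong (nth halt (compile 0 c)) (sym (length-compile 0 c))) (nth-length (compile 0 c)))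

-- Words grow by at most n ^ 3 in each of O(n ^ 3) steps, which gives a constant times n ^ 6. Since
-- n is at least 3, the constant is absorbed by n ^ 7: for c = 301 it is 1205, between 3 ^ 6 and 3 ^
-- 7. Hence the exponent 13.
polynomial : ∀ n c t → 3 ≤ n → 1 + c * 4 ≤ 3 ^ 7 → (let n³ = n * n * n) → t ≤ c * (4 * n³) → n³ + t * n³ ≤ n ^ 13
polynomial n c t 3≤n c≤ h = begin
  n³ + t * n³                   ≤⟨ +-mono-≤ (≤-trans (≤-reflexive (sym (*-identityʳ n³))) (*-monoʳ-≤ n³ 1≤n³))
                                     (*-monoˡ-≤ n³ h) ⟩
  n³ * n³ + c * (4 * n³) * n³   ≡⟨ collect n³ c 4 ⟩
  (1 + c * 4) * (n³ * n³)       ≤⟨ *-monoˡ-≤ (n³ * n³) (≤-trans c≤ (^-monoˡ-≤ 7 3≤n)) ⟩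
  n ^ 7 * (n³ * n³)             ≡⟨ cong (n ^ 7 *_) (sixth n) ⟩
  n ^ 7 * n ^ 6                 ≡⟨ ^-distribˡ-+-* n 7 6 ⟨
  n ^ 13                        ∎
  where
  open ≤-Reasoning
  n³ = n * n * n
  1≤n : 1 ≤ n
  1≤n = ≤-trans (s≤s z≤n) 3≤n
  1≤n³ : 1 ≤ n³
  1≤n³ = *-mono-≤ (*-mono-≤ 1≤n 1≤n) 1≤n
  collect : ∀ a c d → a * a + c * (d * a) * a ≡ (1 + c * d) * (a * a)
  collect = solve-∀
  sixth : ∀ n → n * n * n * (n * n * n) ≡ n * (n * (n * (n * (n * (n * 1)))))
  sixth = solve-∀

module _ {p q r : ℕ} (A : Matrix01 p q) (B : Matrix01 q r) (ℓ k : ℕ)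
         (1≤q : 1 ≤ q) (1≤ℓ : 1 ≤ ℓ) (ℓ≤p : ℓ ≤ p) (1≤k : 1 ≤ k) (k≤r : k ≤ r) where
  open Instance A B ℓ k 1≤q 1≤ℓ ℓ≤p 1≤k k≤r

  n : ℕ
  n = p + q + r

  p≤n : p ≤ n
  p≤n = ≤-trans (m≤m+n p q) (m≤m+n (p + q) r)

  q≤n : q ≤ n
  q≤n = ≤-trans (m≤n+m q p) (m≤m+n (p + q) r)

  r≤n : r ≤ n
  r≤n = m≤n+m r (p + q)

  1≤n : 1 ≤ n
  1≤n = ≤-trans 1≤p p≤n

  size≤ : P₁₂ + G ≤ 4 * (n * n * n)
  size≤ = begin
    P₁₂ + G
      ≤⟨ +-mono-≤
           (+-mono-≤ (*-mono-≤ (*-mono-≤ p≤n q≤n) (≤-trans ℓ≤p p≤n)) (*-mono-≤ (*-mono-≤ r≤n q≤n) (≤-trans k≤r r≤n)))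
           (≤-trans (m⊓n≤m V₁ V₂)
             (+-mono-≤ (*-mono-≤ (*-mono-≤ p≤n r≤n) (≤-trans (⊔-lub 1≤q (λ-row≤ A ℓ)) q≤n))
                       (*-mono-≤ (*-mono-≤ r≤n q≤n) (≤-trans ℓ≤p p≤n)))) ⟩
    (n * n * n + n * n * n) + (n * n * n + n * n * n)
      ≡⟨ fourfold (n * n * n) ⟩
    4 * (n * n * n) ∎
    where
    open ≤-Reasoning
    fourfold : ∀ a → (a + a) + (a + a) ≡ 4 * a
    fourfold = solve-∀

  input-capped : Capped n (n * n * n) σᵢ
  input-capped = capped (λ x → ≤-trans (regs≤n x) (cap-mono 1≤n 0 (level x) ≤-refl z≤n))
    (λ a → ≤-trans (m₀≤1 a) (*-mono-≤ (*-mono-≤ 1≤n 1≤n) 1≤n)) ≤-refl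
    where
    regs≤n : ∀ x → nth 0 (p ∷ q ∷ r ∷ ℓ ∷ k ∷ []) x ≤ n
    regs≤n 0 = p≤n
    regs≤n 1 = q≤n
    regs≤n 2 = r≤n
    regs≤n 3 = ≤-trans ℓ≤p p≤n
    regs≤n 4 = ≤-trans k≤r r≤n
    regs≤n (suc (suc (suc (suc (suc x))))) = z≤n

  words-bounded : ∀ P c {s} → T (all levelled P) → 1 + c * 4 ≤ 3 ^ 7 → s ≤ c * (P₁₂ + G) →
                  WordsBounded (n ^ 13) (run P s σᵢ)
  words-bounded P c {s} h c≤ s≤ x with capped-words 1≤n (run-capped 1≤n P σᵢ s h input-capped) x
  ... | hr , hm = ≤-trans hr W , ≤-trans hm W
    where
    W = polynomial n c s (+-mono-≤ (+-mono-≤ 1≤p 1≤q) 1≤r) c≤ (≤-trans s≤ (*-monoʳ-≤ c size≤))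

theorem5 : ∃[ P ] ∃[ c ] ∃[ d ]
    ∀ (p q r : ℕ) → 1 ≤ q →
    (A : Matrix01 p q) (B : Matrix01 q r) →
    (ℓ k : ℕ) → 1 ≤ ℓ → ℓ ≤ p → 1 ≤ k → k ≤ r →
    ∃[ t ]
    ( t ≤ c * ( p * q * ℓ + r * q * k
    + ( (p * r * (1 ⊔ λ-row A ℓ) + r * q * ℓ)
    ⊓ (p * r * (1 ⊔ λ-col B k) + p * q * k) ) )
    × Halted P (run P t (input A B ℓ k))
    × Outputs (run P t (input A B ℓ k)) (product A B)
    × (∀ s → s ≤ t → WordsBounded ((p + q + r) ^ d) (run P s (input A B ℓ k))) )
theorem5 = compile 0 multiply , 301 , 13 , λ p q r 1≤q A B ℓ k 1≤ℓ ℓ≤p 1≤k k≤r →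
  let open Instance A B ℓ k 1≤q 1≤ℓ ℓ≤p 1≤k k≤r
      t , t≤ , halted , τ , (base≡0 , entries) , regs , cells = compile-exec multiply tt refl multiply-exec
  in t , t≤ , halted ,
     (λ i j → trans (cells _) (trans
       (cong (λ b → mem τ (b + toℕ i * r + toℕ j)) (trans (regs rP) base≡0))
       (trans (entries (toℕ i) (toℕ j) (toℕ<n i) (toℕ<n j)) (sym (product≡g i j))))) ,
     -- Both occurrences of `tt` are evaluations: every compiled instruction is `levelled`, and 1205
     -- is at most 3 ^ 7.
     λ s s≤t → words-bounded A B ℓ k 1≤q 1≤ℓ ℓ≤p 1≤k k≤r (compile 0 multiply) 301 tt (≤ᵇ⇒≤ _ _ tt) (≤-trans s≤t t≤)
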